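{- Let $p_{\xi}(n)$ be defined by $\sum_{n\ge 0} p_{\xi}(n)q^n=\xi(q)$. Then, as identities of $q$-series, $$2\sum_{n=0}^{\infty} p_{\xi}(2n+1)q^{n+1} = \frac{f_{6}^6f_{12}}{f_3^4f_{24}^2} - f(q^{12}) +4q\frac{f_2^2f_{8}^2}{f_1f_3f_4}$$ and $$\sum_{n=0}^{\infty} p_{\xi}(2n)q^{n} = q\frac{f_{6}^8f_{24}^2}{f_3^4f_{12}^5} - q^4\omega(-q^{6}) + \frac{f_4^5}{f_1f_3f_{8}^2}.$$
   Context: For $|q|<1$, $(a;q)_0=1$, $(a;q)_n=(1-a)(1-aq)\cdots(1-aq^{n-1})$, $(a;q)_\infty=\lim_{n\to\infty}(a;q)_n$, and $f_k:=(q^k;q^k)_\infty$. The Gordon–McIntosh third order mock theta function is $\xi(q)=1+2\sum_{n\ge1}\frac{q^{6n^2-6n+1}}{(q;q^6)_n(q^5;q^6)_n}$, and $p_\xi(n)$ denotes its $n$-th coefficient. The third order mock theta functions $\omega$ and $f$ are $\omega(q)=\sum_{n\ge0}\frac{q^{2n(n+1)}}{(q;q^2)_{n+1}^2}$ and $f(q)=\sum_{n\ge0}\frac{q^{n^2}}{(-q;q)_n^2}$. -}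

module Defs where

open import Data.Nat as ℕ using (ℕ; zero; suc; _∸_; NonZero)
open import Data.Nat.DivMod using (_/_; _%_)
open import Data.Integer as ℤ using (ℤ; +_; -_)
open import Data.List using (List; []; _∷_; map; upTo; foldr)
open import Relation.Nullary.Decidable using (does)
open import Data.Bool using (if_then_else_)

-- Formal power series in q with integer coefficients: n ↦ coefficient of q^n.
PS : Set
PS = ℕ → ℤ

sumTo : (ℕ → ℤ) → ℕ → ℤ
sumTo h zero = h zero
sumTo h (suc n) = sumTo h n ℤ.+ h (suc n)

0ₛ : PS
0ₛ _ = + 0

qpow : ℕ → PS
qpow k n = if does (n ℕ.≟ k) then + 1 else + 0

1ₛ : PS
1ₛ = qpow 0

infixl 6 _+ₛ_ _-ₛ_
infixl 7 _*ₛ_ _·ₛ_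
infixr 8 _^ₛ_

_+ₛ_ : PS → PS → PS
(f +ₛ g) n = f n ℤ.+ g n

_-ₛ_ : PS → PS → PS
(f -ₛ g) n = f n ℤ.- g n

_·ₛ_ : ℤ → PS → PS
(c ·ₛ f) n = c ℤ.* f n

_*ₛ_ : PS → PS → PS
(f *ₛ g) n = sumTo (λ i → f i ℤ.* g (n ∸ i)) n

_^ₛ_ : PS → ℕ → PS
f ^ₛ zero = 1ₛ
f ^ₛ suc k = f *ₛ (f ^ₛ k)

prodL : List PS → PS
prodL = foldr _*ₛ_ 1ₛ

oneMinus : ℤ → ℕ → PS
oneMinus c m = 1ₛ -ₛ (c ·ₛ qpow m)

-- 1/(1 - c q^m) = Σ_j c^j q^{mj}, for m ≥ 1 (the case m = 0 is never used).
geomInv : ℤ → ℕ → PS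
geomInv c zero = 0ₛ
geomInv c (suc m) n =
  if does (n % suc m ℕ.≟ 0) then c ℤ.^ (n / suc m) else + 0

poch : ℤ → ℕ → ℕ → ℕ → PS
poch c a d n = prodL (map (λ j → oneMinus c (a ℕ.+ d ℕ.* j)) (upTo n))

-- 1/(c q^a ; q^d)_n  (used only with a ≥ 1)
pochInv : ℤ → ℕ → ℕ → ℕ → PS
pochInv c a d n = prodL (map (λ j → geomInv c (a ℕ.+ d ℕ.* j)) (upTo n))

-- f_k = (q^k;q^k)_∞ (k ≥ 1). The coefficient of q^n only depends on the
-- factors (1 - q^{km}) with m ≤ n, so it is computed from that finite product.
fq : ℕ → PS
fq k n = prodL (map (λ j → oneMinus (+ 1) (k ℕ.* suc j)) (upTo n)) n

-- 1/f_k (k ≥ 1), similarly truncated.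
fqInv : ℕ → PS
fqInv k n = prodL (map (λ j → geomInv (+ 1) (k ℕ.* suc j)) (upTo n)) n

-- Σ_{n≥0} t n, for a family with t n = O(q^n): coefficient N is Σ_{n≤N} (t n) N.
tsum : (ℕ → PS) → PS
tsum t N = sumTo (λ n → t n N) N

-- F(c q^k) for k ≥ 1
dil : ℤ → (k : ℕ) → .{{NonZero k}} → PS → PS
dil c k F n = if does (n % k ℕ.≟ 0) then c ℤ.^ (n / k) ℤ.* F (n / k) else + 0

ξTerm : ℕ → PS
ξTerm zero = 0ₛ
ξTerm (suc m) = qpow (6 ℕ.* n ℕ.* n ∸ 6 ℕ.* n ℕ.+ 1)
                  *ₛ pochInv (+ 1) 1 6 n *ₛ pochInv (+ 1) 5 6 n
  where n = suc m

ξ : PS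
ξ = 1ₛ +ₛ (+ 2) ·ₛ tsum ξTerm

pξ : ℕ → ℤ
pξ = ξ

ω : PS
ω = tsum (λ n → qpow (2 ℕ.* n ℕ.* suc n) *ₛ pochInv (+ 1) 1 2 (suc n) ^ₛ 2)

fmock : PS
fmock = tsum (λ n → qpow (n ℕ.* n) *ₛ pochInv (- + 1) 1 1 n ^ₛ 2)

oddSeries : PS
oddSeries zero = + 0
oddSeries (suc m) = + 2 ℤ.* pξ (2 ℕ.* m ℕ.+ 1)

evenSeries : PS
evenSeries n = pξ (2 ℕ.* n)

-- Write f_k = (q^k;q^k)_∞ and ψ(q) = f₂²/f₁.  The finite products 1/((x;Q)_{n+1} (Q/x;Q)_{n+1}) have a
-- partial fraction expansion with explicit coefficients.  Summed against the finite form of Bailey's lemma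
-- it gives, as n → ∞ in the q-adic topology, the Appell–Lerch series of the mock theta functions, such as
--   f₂ ω(q) = Σ_{r ≥ 0} (-1)^r q^{3r(r+1)} (1 + q^{2r+1}) / (1 - q^{2r+1}),
-- and its plain limit gives ψ² = Σ_{r ≥ 0} (-1)^r q^{r(r+1)} (1 + q^{2r+1}) / (1 - q^{2r+1}).  Splitting the
-- latter according to r mod 3, and using the pentagonal number theorem for f₆, yields
--   ξ(q) = q² ω(q³) + ψ(q)² / f₆.
-- The even and the odd part of f₂ ω are again such series.  Multiplying the expansion with poles at
-- z = q^{±(2r+1)} by the one with poles at z = - q^{±(4j+2)}, respectively z = - q^{±4j}, and separating the
-- poles once more, one finds that ω is the dissection W₀(q²) + q W₁(q²) with
--   W₀ = f₂⁸ f₈² / (f₁⁴ f₄⁵) - q ω(-q²),   2 q W₁ = f₂⁶ f₄ / (f₁⁴ f₈²) - f(q⁴)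
-- (Watson's relation between f and ω).  Finally ψ² = φ(q) f₄² / f₂ with φ(q) = Σ q^{n²}, and φ is dissected by
-- the Jacobi triple product.

module Submission where

open import Algebra.Bundles using (CommutativeRing)
import Algebra.Properties.AbelianGroup as AbelianGroupProperties
import Algebra.Properties.Ring as RingProperties
import Algebra.Properties.Semiring.Exp as SemiringExp
import Algebra.Properties.Semiring.Mult.TCOptimised as SemiringMult
import Algebra.Solver.Ring as RingSolver
open import Algebra.Solver.Ring.AlmostCommutativeRing using (fromCommutativeRing; _-Raw-AlmostCommutative⟶_)
open import Algebra.Structures using (IsCommutativeRing)
open import Data.Bool using (true; false)
open import Data.Integer as ℤ using (ℤ; +_; -[1+_])
import Data.Integer.Properties as ℤ
import Data.Integer.Solver
open import Data.List using (applyUpTo; map; upTo)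
open import Data.Maybe using (Maybe; just; nothing)
open import Data.Nat as ℕ using (ℕ; zero; suc; _∸_; _≤_; _<_; z≤n; s≤s; NonZero)
open import Data.Nat.DivMod using (_/_; _%_; m<n⇒m%n≡m; m≤n⇒[n∸m]%m≡n%m; m/n≡1+[m∸n]/n; m*n%n≡0; m*n/n≡m; m≡m%n+[m/n]*n; [m+kn]%n≡m%n; m/n≤m)
open import Data.Nat.Divisibility using (_∣_; ∣m∣n⇒∣m+n; m%n≡0⇒n∣m; n∣m⇒m%n≡0)
import Data.Nat.Properties as ℕ
import Data.Nat.Solver
open import Data.Product using (_×_; _,_; proj₁; proj₂)
import Data.Sign as Sign
open import Defs
open import Function using (_∘_; id)
open import Level using (_⊔_)
open import Relation.Binary.Bundles using (Setoid)
open import Relation.Binary.PropositionalEquality as ≡ using (_≡_; _≢_; _≗_)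
import Relation.Binary.Reasoning.Setoid as SetoidReasoning
open import Relation.Nullary using (yes; no; contradiction)
open import Relation.Nullary.Decidable using (dec-true; dec-false)

-- There is no variable z and no meromorphic function: each partial fraction identity is proved at
-- one fixed point, as a finite identity between power series over the integers. Of the poles only a
-- bilinear relation between the fractions (`Poles`) survives, and one vanishing sum replaces the
-- comparison at infinity. Elements such as 4 or q^a + q^b need not be units, so they are cancelled
-- from equations instead of being inverted.
--
-- The formulas for W₀ and W₁ multiply two families with disjoint poles. Separating the poles leaves
-- sums of values of one family at a pole of the other. Such a sum is itself a partial fraction
-- expansion, hence a finite product, and the quasi-periodicity of theta functions evaluates its
-- limit as a power of q times an essentially fixed product. The exponents of these powers are
-- quadratic in the index; added to those of the expansion coefficients they give the exponents of
-- the Lerch series of ω and f. The inner products still depend on N when the outer sum is taken, so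
-- all limits carry an explicit precision.

-- Finite sums and products in a commutative ring

module RingKit {c ℓ} (R : CommutativeRing c ℓ) where

  open CommutativeRing R
  open SetoidReasoning setoid
  open SemiringMult semiring renaming (_×_ to _·_)
  private
    module Rₚ = RingProperties ring
    module Aₚ = AbelianGroupProperties +-abelianGroup

  private
    sub-cancel : ∀ x y → (1# + x) - (1# + y) ≈ x - y
    sub-cancel x y = begin
      (1# + x) - (1# + y)          ≈⟨ +-congˡ (sym (Aₚ.⁻¹-∙-comm 1# y)) ⟩
      (1# + x) + (- 1# + - y)      ≈⟨ sym (+-assoc _ _ _) ⟩
      ((1# + x) + - 1#) + - y      ≈⟨ +-congʳ (+-congʳ (+-comm 1# x)) ⟩
      ((x + 1#) + - 1#) + - y      ≈⟨ +-congʳ (+-assoc _ _ _) ⟩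
      (x + (1# + - 1#)) + - y      ≈⟨ +-congʳ (+-congˡ (-‿inverseʳ 1#)) ⟩
      (x + 0#) + - y               ≈⟨ +-congʳ (+-identityʳ x) ⟩
      x - y                        ∎

    -0≈0 : - 0# ≈ 0#
    -0≈0 = Aₚ.ε⁻¹≈ε

  -- With the multiples optimised for type checking, `ι (+ 1)` reduces to `1#` itself, so the
  -- literals `con (+ 1)` in solver equations match the unit of the ring by computation.
  ι : ℤ → Carrier
  ι (+ n)     = n · 1#
  ι -[1+ n ] = - (suc n · 1#)

  private
    ι-⊖ : ∀ m n → ι (m ℤ.⊖ n) ≈ m · 1# - n · 1#
    ι-⊖ m       zero    = sym (trans (+-congˡ -0≈0) (+-identityʳ _))
    ι-⊖ zero    (suc n) = sym (+-identityˡ _)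
    ι-⊖ (suc m) (suc n) = begin
      ι (suc m ℤ.⊖ suc n)     ≡⟨ ≡.cong ι (ℤ.[1+m]⊖[1+n]≡m⊖n m n) ⟩
      ι (m ℤ.⊖ n)             ≈⟨ ι-⊖ m n ⟩
      m · 1# - n · 1#         ≈⟨ sym (sub-cancel _ _) ⟩
      (1# + m · 1#) - (1# + n · 1#) ≈⟨ sym (+-cong (1+× m 1#) (-‿cong (1+× n 1#))) ⟩
      suc m · 1# - suc n · 1# ∎

    ι-+ : ∀ i j → ι (i ℤ.+ j) ≈ ι i + ι j
    ι-+ (+ m)     (+ n)     = ×-homo-+ 1# m n
    ι-+ (+ m)     -[1+ n ] = ι-⊖ m (suc n)
    ι-+ -[1+ m ] (+ n)     = trans (ι-⊖ n (suc m)) (+-comm _ _)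
    ι-+ -[1+ m ] -[1+ n ] = begin
      - (suc (suc (m ℕ.+ n)) · 1#)       ≡⟨ ≡.cong (λ k → - (suc k · 1#)) (≡.sym (ℕ.+-suc m n)) ⟩
      - ((suc m ℕ.+ suc n) · 1#)         ≈⟨ -‿cong (×-homo-+ 1# (suc m) (suc n)) ⟩
      - (suc m · 1# + suc n · 1#)        ≈⟨ sym (Aₚ.⁻¹-∙-comm _ _) ⟩
      - (suc m · 1#) + - (suc n · 1#)    ∎

    ι-neg : ∀ i → ι (ℤ.- i) ≈ - ι i
    ι-neg (+ zero)  = sym -0≈0
    ι-neg (+ suc n) = refl
    ι-neg -[1+ n ]  = sym (Aₚ.⁻¹-involutive _)

    ι-+◃ : ∀ n → ι (Sign.+ ℤ.◃ n) ≈ n · 1#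
    ι-+◃ zero    = refl
    ι-+◃ (suc n) = refl

    ι--◃ : ∀ n → ι (Sign.- ℤ.◃ n) ≈ - (n · 1#)
    ι--◃ zero    = sym -0≈0
    ι--◃ (suc n) = refl

    ×-* : ∀ m n → (m ℕ.* n) · 1# ≈ (m · 1#) * (n · 1#)
    ×-* m n = ×1-homo-* m n

    ι-* : ∀ i j → ι (i ℤ.* j) ≈ ι i * ι j
    ι-* (+ m)     (+ n)     = trans (ι-+◃ (m ℕ.* n)) (×-* m n)
    ι-* (+ m)     -[1+ n ] = trans (ι--◃ (m ℕ.* suc n))
      (trans (-‿cong (×-* m (suc n))) (Rₚ.-‿distribʳ-* _ _))
    ι-* -[1+ m ] (+ n)     = trans (ι--◃ (suc m ℕ.* n))
      (trans (-‿cong (×-* (suc m) n)) (Rₚ.-‿distribˡ-* _ _))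
    ι-* -[1+ m ] -[1+ n ] = trans (ι-+◃ (suc m ℕ.* suc n))
      (trans (×-* (suc m) (suc n)) 
        (trans (sym (Aₚ.⁻¹-involutive _))
          (trans (-‿cong (Rₚ.-‿distribˡ-* _ _)) (Rₚ.-‿distribʳ-* _ _))))

    morphism : ℤ.+-*-rawRing -Raw-AlmostCommutative⟶ fromCommutativeRing R
    morphism = record
      { ⟦_⟧    = ι
      ; +-homo = ι-+
      ; *-homo = ι-*
      ; -‿homo = ι-neg
      ; 0-homo = refl
      ; 1-homo = refl
      }

    ι-≟ : ∀ i j → Maybe (ι i ≈ ι j)
    ι-≟ i j with i ℤ.≟ j
    ... | yes i≡j = just (reflexive (≡.cong ι i≡j))
    ... | no  _   = nothing

  module Solver = RingSolver ℤ.+-*-rawRing (fromCommutativeRing R) morphism ι-≟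

  open Solver public
    using (solve; _:=_; _:+_; _:*_; :-_; _:-_; _:^_; con; Polynomial)

  Σ≤ : (ℕ → Carrier) → ℕ → Carrier
  Σ≤ f zero    = f 0
  Σ≤ f (suc n) = Σ≤ f n + f (suc n)

  Π< : (ℕ → Carrier) → ℕ → Carrier
  Π< f zero    = 1#
  Π< f (suc n) = Π< f n * f n

  Σ-cong≤ : ∀ {f g} n → (∀ i → i ≤ n → f i ≈ g i) → Σ≤ f n ≈ Σ≤ g n
  Σ-cong≤ zero    e = e 0 z≤n
  Σ-cong≤ (suc n) e =
    +-cong (Σ-cong≤ n (λ i i≤n → e i (ℕ.m≤n⇒m≤1+n i≤n))) (e (suc n) ℕ.≤-refl)

  Σ-cong : ∀ {f g} n → (∀ i → f i ≈ g i) → Σ≤ f n ≈ Σ≤ g n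
  Σ-cong n e = Σ-cong≤ n (λ i _ → e i)

  Π-cong< : ∀ {f g} n → (∀ i → i < n → f i ≈ g i) → Π< f n ≈ Π< g n
  Π-cong< zero    e = refl
  Π-cong< (suc n) e =
    *-cong (Π-cong< n (λ i i<n → e i (ℕ.m≤n⇒m≤1+n i<n))) (e n ℕ.≤-refl)

  Π-cong : ∀ {f g} n → (∀ i → f i ≈ g i) → Π< f n ≈ Π< g n
  Π-cong n e = Π-cong< n (λ i _ → e i)

  private
    interchange+ : ∀ a b c d → (a + b) + (c + d) ≈ (a + c) + (b + d)
    interchange+ = solve 4 (λ a b c d → (a :+ b) :+ (c :+ d) := (a :+ c) :+ (b :+ d)) refl

    interchange* : ∀ a b c d → (a * b) * (c * d) ≈ (a * c) * (b * d)
    interchange* = solve 4 (λ a b c d → (a :* b) :* (c :* d) := (a :* c) :* (b :* d)) refl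

  Σ-+ : ∀ f g n → Σ≤ (λ i → f i + g i) n ≈ Σ≤ f n + Σ≤ g n
  Σ-+ f g zero    = refl
  Σ-+ f g (suc n) = trans (+-congʳ (Σ-+ f g n)) (interchange+ _ _ _ _)

  Σ-*ˡ : ∀ x f n → Σ≤ (λ i → x * f i) n ≈ x * Σ≤ f n
  Σ-*ˡ x f zero    = refl
  Σ-*ˡ x f (suc n) = trans (+-congʳ (Σ-*ˡ x f n)) (sym (distribˡ _ _ _))

  Σ-*ʳ : ∀ x f n → Σ≤ (λ i → f i * x) n ≈ Σ≤ f n * x
  Σ-*ʳ x f zero    = refl
  Σ-*ʳ x f (suc n) = trans (+-congʳ (Σ-*ʳ x f n)) (sym (distribʳ _ _ _))

  Σ-0 : ∀ n → Σ≤ (λ _ → 0#) n ≈ 0#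
  Σ-0 zero    = refl
  Σ-0 (suc n) = trans (+-identityʳ _) (Σ-0 n)

  Σ-first : ∀ f n → Σ≤ f (suc n) ≈ f 0 + Σ≤ (λ i → f (suc i)) n
  Σ-first f zero    = refl
  Σ-first f (suc n) = trans (+-congʳ (Σ-first f n)) (+-assoc _ _ _)

  Σ-rev : ∀ f n → Σ≤ f n ≈ Σ≤ (λ i → f (n ∸ i)) n
  Σ-rev f zero    = refl
  Σ-rev f (suc n) = begin
    Σ≤ f n + f (suc n)                       ≈⟨ +-comm _ _ ⟩
    f (suc n) + Σ≤ f n                       ≈⟨ +-congˡ (Σ-rev f n) ⟩
    f (suc n) + Σ≤ (λ i → f (n ∸ i)) n       ≈⟨ sym (Σ-first (λ i → f (suc n ∸ i)) n) ⟩
    Σ≤ (λ i → f (suc n ∸ i)) (suc n)         ∎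

  Σ-swap : ∀ (a : ℕ → ℕ → Carrier) m n →
           Σ≤ (λ i → Σ≤ (a i) n) m ≈ Σ≤ (λ j → Σ≤ (λ i → a i j) m) n
  Σ-swap a zero    n = refl
  Σ-swap a (suc m) n = trans (+-congʳ (Σ-swap a m n)) (sym (Σ-+ _ _ n))

  -- Both sides run over j ≤ i ≤ n, with i = j + k on the right. The associativity of the Cauchy
  -- product and the finite Bailey lemma rest on this exchange.
  Σ-triangle : ∀ (a : ℕ → ℕ → Carrier) n →
               Σ≤ (λ i → Σ≤ (a i) i) n ≈ Σ≤ (λ j → Σ≤ (λ k → a (j ℕ.+ k) j) (n ∸ j)) n
  Σ-triangle a zero    = refl
  Σ-triangle a (suc n) = begin
    Σ≤ (λ i → Σ≤ (a i) i) n + (Σ≤ (a (suc n)) n + a (suc n) (suc n))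
      ≈⟨ sym (+-assoc _ _ _) ⟩
    (Σ≤ (λ i → Σ≤ (a i) i) n + Σ≤ (a (suc n)) n) + a (suc n) (suc n)
      ≈⟨ +-cong (+-congʳ (Σ-triangle a n)) (last (suc n)) ⟩
    (Σ≤ inner n + Σ≤ (a (suc n)) n) + Σ≤ (λ k → a (suc n ℕ.+ k) (suc n)) (suc n ∸ suc n)
      ≈⟨ +-congʳ (sym (Σ-+ _ _ n)) ⟩
    Σ≤ (λ j → inner j + a (suc n) j) n + _
      ≈⟨ +-congʳ (Σ-cong≤ n step) ⟩
    Σ≤ (λ j → Σ≤ (λ k → a (j ℕ.+ k) j) (suc n ∸ j)) (suc n) ∎
    where
    inner : ℕ → Carrier
    inner j = Σ≤ (λ k → a (j ℕ.+ k) j) (n ∸ j)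
    last : ∀ m → a m m ≈ Σ≤ (λ k → a (m ℕ.+ k) m) (m ∸ m)
    last m rewrite ℕ.n∸n≡0 m | ℕ.+-identityʳ m = refl
    step : ∀ j → j ≤ n → inner j + a (suc n) j ≈ Σ≤ (λ k → a (j ℕ.+ k) j) (suc n ∸ j)
    step j j≤n rewrite ℕ.+-∸-assoc 1 j≤n | ℕ.+-suc j (n ∸ j) | ℕ.m+[n∸m]≡n j≤n = refl

  Π-first : ∀ f n → Π< f (suc n) ≈ f 0 * Π< (λ i → f (suc i)) n
  Π-first f zero    = *-comm _ _
  Π-first f (suc n) = trans (*-congʳ (Π-first f n)) (*-assoc _ _ _)

  Π-* : ∀ f g n → Π< (λ i → f i * g i) n ≈ Π< f n * Π< g n
  Π-* f g zero    = sym (*-identityˡ 1#)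
  Π-* f g (suc n) = trans (*-congʳ (Π-* f g n)) (interchange* _ _ _ _)

  Π-+ : ∀ f m n → Π< f (m ℕ.+ n) ≈ Π< f m * Π< (λ i → f (m ℕ.+ i)) n
  Π-+ f m zero    rewrite ℕ.+-identityʳ m = sym (*-identityʳ _)
  Π-+ f m (suc n) rewrite ℕ.+-suc m n =
    trans (*-congʳ (Π-+ f m n)) (*-assoc _ _ _)

  Π-2* : ∀ f n → Π< f (2 ℕ.* n) ≈ Π< (λ i → f (2 ℕ.* i) * f (suc (2 ℕ.* i))) n
  Π-2* f zero    = refl
  Π-2* f (suc n) rewrite ℕ.+-suc n (n ℕ.+ 0) =
    trans (*-assoc _ _ _) (*-congʳ (Π-2* f n))

  Π-3* : ∀ f n → Π< f (3 ℕ.* n) ≈ Π< (λ i → f (3 ℕ.* i) * f (1 ℕ.+ 3 ℕ.* i) * f (2 ℕ.+ 3 ℕ.* i)) n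
  Π-3* f zero    = refl
  Π-3* f (suc n) = trans (reflexive (≡.cong (Π< f) (ℕ.*-suc 3 n)))
    (trans (trans (*-congʳ (*-assoc _ _ _)) (*-assoc _ _ _)) (*-congʳ (Π-3* f n)))

  Σ-2* : ∀ f n → Σ≤ f (1 ℕ.+ 2 ℕ.* n) ≈ Σ≤ (λ i → f (2 ℕ.* i) + f (1 ℕ.+ 2 ℕ.* i)) n
  Σ-2* f zero    = refl
  Σ-2* f (suc n) = trans (+-assoc _ _ _)
    (+-congʳ (trans (reflexive (≡.cong (Σ≤ f) (ℕ.suc-injective (ℕ.*-suc 2 n)))) (Σ-2* f n)))

  Σ-3* : ∀ f n → Σ≤ f (2 ℕ.+ 3 ℕ.* n) ≈ Σ≤ (λ i → f (3 ℕ.* i) + f (1 ℕ.+ 3 ℕ.* i) + f (2 ℕ.+ 3 ℕ.* i)) n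
  Σ-3* f zero    = refl
  Σ-3* f (suc n) = trans (trans (+-congʳ (+-assoc _ _ _)) (+-assoc _ _ _))
    (+-congʳ (trans (reflexive (≡.cong (Σ≤ f) (ℕ.suc-injective (ℕ.*-suc 3 n)))) (Σ-3* f n)))

  Σ-middle : ∀ f m n → Σ≤ f (m ℕ.+ suc n) ≈ Σ≤ f m + Σ≤ (λ l → f (m ℕ.+ suc l)) n
  Σ-middle f m zero    rewrite ℕ.+-suc m 0 | ℕ.+-identityʳ m = refl
  Σ-middle f m (suc n) rewrite ℕ.+-suc m (suc n) = trans (+-congʳ (Σ-middle f m n)) (+-assoc _ _ _)

-- The ring of formal power series over the integers

module ℤΣ = RingKit ℤ.+-*-commutativeRing
open ℤΣ using () renaming (Σ≤ to ℤΣ≤)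

sumTo≡Σ≤ : ∀ f n → sumTo f n ≡ ℤΣ≤ f n
sumTo≡Σ≤ f zero    = ≡.refl
sumTo≡Σ≤ f (suc n) = ≡.cong (ℤ._+ f (suc n)) (sumTo≡Σ≤ f n)

-- A record rather than the function type ∀ n → F n ≡ G n, so that F and G can be inferred.
infix 4 _≐_
record _≐_ (F G : PS) : Set where
  constructor ptw
  field
    at : ∀ n → F n ≡ G n
open _≐_ public

negₛ : PS → PS
negₛ F n = ℤ.- F n

private
  conv : PS → PS → ℕ → ℤ
  conv F G n = ℤΣ≤ (λ i → F i ℤ.* G (n ∸ i)) n

  *≡conv : ∀ F G n → (F *ₛ G) n ≡ conv F G n
  *≡conv F G n = sumTo≡Σ≤ (λ i → F i ℤ.* G (n ∸ i)) n

  *ₛ-comm : ∀ F G → F *ₛ G ≗ G *ₛ F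
  *ₛ-comm F G n = begin
    (F *ₛ G) n                                      ≡⟨ *≡conv F G n ⟩
    conv F G n                                      ≡⟨ ℤΣ.Σ-rev _ n ⟩
    ℤΣ≤ (λ i → F (n ∸ i) ℤ.* G (n ∸ (n ∸ i))) n     ≡⟨ ℤΣ.Σ-cong≤ n flip ⟩
    conv G F n                                      ≡⟨ *≡conv G F n ⟨
    (G *ₛ F) n                                      ∎
    where
    open ≡.≡-Reasoning
    flip : ∀ i → i ≤ n → F (n ∸ i) ℤ.* G (n ∸ (n ∸ i)) ≡ G i ℤ.* F (n ∸ i)
    flip i i≤n = ≡.trans (≡.cong (λ k → F (n ∸ i) ℤ.* G k) (ℕ.m∸[m∸n]≡n i≤n))
                         (ℤ.*-comm (F (n ∸ i)) (G i))

  *ₛ-assoc : ∀ F G H → (F *ₛ G) *ₛ H ≗ F *ₛ (G *ₛ H)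
  *ₛ-assoc F G H n = begin
    ((F *ₛ G) *ₛ H) n
      ≡⟨ *≡conv (F *ₛ G) H n ⟩
    ℤΣ≤ (λ i → (F *ₛ G) i ℤ.* H (n ∸ i)) n
      ≡⟨ ℤΣ.Σ-cong n (λ i → ≡.trans (≡.cong (ℤ._* H (n ∸ i)) (*≡conv F G i))
                                    (≡.sym (ℤΣ.Σ-*ʳ (H (n ∸ i)) _ i))) ⟩
    ℤΣ≤ (λ i → ℤΣ≤ (λ j → F j ℤ.* G (i ∸ j) ℤ.* H (n ∸ i)) i) n
      ≡⟨ ℤΣ.Σ-triangle (λ i j → F j ℤ.* G (i ∸ j) ℤ.* H (n ∸ i)) n ⟩
    ℤΣ≤ (λ j → ℤΣ≤ (λ k → F j ℤ.* G (j ℕ.+ k ∸ j) ℤ.* H (n ∸ (j ℕ.+ k))) (n ∸ j)) n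
      ≡⟨ ℤΣ.Σ-cong n (λ j → ≡.trans (ℤΣ.Σ-cong (n ∸ j) (reindex j))
                                    (ℤΣ.Σ-*ˡ (F j) _ (n ∸ j))) ⟩
    ℤΣ≤ (λ j → F j ℤ.* conv G H (n ∸ j)) n
      ≡⟨ ℤΣ.Σ-cong n (λ j → ≡.cong (F j ℤ.*_) (≡.sym (*≡conv G H (n ∸ j)))) ⟩
    ℤΣ≤ (λ j → F j ℤ.* (G *ₛ H) (n ∸ j)) n
      ≡⟨ *≡conv F (G *ₛ H) n ⟨
    (F *ₛ (G *ₛ H)) n ∎
    where
    open ≡.≡-Reasoning
    reindex : ∀ j k → F j ℤ.* G (j ℕ.+ k ∸ j) ℤ.* H (n ∸ (j ℕ.+ k))
                    ≡ F j ℤ.* (G k ℤ.* H (n ∸ j ∸ k))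
    reindex j k rewrite ℕ.m+n∸m≡n j k | ℕ.∸-+-assoc n j k = ℤ.*-assoc (F j) _ _

qpow-≡ : ∀ k → qpow k k ≡ + 1
qpow-≡ k rewrite dec-true (k ℕ.≟ k) ≡.refl = ≡.refl

qpow-≢ : ∀ {k n} → n ≢ k → qpow k n ≡ + 0
qpow-≢ {k} {n} n≢k rewrite dec-false (n ℕ.≟ k) n≢k = ≡.refl

private
  Σ-qpow : ∀ k (g : ℕ → ℤ) n → k ≤ n → ℤΣ≤ (λ i → qpow k i ℤ.* g i) n ≡ g k
  Σ-qpow-0 : ∀ k (g : ℕ → ℤ) n → n < k → ℤΣ≤ (λ i → qpow k i ℤ.* g i) n ≡ + 0
  Σ-qpow-0 k g n n<k = ≡.trans (ℤΣ.Σ-cong≤ n vanish) (ℤΣ.Σ-0 n)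
    where
    vanish : ∀ i → i ≤ n → qpow k i ℤ.* g i ≡ + 0
    vanish i i≤n rewrite qpow-≢ {k} {i} (ℕ.<⇒≢ (ℕ.≤-<-trans i≤n n<k)) = ≡.refl
  Σ-qpow zero g zero _ = ℤ.*-identityˡ (g 0)
  Σ-qpow k g (suc n) k≤ with k ℕ.≟ suc n
  ... | yes ≡.refl = ≡.trans
    (≡.cong₂ ℤ._+_ (Σ-qpow-0 (suc n) g n ℕ.≤-refl)
                   (≡.trans (≡.cong (ℤ._* g (suc n)) (qpow-≡ (suc n))) (ℤ.*-identityˡ _)))
    (ℤ.+-identityˡ _)
  ... | no k≢ = ≡.trans
    (≡.cong₂ ℤ._+_ (Σ-qpow k g n (ℕ.≤-pred (ℕ.≤∧≢⇒< k≤ k≢)))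
                   (≡.cong (ℤ._* g (suc n)) (qpow-≢ (λ e → k≢ (≡.sym e)))))
    (ℤ.+-identityʳ _)

qpow-*-≥ : ∀ k F n → k ≤ n → (qpow k *ₛ F) n ≡ F (n ∸ k)
qpow-*-≥ k F n k≤n = ≡.trans (*≡conv (qpow k) F n) (Σ-qpow k (λ i → F (n ∸ i)) n k≤n)

qpow-*-< : ∀ k F n → n < k → (qpow k *ₛ F) n ≡ + 0
qpow-*-< k F n n<k = ≡.trans (*≡conv (qpow k) F n) (Σ-qpow-0 k (λ i → F (n ∸ i)) n n<k)

private
  *ₛ-cong : ∀ {F F′ G G′} → F ≗ F′ → G ≗ G′ → F *ₛ G ≗ F′ *ₛ G′
  *ₛ-cong {F} {F′} {G} {G′} e e′ n = ≡.trans (*≡conv F G n)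
    (≡.trans (ℤΣ.Σ-cong n (λ i → ≡.cong₂ ℤ._*_ (e i) (e′ (n ∸ i)))) (≡.sym (*≡conv F′ G′ n)))

  *ₛ-identityˡ : ∀ F → 1ₛ *ₛ F ≗ F
  *ₛ-identityˡ F n = qpow-*-≥ 0 F n z≤n

  *ₛ-distribˡ : ∀ F G H → F *ₛ (G +ₛ H) ≗ F *ₛ G +ₛ F *ₛ H
  *ₛ-distribˡ F G H n = begin
    (F *ₛ (G +ₛ H)) n            ≡⟨ *≡conv F (G +ₛ H) n ⟩
    conv F (G +ₛ H) n            ≡⟨ ℤΣ.Σ-cong n (λ i → ℤ.*-distribˡ-+ (F i) _ _) ⟩
    _                            ≡⟨ ℤΣ.Σ-+ _ _ n ⟩
    conv F G n ℤ.+ conv F H n    ≡⟨ ≡.cong₂ ℤ._+_ (*≡conv F G n) (*≡conv F H n) ⟨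
    (F *ₛ G +ₛ F *ₛ H) n         ∎
    where open ≡.≡-Reasoning

-- Opaque copies of the operations on power series: unification treats them as constructors.
opaque
  infixl 6 _⊞_
  infixl 7 _⊛_
  _⊞_ _⊛_ : PS → PS → PS
  _⊞_ = _+ₛ_
  _⊛_ = _*ₛ_

  ⊟_ : PS → PS
  ⊟ F = negₛ F

  q^_ : ℕ → PS
  q^_ = qpow

  𝟘 𝟙 : PS
  𝟘 = 0ₛ
  𝟙 = 1ₛ

  isCommutativeRing : IsCommutativeRing _≐_ _⊞_ _⊛_ ⊟_ 𝟘 𝟙
  isCommutativeRing = record
    { isRing = record
      { +-isAbelianGroup = record
        { isGroup = record
          { isMonoid = record
            { isSemigroup = record
              { isMagma = record
                { isEquivalence = record
                  { refl = ptw λ _ → ≡.refl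
                  ; sym = λ e → ptw λ n → ≡.sym (at e n)
                  ; trans = λ e e′ → ptw λ n → ≡.trans (at e n) (at e′ n)
                  }
                ; ∙-cong = λ e e′ → ptw λ n → ≡.cong₂ ℤ._+_ (at e n) (at e′ n)
                }
              ; assoc = λ F G H → ptw λ n → ℤ.+-assoc (F n) (G n) (H n)
              }
            ; identity = (λ F → ptw λ n → ℤ.+-identityˡ (F n)) , (λ F → ptw λ n → ℤ.+-identityʳ (F n))
            }
          ; inverse = (λ F → ptw λ n → ℤ.+-inverseˡ (F n)) , (λ F → ptw λ n → ℤ.+-inverseʳ (F n))
          ; ⁻¹-cong = λ e → ptw λ n → ≡.cong ℤ.-_ (at e n)
          }
        ; comm = λ F G → ptw λ n → ℤ.+-comm (F n) (G n)
        }
      ; *-cong = λ e e′ → ptw (*ₛ-cong (at e) (at e′))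
      ; *-assoc = λ F G H → ptw (*ₛ-assoc F G H)
      ; *-identity = (λ F → ptw (*ₛ-identityˡ F)) , λ F → ptw λ n → ≡.trans (*ₛ-comm F 1ₛ n) (*ₛ-identityˡ F n)
      ; distrib = (λ F G H → ptw (*ₛ-distribˡ F G H)) , λ F G H → ptw λ n → ≡.trans (*ₛ-comm (G +ₛ H) F n)
          (≡.trans (*ₛ-distribˡ F G H n) (≡.cong₂ ℤ._+_ (*ₛ-comm F G n) (*ₛ-comm F H n)))
      }
    ; *-comm = λ F G → ptw (*ₛ-comm F G)
    }

psRing : CommutativeRing _ _
psRing = record { isCommutativeRing = isCommutativeRing }

module ℛ = CommutativeRing psRing
module 𝒮 = RingKit psRing

opaque
  unfolding _⊞_

  ⊞-at : ∀ F G n → (F ⊞ G) n ≡ F n ℤ.+ G n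
  ⊞-at F G n = ≡.refl

  ⊟-at : ∀ F n → (⊟ F) n ≡ ℤ.- F n
  ⊟-at F n = ≡.refl

  𝟘-at : ∀ n → 𝟘 n ≡ + 0
  𝟘-at n = ≡.refl

  q^-at : ∀ k n → (q^ k) n ≡ qpow k n
  q^-at k n = ≡.refl

  𝟙-at : ∀ n → 𝟙 n ≡ 1ₛ n
  𝟙-at n = ≡.refl

  ⊛-at : ∀ F G n → (F ⊛ G) n ≡ ℤΣ≤ (λ i → F i ℤ.* G (n ∸ i)) n
  ⊛-at F G n = *≡conv F G n

  q^-⊛-≥ : ∀ k F n → k ≤ n → (q^ k ⊛ F) n ≡ F (n ∸ k)
  q^-⊛-≥ = qpow-*-≥

  q^-⊛-< : ∀ k F n → n < k → (q^ k ⊛ F) n ≡ + 0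
  q^-⊛-< = qpow-*-<

  q^0 : q^ 0 ≐ 𝟙
  q^0 = ptw λ _ → ≡.refl

  +ₛ≐ : ∀ F G → F +ₛ G ≐ F ⊞ G
  +ₛ≐ F G = ptw λ _ → ≡.refl

  -ₛ≐ : ∀ F G → F -ₛ G ≐ F ℛ.- G
  -ₛ≐ F G = ptw λ _ → ≡.refl

  *ₛ≐ : ∀ F G → F *ₛ G ≐ F ⊛ G
  *ₛ≐ F G = ptw λ _ → ≡.refl

  1ₛ≐ : 1ₛ ≐ 𝟙
  1ₛ≐ = ptw λ _ → ≡.refl

  0ₛ≐ : 0ₛ ≐ 𝟘
  0ₛ≐ = ptw λ _ → ≡.refl

  qpow≐ : ∀ k → qpow k ≐ q^ k
  qpow≐ k = ptw λ _ → ≡.refl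

-- Finite q-identities: q-Pascal rules, Durfee rectangles, Jacobi triple product

module ℕS = Data.Nat.Solver.+-*-Solver

m∸[m+n]≡0 : ∀ m n → m ∸ (m ℕ.+ n) ≡ 0
m∸[m+n]≡0 m n = ℕ.m≤n⇒m∸n≡0 (ℕ.m≤m+n m n)

-- pw e stands for Q ^ e, and g k for the inverse of 1 - Q ^ (1 + k).
record QBase {c ℓ} (R : CommutativeRing c ℓ) : Set (c ⊔ ℓ) where
  open CommutativeRing R
  field
    pw        : ℕ → Carrier
    pw-0      : pw 0 ≈ 1#
    pw-+      : ∀ m n → pw (m ℕ.+ n) ≈ pw m * pw n
    g         : ℕ → Carrier
    g-inverse : ∀ k → (1# - pw (suc k)) * g k ≈ 1#

module FiniteQ {c ℓ} (R : CommutativeRing c ℓ) (base : QBase R) where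

  open CommutativeRing R
  open QBase base
  open RingKit R
  open SetoidReasoning setoid

  pw-≡ : ∀ {m n} → m ≡ n → pw m ≈ pw n
  pw-≡ ≡.refl = refl

  -- I k = 1/(Q;Q)_k
  I : ℕ → Carrier
  I zero    = 1#
  I (suc k) = I k * g k

  I-suc : ∀ k → (1# - pw (suc k)) * I (suc k) ≈ I k
  I-suc k = begin
    (1# - pw (suc k)) * (I k * g k)   ≈⟨ solve 3 (λ a b c → a :* (b :* c) := b :* (a :* c)) refl _ _ _ ⟩
    I k * ((1# - pw (suc k)) * g k)   ≈⟨ *-congˡ (g-inverse k) ⟩
    I k * 1#                          ≈⟨ *-identityʳ _ ⟩
    I k                               ∎

  cancel : ∀ k {x y} → (1# - pw (suc k)) * x ≈ (1# - pw (suc k)) * y → x ≈ y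
  cancel k {x} {y} e = begin
    x                              ≈⟨ expand x ⟩
    g k * ((1# - pw (suc k)) * x)  ≈⟨ *-congˡ e ⟩
    g k * ((1# - pw (suc k)) * y)  ≈⟨ sym (expand y) ⟩
    y                              ∎
    where
    expand : ∀ z → z ≈ g k * ((1# - pw (suc k)) * z)
    expand z = begin
      z                              ≈⟨ sym (*-identityˡ z) ⟩
      1# * z                         ≈⟨ *-congʳ (sym (g-inverse k)) ⟩
      (1# - pw (suc k)) * g k * z    ≈⟨ solve 3 (λ a b c → a :* b :* c := b :* (a :* c)) refl _ _ _ ⟩
      g k * ((1# - pw (suc k)) * z)  ∎

  -- Multiplying I k by 1 - Q^k lowers its index, so every splitting of 1 - Q^(N+1) into a multiple
  -- of 1 - Q^(N+1-k) and a multiple of 1 - Q^k reduces the order of the sum by one. The factors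
  -- vanish at k = N + 1 and at k = 0 respectively, which keeps both shifted sums in range.
  -- `pascal₁` and `pascal₂` are the two q-Pascal rules.
  pascal : ∀ N (a b t : ℕ → Carrier) →
    (∀ k → k ≤ suc N → 1# - pw (suc N) ≈ a k * (1# - pw (suc N ∸ k)) + b k * (1# - pw k)) →
    (1# - pw (suc N)) * Σ≤ (λ k → I k * I (suc N ∸ k) * t k) (suc N)
      ≈ Σ≤ (λ k → I k * I (N ∸ k) * (a k * t k + b (suc k) * t (suc k))) N
  pascal N a b t split = begin
    (1# - pw (suc N)) * Σ≤ (λ k → I k * I (suc N ∸ k) * t k) (suc N)
      ≈⟨ sym (Σ-*ˡ _ _ (suc N)) ⟩
    Σ≤ (λ k → (1# - pw (suc N)) * (I k * I (suc N ∸ k) * t k)) (suc N)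
      ≈⟨ Σ-cong≤ (suc N) (λ k k≤ → trans (*-congʳ (split k k≤)) (separate _ _ _ _ _ _ _)) ⟩
    Σ≤ (λ k → A k + B k) (suc N)
      ≈⟨ Σ-+ A B (suc N) ⟩
    (Σ≤ A N + A (suc N)) + Σ≤ B (suc N)
      ≈⟨ +-cong (+-congˡ A-last) (trans (Σ-first B N) (+-congʳ B-first)) ⟩
    (Σ≤ A N + 0#) + (0# + Σ≤ (λ k → B (suc k)) N)
      ≈⟨ +-cong (+-identityʳ _) (+-identityˡ _) ⟩
    Σ≤ A N + Σ≤ (λ k → B (suc k)) N
      ≈⟨ sym (Σ-+ _ _ N) ⟩
    Σ≤ (λ k → A k + B (suc k)) N
      ≈⟨ Σ-cong≤ N combine ⟩
    Σ≤ (λ k → I k * I (N ∸ k) * (a k * t k + b (suc k) * t (suc k))) N ∎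
    where
    A B : ℕ → Carrier
    A k = a k * I k * ((1# - pw (suc N ∸ k)) * I (suc N ∸ k)) * t k
    B k = b k * ((1# - pw k) * I k) * I (suc N ∸ k) * t k
    separate : ∀ a x b y i j t → (a * x + b * y) * (i * j * t) ≈ a * i * (x * j) * t + b * (y * i) * j * t
    separate = solve 7 (λ a x b y i j t → (a :* x :+ b :* y) :* (i :* j :* t)
                          := a :* i :* (x :* j) :* t :+ b :* (y :* i) :* j :* t) refl
    1-pw0 : ∀ {n} → n ≡ 0 → 1# - pw n ≈ 0#
    1-pw0 ≡.refl = trans (+-congˡ (-‿cong pw-0)) (-‿inverseʳ 1#)
    A-last : A (suc N) ≈ 0#
    A-last = trans (*-congʳ (*-congˡ (*-congʳ (1-pw0 (ℕ.n∸n≡0 (suc N))))))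
      (solve 4 (λ a i j t → a :* i :* (con (+ 0) :* j) :* t := con (+ 0)) refl _ _ _ _)
    B-first : B 0 ≈ 0#
    B-first = trans (*-congʳ (*-congʳ (*-congˡ (*-congʳ (1-pw0 ≡.refl)))))
      (solve 4 (λ b i j t → b :* (con (+ 0) :* i) :* j :* t := con (+ 0)) refl _ _ _ _)
    combine : ∀ k → k ≤ N → A k + B (suc k) ≈ I k * I (N ∸ k) * (a k * t k + b (suc k) * t (suc k))
    combine k k≤N rewrite ℕ.+-∸-assoc 1 k≤N = trans
      (+-cong (*-congʳ (*-congˡ (I-suc (N ∸ k)))) (*-congʳ (*-congʳ (*-congˡ (I-suc k)))))
      (solve 6 (λ a i j t b t′ → a :* i :* j :* t :+ b :* i :* j :* t′ := i :* j :* (a :* t :+ b :* t′))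
        refl _ _ _ _ _ _)

  private
    pw-split : ∀ N k → k ≤ N → pw N ≈ pw (N ∸ k) * pw k
    pw-split N k k≤N = trans (pw-≡ (≡.sym (ℕ.m∸n+n≡m k≤N))) (pw-+ (N ∸ k) k)

  pascal₁ : ∀ N (t : ℕ → Carrier) →
    (1# - pw (suc N)) * Σ≤ (λ k → I k * I (suc N ∸ k) * t k) (suc N)
      ≈ Σ≤ (λ k → I k * I (N ∸ k) * (pw k * t k + 1# * t (suc k))) N
  pascal₁ N t = pascal N pw (λ _ → 1#) t λ k k≤ →
    trans (+-congˡ (-‿cong (pw-split (suc N) k k≤)))
      (solve 2 (λ x y → con (+ 1) :- x :* y
         := y :* (con (+ 1) :- x) :+ con (+ 1) :* (con (+ 1) :- y)) refl (pw (suc N ∸ k)) (pw k))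

  pascal₂ : ∀ N (t : ℕ → Carrier) →
    (1# - pw (suc N)) * Σ≤ (λ k → I k * I (suc N ∸ k) * t k) (suc N)
      ≈ Σ≤ (λ k → I k * I (N ∸ k) * (1# * t k + pw (N ∸ k) * t (suc k))) N
  pascal₂ N t = pascal N (λ _ → 1#) (λ k → pw (suc N ∸ k)) t λ k k≤ →
    trans (+-congˡ (-‿cong (pw-split (suc N) k k≤)))
      (solve 2 (λ x y → con (+ 1) :- x :* y
         := con (+ 1) :* (con (+ 1) :- x) :+ x :* (con (+ 1) :- y)) refl (pw (suc N ∸ k)) (pw k))

  -- A q-Chu-Vandermonde sum, which classifies partitions by their Durfee rectangle. The induction
  -- lowers N and raises s: after `pascal₁`, neighbouring terms merge into the term for s + 1.
  durfee : ∀ N s → Σ≤ (λ m → I m * I (N ∸ m) * (pw (m ℕ.* (m ℕ.+ s)) * I (m ℕ.+ s))) N ≈ I N * I (N ℕ.+ s)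
  durfee zero    s = trans (*-congˡ (*-congʳ pw-0))
    (solve 1 (λ x → con (+ 1) :* con (+ 1) :* (con (+ 1) :* x) := con (+ 1) :* x) refl _)
  durfee (suc N) s = cancel N (begin
    (1# - pw (suc N)) * Σ≤ (λ m → I m * I (suc N ∸ m) * t m) (suc N)
      ≈⟨ pascal₁ N t ⟩
    Σ≤ (λ m → I m * I (N ∸ m) * (pw m * t m + 1# * t (suc m))) N
      ≈⟨ Σ-cong N (λ m → *-congˡ (merge m)) ⟩
    Σ≤ (λ m → I m * I (N ∸ m) * (pw (m ℕ.* (m ℕ.+ suc s)) * I (m ℕ.+ suc s))) N
      ≈⟨ durfee N (suc s) ⟩
    I N * I (N ℕ.+ suc s)
      ≈⟨ *-cong (sym (I-suc N)) (reflexive (≡.cong I (ℕ.+-suc N s))) ⟩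
    (1# - pw (suc N)) * I (suc N) * I (suc N ℕ.+ s)
      ≈⟨ *-assoc _ _ _ ⟩
    (1# - pw (suc N)) * (I (suc N) * I (suc N ℕ.+ s)) ∎)
    where
    t : ℕ → Carrier
    t m = pw (m ℕ.* (m ℕ.+ s)) * I (m ℕ.+ s)
    merge : ∀ m → pw m * t m + 1# * t (suc m) ≈ pw (m ℕ.* (m ℕ.+ suc s)) * I (m ℕ.+ suc s)
    merge m = begin
      pw m * (pw (m ℕ.* (m ℕ.+ s)) * I (m ℕ.+ s)) + 1# * (pw (suc m ℕ.* (suc m ℕ.+ s)) * J)
        ≈⟨ +-cong (*-congˡ (*-congˡ (sym (I-suc (m ℕ.+ s))))) (*-congˡ (*-congʳ (trans (pw-≡ e₂) (pw-+ _ _)))) ⟩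
      pw m * (pw (m ℕ.* (m ℕ.+ s)) * ((1# - w) * J)) + 1# * (E * w * J)
        ≈⟨ +-congʳ (solve 4 (λ a b w J → a :* (b :* ((con (+ 1) :- w) :* J)) := a :* b :* ((con (+ 1) :- w) :* J)) refl _ _ _ _) ⟩
      pw m * pw (m ℕ.* (m ℕ.+ s)) * ((1# - w) * J) + 1# * (E * w * J)
        ≈⟨ +-congʳ (*-congʳ (trans (sym (pw-+ _ _)) (pw-≡ e₁))) ⟩
      E * ((1# - w) * J) + 1# * (E * w * J)
        ≈⟨ solve 3 (λ E w J → E :* ((con (+ 1) :- w) :* J) :+ con (+ 1) :* (E :* w :* J) := E :* J) refl _ _ _ ⟩
      E * J
        ≈⟨ *-congˡ (reflexive (≡.cong I (≡.sym (ℕ.+-suc m s)))) ⟩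
      E * I (m ℕ.+ suc s) ∎
      where
      E J w : Carrier
      E = pw (m ℕ.* (m ℕ.+ suc s))
      J = I (suc (m ℕ.+ s))
      w = pw (suc (m ℕ.+ s))
      open ℕS using () renaming (solve to ℕsolve; _:+_ to _⊕_; _:*_ to _⊗_; _:=_ to _⊜_; con to κ)
      e₁ : m ℕ.+ m ℕ.* (m ℕ.+ s) ≡ m ℕ.* (m ℕ.+ suc s)
      e₁ = ℕsolve 2 (λ m s → m ⊕ m ⊗ (m ⊕ s) ⊜ m ⊗ (m ⊕ (κ 1 ⊕ s))) ≡.refl m s
      e₂ : suc m ℕ.* (suc m ℕ.+ s) ≡ m ℕ.* (m ℕ.+ suc s) ℕ.+ suc (m ℕ.+ s)
      e₂ = ℕsolve 2 (λ m s → (κ 1 ⊕ m) ⊗ (κ 1 ⊕ m ⊕ s) ⊜ m ⊗ (m ⊕ (κ 1 ⊕ s)) ⊕ (κ 1 ⊕ (m ⊕ s))) ≡.refl m s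

  -- This is X^l Q^(l(l-1)/2), the summand of a theta series.
  T : Carrier → ℕ → Carrier
  T X zero    = 1#
  T X (suc l) = T X l * (X * pw l)

  -- If XY = Q, the theta summand at index -p equals `T Y p`, so negative powers of X never occur.
  -- Truncated subtraction makes one of the two factors 1, according to the sign of k - m.
  τ : Carrier → Carrier → ℕ → ℕ → Carrier
  τ X Y m k = T Y (m ∸ k) * T X (k ∸ m)

  private
    q-binomial : ∀ Y m → Σ≤ (λ k → I k * I (m ∸ k) * T Y (m ∸ k)) m ≈ I m * Π< (λ j → 1# + Y * pw j) m
    q-binomial Y zero    = *-identityʳ _
    q-binomial Y (suc m) = cancel m (begin
      (1# - pw (suc m)) * Σ≤ (λ k → I k * I (suc m ∸ k) * T Y (suc m ∸ k)) (suc m)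
        ≈⟨ pascal₁ m (λ k → T Y (suc m ∸ k)) ⟩
      Σ≤ (λ k → I k * I (m ∸ k) * (pw k * T Y (suc m ∸ k) + 1# * T Y (m ∸ k))) m
        ≈⟨ Σ-cong≤ m step ⟩
      Σ≤ (λ k → I k * I (m ∸ k) * T Y (m ∸ k) * (1# + Y * pw m)) m
        ≈⟨ Σ-*ʳ _ _ m ⟩
      Σ≤ (λ k → I k * I (m ∸ k) * T Y (m ∸ k)) m * (1# + Y * pw m)
        ≈⟨ *-congʳ (q-binomial Y m) ⟩
      I m * Π< (λ j → 1# + Y * pw j) m * (1# + Y * pw m)
        ≈⟨ trans (*-congʳ (*-congʳ (sym (I-suc m)))) (solve 4 (λ a b c d → a :* b :* c :* d := a :* (b :* (c :* d))) refl _ _ _ _) ⟩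
      (1# - pw (suc m)) * (I (suc m) * (Π< (λ j → 1# + Y * pw j) m * (1# + Y * pw m))) ∎)
      where
      step : ∀ k → k ≤ m → I k * I (m ∸ k) * (pw k * T Y (suc m ∸ k) + 1# * T Y (m ∸ k))
                         ≈ I k * I (m ∸ k) * T Y (m ∸ k) * (1# + Y * pw m)
      step k k≤m rewrite ℕ.+-∸-assoc 1 k≤m = trans
        (solve 6 (λ i j k t Y w → i :* j :* (k :* (t :* (Y :* w)) :+ con (+ 1) :* t)
           := i :* j :* t :* (con (+ 1) :+ Y :* (w :* k))) refl _ _ _ _ _ _)
        (*-congˡ (+-congˡ (*-congˡ (sym (pw-split m k k≤m)))))

  -- Finite Jacobi triple product; with m = n → ∞ the index l = k - m runs over ℤ.
  jacobi : ∀ {X Y} → X * Y ≈ pw 1 → ∀ m n →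
    Σ≤ (λ k → I k * I (m ℕ.+ n ∸ k) * τ X Y m k) (m ℕ.+ n)
      ≈ I (m ℕ.+ n) * (Π< (λ j → 1# + Y * pw j) m * Π< (λ j → 1# + X * pw j) n)
  jacobi {X} {Y} XY m zero rewrite ℕ.+-identityʳ m = begin
    Σ≤ (λ k → I k * I (m ∸ k) * τ X Y m k) m   ≈⟨ Σ-cong≤ m (λ k k≤m → *-congˡ (trans (*-congˡ (reflexive (≡.cong (T X) (ℕ.m≤n⇒m∸n≡0 k≤m)))) (*-identityʳ _))) ⟩
    Σ≤ (λ k → I k * I (m ∸ k) * T Y (m ∸ k)) m ≈⟨ q-binomial Y m ⟩
    I m * Π< (λ j → 1# + Y * pw j) m           ≈⟨ *-congˡ (sym (*-identityʳ _)) ⟩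
    I m * (Π< (λ j → 1# + Y * pw j) m * 1#)    ∎
  jacobi {X} {Y} XY m (suc n) rewrite ℕ.+-suc m n = cancel N (begin
    (1# - pw (suc N)) * Σ≤ (λ k → I k * I (suc N ∸ k) * t k) (suc N)
      ≈⟨ pascal₂ N t ⟩
    Σ≤ (λ k → I k * I (N ∸ k) * (1# * t k + pw (N ∸ k) * t (suc k))) N
      ≈⟨ Σ-cong≤ N (λ k k≤ → trans (*-congˡ (+-congˡ (shift k k≤))) (solve 5 (λ i j t X w → i :* j :* (con (+ 1) :* t :+ X :* w :* t) := i :* j :* t :* (con (+ 1) :+ X :* w)) refl _ _ _ _ _)) ⟩
    Σ≤ (λ k → I k * I (N ∸ k) * t k * (1# + X * pw n)) N
      ≈⟨ Σ-*ʳ _ _ N ⟩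
    Σ≤ (λ k → I k * I (N ∸ k) * t k) N * (1# + X * pw n)
      ≈⟨ *-congʳ (jacobi XY m n) ⟩
    I N * (_ * _) * (1# + X * pw n)
      ≈⟨ trans (*-congʳ (*-congʳ (sym (I-suc N)))) (solve 5 (λ a b c d e → a :* b :* (c :* d) :* e := a :* (b :* (c :* (d :* e)))) refl _ _ _ _ _) ⟩
    (1# - pw (suc N)) * (I (suc N) * (Π< (λ j → 1# + Y * pw j) m * (Π< (λ j → 1# + X * pw j) n * (1# + X * pw n)))) ∎)
    where
    N : ℕ
    N = m ℕ.+ n
    t : ℕ → Carrier
    t = τ X Y m
    -- Raising l = k - m by one multiplies the summand by X Q^l. Together with Q^(N-k) = Q^(n-l)
    -- this becomes X Q^n, independent of k. For negative l the relation XY = Q is what makes it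
    -- work.
    shift-≥ : ∀ l → l ≤ n → pw (N ∸ (m ℕ.+ l)) * t (suc (m ℕ.+ l)) ≈ X * pw n * t (m ℕ.+ l)
    shift-≥ l l≤n
      rewrite ℕ.[m+n]∸[m+o]≡n∸o m n l | ≡.sym (ℕ.+-suc m l)
            | m∸[m+n]≡0 m l | m∸[m+n]≡0 m (suc l)
            | ℕ.m+n∸m≡n m l | ℕ.m+n∸m≡n m (suc l) = trans
      (solve 4 (λ v t X w → v :* (con (+ 1) :* (t :* (X :* w))) := X :* (v :* w) :* (con (+ 1) :* t)) refl _ _ _ _)
      (*-congʳ (*-congˡ (sym (pw-split n l l≤n))))
    shift-< : ∀ k p → m ≡ suc k ℕ.+ p → pw (N ∸ k) * t (suc k) ≈ X * pw n * t k
    shift-< k p ≡.refl = begin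
      pw (suc (k ℕ.+ p) ℕ.+ n ∸ k) * τ X Y (suc (k ℕ.+ p)) (suc k)
        ≡⟨ ≡.cong₂ (λ i j → pw i * j) e₁ (≡.cong₂ (λ i j → T Y i * T X j) (ℕ.m+n∸m≡n k p) (m∸[m+n]≡0 k p)) ⟩
      pw (suc p ℕ.+ n) * (T Y p * 1#)
        ≈⟨ *-congʳ (trans (pw-+ (suc p) n) (*-congʳ (trans (pw-+ 1 p) (*-congʳ (sym XY))))) ⟩
      X * Y * pw p * pw n * (T Y p * 1#)
        ≈⟨ solve 5 (λ X Y p n t → X :* Y :* p :* n :* (t :* con (+ 1)) := X :* n :* (t :* (Y :* p) :* con (+ 1))) refl _ _ _ _ _ ⟩
      X * pw n * (T Y (suc p) * 1#)
        ≡⟨ ≡.cong (X * pw n *_) (≡.cong₂ (λ i j → T Y i * T X j) e₂ e₃) ⟨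
      X * pw n * τ X Y (suc (k ℕ.+ p)) k ∎
      where
      e₁ : suc (k ℕ.+ p) ℕ.+ n ∸ k ≡ suc p ℕ.+ n
      e₁ = ≡.trans (≡.cong (λ i → i ℕ.+ n ∸ k) (≡.sym (ℕ.+-suc k p)))
             (≡.trans (≡.cong (_∸ k) (ℕ.+-assoc k (suc p) n)) (ℕ.m+n∸m≡n k (suc p ℕ.+ n)))
      e₂ : suc (k ℕ.+ p) ∸ k ≡ suc p
      e₂ = ≡.trans (≡.cong (_∸ k) (≡.sym (ℕ.+-suc k p))) (ℕ.m+n∸m≡n k (suc p))
      e₃ : k ∸ suc (k ℕ.+ p) ≡ 0
      e₃ = ℕ.m≤n⇒m∸n≡0 (ℕ.m≤n⇒m≤1+n (ℕ.m≤m+n k p))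
    shift : ∀ k → k ≤ N → pw (N ∸ k) * t (suc k) ≈ X * pw n * t k
    shift k k≤N with k ℕ.<? m
    ... | yes k<m = shift-< k (m ∸ suc k) (≡.sym (ℕ.m+[n∸m]≡n k<m))
    ... | no  k≮m = ≡.subst (λ k → pw (N ∸ k) * t (suc k) ≈ X * pw n * t k) m+l≡k
      (shift-≥ (k ∸ m) (ℕ.+-cancelˡ-≤ m _ _ (ℕ.≤-trans (ℕ.≤-reflexive m+l≡k) k≤N)))
      where
      m+l≡k : m ℕ.+ (k ∸ m) ≡ k
      m+l≡k = ℕ.m+[n∸m]≡n (ℕ.≮⇒≥ k≮m)

-- Partial fractions and the finite Bailey lemma

module PartialFractions {c ℓ} (R : CommutativeRing c ℓ) (base : QBase R) where

  open CommutativeRing R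
  open QBase base
  open RingKit R
  open FiniteQ R base
  open SetoidReasoning setoid

  -- χ r = (-1)^r Q^(r(r+1)/2)
  χ : ℕ → Carrier
  χ zero    = 1#
  χ (suc r) = - (χ r * pw (suc r))

  -- For s = 0 the poles come in pairs Q^r, Q^(-r), which merge at r = 0. That entry is therefore 1
  -- and not 1 + Q^0.
  σ₀ σ₁ : ℕ → Carrier
  σ₀ zero    = 1#
  σ₀ (suc r) = 1# + pw (suc r)
  σ₁ r       = 1# - pw (suc (r ℕ.+ r))

  -- The shape is that of a Bailey pair: s = 0 and s = 1 correspond to pairs relative to a = 1 and a
  -- = Q.
  coeff : (ℕ → Carrier) → ℕ → ℕ → ℕ → Carrier
  coeff σ s n r = χ r * σ r * (I (n ∸ r) * I (n ℕ.+ r ℕ.+ s))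

  -- For a denominator E (1 + c X²) - V X with X proportional to Q^r, a single fraction behaves like
  -- a multiple of Q^(-r) / V for large V, whereas a product of two or more of them decays faster.
  -- `moment` is the resulting cancellation; with `initial` it is all the expansion uses about σ.
  record Weight : Set (c ⊔ ℓ) where
    field
      s       : ℕ
      σ       : ℕ → Carrier
      initial : coeff σ s 0 0 ≈ 1#
      moment  : ∀ n → Σ≤ (λ r → coeff σ s (suc n) r * pw (suc n ∸ r)) (suc n) ≈ 0#

  private
    pw-suc : ∀ k → pw (suc k) ≈ pw 1 * pw k
    pw-suc k = pw-+ 1 k

    -- Partial sums of the moment telescope.
    partial₀ : ∀ m k → let n = m ℕ.+ suc k in
      (1# - pw n) * Σ≤ (λ r → coeff σ₀ 0 n r * pw (n ∸ r)) m ≈ pw n * χ m * (I k * I (n ℕ.+ m))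
    partial₀ zero k = trans
      (*-congˡ (*-congʳ (*-congˡ (*-congˡ (reflexive (≡.cong I (ℕ.+-identityʳ (suc k ℕ.+ 0))))))))
      (trans (solve 4 (λ w i j v → (con (+ 1) :- w) :* (con (+ 1) :* con (+ 1) :* (i :* j) :* w)
                 := w :* con (+ 1) :* (((con (+ 1) :- w) :* i) :* j)) refl (pw (suc k)) _ _ (pw 0))
             (*-congˡ (*-congʳ (I-suc k))))
    partial₀ (suc m) k = begin
      (1# - pw n) * (S + c′ * pw (n ∸ suc m))
        ≈⟨ distribˡ _ _ _ ⟩
      (1# - pw n) * S + (1# - pw n) * (c′ * pw (n ∸ suc m))
        ≈⟨ +-cong previous (*-congˡ (*-cong (*-congˡ (*-cong (reflexive (≡.cong I n∸m)) (reflexive (≡.cong I (ℕ.+-identityʳ (n ℕ.+ suc m)))))) (pw-≡ n∸m))) ⟩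
      pw n * χ m * (L * ((1# - pw (suc (n ℕ.+ m))) * J)) + (1# - pw n) * (- (χ m * A) * (1# + A) * (L * J) * B′)
        ≈⟨ +-cong (*-cong (*-congʳ pwn) (*-congˡ (*-congʳ (+-congˡ (-‿cong pwnm))))) (*-congʳ (+-congˡ (-‿cong pwn))) ⟩
      A * B′ * χ m * (L * ((1# - A * B′ * A) * J)) + (1# - A * B′) * (- (χ m * A) * (1# + A) * (L * J) * B′)
        ≈⟨ solve 5 (λ A B χ L J →
             A :* B :* χ :* (L :* ((con (+ 1) :- A :* B :* A) :* J)) :+ (con (+ 1) :- A :* B) :* (:- (χ :* A) :* (con (+ 1) :+ A) :* (L :* J) :* B)
             := A :* B :* (:- (χ :* A)) :* (((con (+ 1) :- B) :* L) :* J)) refl A B′ (χ m) L J ⟩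
      A * B′ * χ (suc m) * (((1# - B′) * L) * J)
        ≈⟨ *-cong (*-congʳ (sym pwn)) (*-congʳ (I-suc k)) ⟩
      pw n * χ (suc m) * (I k * J) ∎
      where
      n : ℕ
      n = suc m ℕ.+ suc k
      n∸m : n ∸ suc m ≡ suc k
      n∸m = ℕ.m+n∸m≡n (suc m) (suc k)
      c′ A B′ L J S : Carrier
      c′ = coeff σ₀ 0 n (suc m)
      A = pw (suc m)
      B′ = pw (suc k)
      L = I (suc k)
      J = I (n ℕ.+ suc m)
      S = Σ≤ (λ r → coeff σ₀ 0 n r * pw (n ∸ r)) m
      pwn : pw n ≈ A * B′
      pwn = pw-+ (suc m) (suc k)
      pwnm : pw (suc (n ℕ.+ m)) ≈ A * B′ * A
      pwnm = trans (pw-≡ (≡.sym (ℕ.+-suc n m))) (trans (pw-+ n (suc m)) (*-congʳ pwn))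
      previous : (1# - pw n) * S ≈ pw n * χ m * (L * ((1# - pw (suc (n ℕ.+ m))) * J))
      previous = trans
        (≡.subst (λ n → (1# - pw n) * Σ≤ (λ r → coeff σ₀ 0 n r * pw (n ∸ r)) m ≈ pw n * χ m * (I (suc k) * I (n ℕ.+ m)))
                 (ℕ.+-suc m (suc k)) (partial₀ m (suc k)))
        (*-congˡ (*-congˡ (trans (sym (I-suc (n ℕ.+ m))) (*-congˡ (reflexive (≡.cong I (≡.sym (ℕ.+-suc n m))))))))

    -- The term r = n + 1 lies beyond the reach of `partial₀`, where `I k` would need k = -1. It
    -- cancels the telescoped sum of the preceding terms.
    moment₀ : ∀ n → Σ≤ (λ r → coeff σ₀ 0 (suc n) r * pw (suc n ∸ r)) (suc n) ≈ 0#
    moment₀ n = cancel n (begin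
      (1# - w) * (S + χ N * (1# + w) * (I (N ∸ N) * I (N ℕ.+ N ℕ.+ 0)) * pw (N ∸ N))
        ≈⟨ distribˡ _ _ _ ⟩
      (1# - w) * S + (1# - w) * (χ N * (1# + w) * (I (N ∸ N) * I (N ℕ.+ N ℕ.+ 0)) * pw (N ∸ N))
        ≈⟨ +-cong previous (*-congˡ (*-cong (*-congˡ (*-cong (reflexive (≡.cong I N∸N)) (reflexive (≡.cong I (ℕ.+-identityʳ (N ℕ.+ N)))))) (trans (pw-≡ N∸N) pw-0))) ⟩
      w * χ n * (1# * ((1# - w * w) * J)) + (1# - w) * (- (χ n * w) * (1# + w) * (1# * J) * 1#)
        ≈⟨ solve 3 (λ w χ J → w :* χ :* (con (+ 1) :* ((con (+ 1) :- w :* w) :* J)) :+ (con (+ 1) :- w) :* (:- (χ :* w) :* (con (+ 1) :+ w) :* (con (+ 1) :* J) :* con (+ 1))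
             := (con (+ 1) :- w) :* con (+ 0)) refl w (χ n) J ⟩
      (1# - w) * 0# ∎)
      where
      N : ℕ
      N = suc n
      N∸N : N ∸ N ≡ 0
      N∸N = ℕ.n∸n≡0 N
      w S J : Carrier
      w = pw N
      S = Σ≤ (λ r → coeff σ₀ 0 N r * pw (N ∸ r)) n
      J = I (N ℕ.+ N)
      previous : (1# - w) * S ≈ w * χ n * (1# * ((1# - w * w) * J))
      previous = trans
        (≡.subst (λ N → (1# - pw N) * Σ≤ (λ r → coeff σ₀ 0 N r * pw (N ∸ r)) n ≈ pw N * χ n * (1# * I (N ℕ.+ n)))
                 (ℕ.+-comm n 1) (partial₀ n 0))
        (*-congˡ (*-congˡ (trans (sym (I-suc (N ℕ.+ n))) (*-cong (+-congˡ (-‿cong (trans (pw-≡ (≡.sym (ℕ.+-suc N n))) (pw-+ N N)))) (reflexive (≡.cong I (≡.sym (ℕ.+-suc N n))))))))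

    partial₁ : ∀ m k → let n = m ℕ.+ suc k in
      (1# - pw n) * Σ≤ (λ r → coeff σ₁ 1 n r * pw (n ∸ r)) m
        ≈ pw n * χ m * (1# - pw (suc m)) * (I k * I (suc (n ℕ.+ m)))
    partial₁ zero k = trans
      (*-congˡ (*-congʳ (*-congˡ (*-congˡ (reflexive (≡.cong I (ℕ.+-comm (suc k ℕ.+ 0) 1)))))))
      (trans (solve 4 (λ w i j v → (con (+ 1) :- w) :* (con (+ 1) :* (con (+ 1) :- v) :* (i :* j) :* w)
                 := w :* con (+ 1) :* (con (+ 1) :- v) :* (((con (+ 1) :- w) :* i) :* j)) refl (pw (suc k)) _ _ (pw 1))
             (*-congˡ (*-congʳ (I-suc k))))
    partial₁ (suc m) k = begin
      (1# - pw n) * (S + c′ * pw (n ∸ suc m))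
        ≈⟨ distribˡ _ _ _ ⟩
      (1# - pw n) * S + (1# - pw n) * (c′ * pw (n ∸ suc m))
        ≈⟨ +-cong previous (*-congˡ (*-cong (*-cong (*-congˡ (+-congˡ (-‿cong pwσ))) (*-cong (reflexive (≡.cong I n∸m)) (reflexive (≡.cong I (ℕ.+-comm (n ℕ.+ suc m) 1))))) (pw-≡ n∸m))) ⟩
      pw n * χ m * (1# - A) * (L * ((1# - pw (suc (suc (n ℕ.+ m)))) * J)) + (1# - pw n) * (- (χ m * A) * (1# - q * (A * A)) * (L * J) * B′)
        ≈⟨ +-cong (*-cong (*-congʳ (*-congʳ pwn)) (*-congˡ (*-congʳ (+-congˡ (-‿cong pwnm))))) (*-congʳ (+-congˡ (-‿cong pwn))) ⟩
      A * B′ * χ m * (1# - A) * (L * ((1# - q * (A * B′ * A)) * J)) + (1# - A * B′) * (- (χ m * A) * (1# - q * (A * A)) * (L * J) * B′)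
        ≈⟨ solve 6 (λ A B χ L J q →
             A :* B :* χ :* (con (+ 1) :- A) :* (L :* ((con (+ 1) :- q :* (A :* B :* A)) :* J)) :+ (con (+ 1) :- A :* B) :* (:- (χ :* A) :* (con (+ 1) :- q :* (A :* A)) :* (L :* J) :* B)
             := A :* B :* (:- (χ :* A)) :* (con (+ 1) :- q :* A) :* (((con (+ 1) :- B) :* L) :* J)) refl A B′ (χ m) L J q ⟩
      A * B′ * χ (suc m) * (1# - q * A) * (((1# - B′) * L) * J)
        ≈⟨ *-cong (*-cong (*-congʳ (sym pwn)) (+-congˡ (-‿cong (sym (pw-suc (suc m)))))) (*-congʳ (I-suc k)) ⟩
      pw n * χ (suc m) * (1# - pw (suc (suc m))) * (I k * J) ∎
      where
      n : ℕ
      n = suc m ℕ.+ suc k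
      n∸m : n ∸ suc m ≡ suc k
      n∸m = ℕ.m+n∸m≡n (suc m) (suc k)
      c′ A B′ L J S q : Carrier
      q = pw 1
      c′ = coeff σ₁ 1 n (suc m)
      A = pw (suc m)
      B′ = pw (suc k)
      L = I (suc k)
      J = I (suc (n ℕ.+ suc m))
      S = Σ≤ (λ r → coeff σ₁ 1 n r * pw (n ∸ r)) m
      pwn : pw n ≈ A * B′
      pwn = pw-+ (suc m) (suc k)
      pwσ : pw (suc (suc m ℕ.+ suc m)) ≈ q * (A * A)
      pwσ = trans (pw-suc _) (*-congˡ (pw-+ (suc m) (suc m)))
      pwnm : pw (suc (suc (n ℕ.+ m))) ≈ q * (A * B′ * A)
      pwnm = trans (pw-suc _) (*-congˡ (trans (pw-≡ (≡.sym (ℕ.+-suc n m))) (trans (pw-+ n (suc m)) (*-congʳ pwn))))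
      previous : (1# - pw n) * S ≈ pw n * χ m * (1# - A) * (L * ((1# - pw (suc (suc (n ℕ.+ m)))) * J))
      previous = trans
        (≡.subst (λ n → (1# - pw n) * Σ≤ (λ r → coeff σ₁ 1 n r * pw (n ∸ r)) m ≈ pw n * χ m * (1# - A) * (I (suc k) * I (suc (n ℕ.+ m))))
                 (ℕ.+-suc m (suc k)) (partial₁ m (suc k)))
        (*-congˡ (*-congˡ (trans (sym (I-suc (suc (n ℕ.+ m)))) (*-congˡ (reflexive (≡.cong (λ i → I (suc i)) (≡.sym (ℕ.+-suc n m))))))))

    moment₁ : ∀ n → Σ≤ (λ r → coeff σ₁ 1 (suc n) r * pw (suc n ∸ r)) (suc n) ≈ 0#
    moment₁ n = cancel n (begin
      (1# - w) * (S + χ N * σ₁ N * (I (N ∸ N) * I (N ℕ.+ N ℕ.+ 1)) * pw (N ∸ N))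
        ≈⟨ distribˡ _ _ _ ⟩
      (1# - w) * S + (1# - w) * (χ N * σ₁ N * (I (N ∸ N) * I (N ℕ.+ N ℕ.+ 1)) * pw (N ∸ N))
        ≈⟨ +-cong previous (*-congˡ (*-cong (*-congˡ (*-cong (reflexive (≡.cong I N∸N)) (reflexive (≡.cong I (ℕ.+-comm (N ℕ.+ N) 1))))) (trans (pw-≡ N∸N) pw-0))) ⟩
      w * χ n * (1# - w) * (1# * ((1# - v) * J)) + (1# - w) * (- (χ n * w) * (1# - v) * (1# * J) * 1#)
        ≈⟨ solve 4 (λ w χ J v → w :* χ :* (con (+ 1) :- w) :* (con (+ 1) :* ((con (+ 1) :- v) :* J)) :+ (con (+ 1) :- w) :* (:- (χ :* w) :* (con (+ 1) :- v) :* (con (+ 1) :* J) :* con (+ 1))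
             := (con (+ 1) :- w) :* con (+ 0)) refl w (χ n) J v ⟩
      (1# - w) * 0# ∎)
      where
      N : ℕ
      N = suc n
      N∸N : N ∸ N ≡ 0
      N∸N = ℕ.n∸n≡0 N
      w v S J : Carrier
      w = pw N
      v = pw (suc (N ℕ.+ N))
      S = Σ≤ (λ r → coeff σ₁ 1 N r * pw (N ∸ r)) n
      J = I (suc (N ℕ.+ N))
      previous : (1# - w) * S ≈ w * χ n * (1# - w) * (1# * ((1# - v) * J))
      previous = trans
        (≡.subst (λ N → (1# - pw N) * Σ≤ (λ r → coeff σ₁ 1 N r * pw (N ∸ r)) n ≈ pw N * χ n * (1# - pw (suc n)) * (1# * I (suc (N ℕ.+ n))))
                 (ℕ.+-comm n 1) (partial₁ n 0))
        (*-congˡ (*-congˡ (trans (sym (I-suc (suc (N ℕ.+ n)))) (reflexive (≡.cong (λ i → (1# - pw (suc i)) * I (suc i)) (≡.sym (ℕ.+-suc N n)))))))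

  weight₀ weight₁ : Weight
  weight₀ = record
    { s = 0 ; σ = σ₀ ; moment = moment₀
    ; initial = solve 0 (con (+ 1) :* con (+ 1) :* (con (+ 1) :* con (+ 1)) := con (+ 1)) refl }
  weight₁ = record
    { s = 1 ; σ = σ₁ ; moment = moment₁
    ; initial = trans (solve 2 (λ w i → con (+ 1) :* (con (+ 1) :- w) :* (con (+ 1) :* i) := (con (+ 1) :- w) :* i) refl _ _) (I-suc 0) }

  module Expansion (W : Weight) where
    open Weight W

    c[_,_] : ℕ → ℕ → Carrier
    c[_,_] = coeff σ s

    -- Satisfied by d r = κ / D r when D n = Q^(n-r) D r + (1 - Q^(n-r)) (1 - Q^(n+r+s)).
    Poles : Carrier → (ℕ → Carrier) → Set ℓ
    Poles κ d = ∀ r k → let n = suc (r ℕ.+ k) in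
      κ * (d r - pw (suc k) * d n) ≈ (1# - pw (suc k)) * (1# - pw (n ℕ.+ r ℕ.+ s)) * (d r * d n)

    -- The relation comes from D r = E (1 + c (X r)²) - V X r with X n = Q^(n-r) X r.
    poles : ∀ {E V c κ} {X d : ℕ → Carrier} → (∀ {x y} → E * x ≈ E * y → x ≈ y) →
      (∀ r k → X (suc (r ℕ.+ k)) ≈ X r * pw (suc k)) →
      (∀ r k → c * X r * X (suc (r ℕ.+ k)) ≈ pw (suc (r ℕ.+ k) ℕ.+ r ℕ.+ s)) →
      (∀ r → (E * (1# + c * X r * X r) - V * X r) * d r ≈ κ * E) → Poles κ d
    poles {E} {V} {c} {κ} {X} {d} E-cancel shift product residue r k = E-cancel (begin
      E * (κ * (d r - w * d n))
        ≈⟨ solve 5 (λ E κ d w e → E :* (κ :* (d :- w :* e)) := κ :* E :* d :- w :* e :* (κ :* E)) refl _ _ _ _ _ ⟩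
      κ * E * d r - w * d n * (κ * E)
        ≈⟨ +-cong (*-congʳ (sym (residue n))) (-‿cong (*-congˡ (sym (residue r)))) ⟩
      (E * (1# + c * X n * X n) - V * X n) * d n * d r - w * d n * ((E * (1# + c * X r * X r) - V * X r) * d r)
        ≈⟨ +-congʳ (*-congʳ (*-congʳ (+-cong (*-congˡ (+-congˡ (*-cong (*-congˡ (shift r k)) (shift r k)))) (-‿cong (*-congˡ (shift r k)))))) ⟩
      (E * (1# + c * (X r * w) * (X r * w)) - V * (X r * w)) * d n * d r - w * d n * ((E * (1# + c * X r * X r) - V * X r) * d r)
        ≈⟨ solve 7 (λ E c X w V d e →
             (E :* (con (+ 1) :+ c :* (X :* w) :* (X :* w)) :- V :* (X :* w)) :* e :* d
               :- w :* e :* ((E :* (con (+ 1) :+ c :* X :* X) :- V :* X) :* d)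
             := E :* ((con (+ 1) :- w) :* (con (+ 1) :- c :* X :* (X :* w)) :* (d :* e))) refl _ _ _ _ _ _ _ ⟩
      E * ((1# - w) * (1# - c * X r * (X r * w)) * (d r * d n))
        ≈⟨ *-congˡ (*-congʳ (*-congˡ (+-congˡ (-‿cong (trans (*-congˡ (sym (shift r k))) (product r k)))))) ⟩
      E * ((1# - w) * (1# - pw (n ℕ.+ r ℕ.+ s)) * (d r * d n)) ∎)
      where
      n : ℕ
      n = suc (r ℕ.+ k)
      w : Carrier
      w = pw (suc k)

    -- Here b n is the product of d 0, ..., d n divided by κ^n. With N = n + 1, `Poles` turns c[n,r]
    -- d r d N into κ c[N,r] d r minus κ c[N,r] Q^(N-r) d N, and by `moment` the subtracted parts
    -- add up to the missing term r = N. The constant κ is only cancelled, because over the integers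
    -- it will also be 4.
    expansion : ∀ κ → (∀ {x y} → κ * x ≈ κ * y → x ≈ y) →
      ∀ (d b : ℕ → Carrier) → Poles κ d → b 0 ≈ d 0 → (∀ n → κ * b (suc n) ≈ b n * d (suc n)) →
      ∀ n → b n ≈ Σ≤ (λ r → c[ n , r ] * d r) n
    expansion κ κ-cancel d b poles b₀ b-suc zero    = trans b₀ (sym (trans (*-congʳ initial) (*-identityˡ _)))
    expansion κ κ-cancel d b poles b₀ b-suc (suc n) = κ-cancel (begin
      κ * b (suc n)
        ≈⟨ b-suc n ⟩
      b n * dₙ
        ≈⟨ *-congʳ (expansion κ κ-cancel d b poles b₀ b-suc n) ⟩
      Σ≤ (λ r → c[ n , r ] * d r) n * dₙ
        ≈⟨ sym (Σ-*ʳ dₙ _ n) ⟩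
      Σ≤ (λ r → c[ n , r ] * d r * dₙ) n
        ≈⟨ Σ-cong≤ n step ⟩
      Σ≤ (λ r → κ * (c[ N , r ] * d r) + (- κ * dₙ) * (c[ N , r ] * pw (N ∸ r))) n
        ≈⟨ Σ-+ _ _ n ⟩
      Σ≤ (λ r → κ * (c[ N , r ] * d r)) n + Σ≤ (λ r → (- κ * dₙ) * (c[ N , r ] * pw (N ∸ r))) n
        ≈⟨ +-cong (Σ-*ˡ _ _ n) (Σ-*ˡ _ _ n) ⟩
      κ * S₁ + (- κ * dₙ) * S₂
        ≈⟨ solve 6 (λ κ S₁ S₂ d c w → κ :* S₁ :+ (:- κ :* d) :* S₂
             := κ :* (S₁ :+ c :* (w :* d)) :- κ :* d :* (S₂ :+ c :* w)) refl κ S₁ S₂ dₙ c[ N , N ] (pw (N ∸ N)) ⟩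
      κ * (S₁ + c[ N , N ] * (pw (N ∸ N) * dₙ)) - κ * dₙ * (S₂ + c[ N , N ] * pw (N ∸ N))
        ≈⟨ +-cong (*-congˡ (+-congˡ (*-congˡ (trans (*-congʳ (trans (pw-≡ (ℕ.n∸n≡0 N)) pw-0)) (*-identityˡ dₙ)))))
                  (-‿cong (*-congˡ (moment n))) ⟩
      κ * (S₁ + c[ N , N ] * dₙ) - κ * dₙ * 0#
        ≈⟨ solve 3 (λ x κ d → x :- κ :* d :* con (+ 0) := x) refl _ _ _ ⟩
      κ * (S₁ + c[ N , N ] * dₙ) ∎)
      where
      N : ℕ
      N = suc n
      dₙ S₁ S₂ : Carrier
      dₙ = d N
      S₁ = Σ≤ (λ r → c[ N , r ] * d r) n
      S₂ = Σ≤ (λ r → c[ N , r ] * pw (N ∸ r)) n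
      step′ : ∀ r k → r ℕ.+ k ≡ n →
        c[ n , r ] * d r * dₙ ≈ κ * (c[ N , r ] * d r) + (- κ * dₙ) * (c[ N , r ] * pw (N ∸ r))
      step′ r k ≡.refl = begin
        χ r * σ r * (I (r ℕ.+ k ∸ r) * I (r ℕ.+ k ℕ.+ r ℕ.+ s)) * d r * dₙ
          ≈⟨ *-congʳ (*-congʳ (*-congˡ (*-cong (trans (reflexive (≡.cong I (ℕ.m+n∸m≡n r k))) (sym (I-suc k))) (sym (I-suc _))))) ⟩
        χ r * σ r * (((1# - pw (suc k)) * I (suc k)) * ((1# - pw (N ℕ.+ r ℕ.+ s)) * J)) * d r * dₙ
          ≈⟨ solve 8 (λ χ σ x i y j d e → χ :* σ :* ((x :* i) :* (y :* j)) :* d :* e := χ :* σ :* (i :* j) :* (x :* y :* (d :* e))) refl _ _ _ _ _ _ _ _ ⟩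
        χ r * σ r * (I (suc k) * J) * ((1# - pw (suc k)) * (1# - pw (N ℕ.+ r ℕ.+ s)) * (d r * dₙ))
          ≈⟨ *-congˡ (sym (poles r k)) ⟩
        χ r * σ r * (I (suc k) * J) * (κ * (d r - pw (suc k) * dₙ))
          ≈⟨ solve 5 (λ c κ d w e → c :* (κ :* (d :- w :* e)) := κ :* (c :* d) :+ (:- κ :* e) :* (c :* w)) refl _ _ _ _ _ ⟩
        κ * (χ r * σ r * (I (suc k) * J) * d r) + (- κ * dₙ) * (χ r * σ r * (I (suc k) * J) * pw (suc k))
          ≡⟨ ≡.cong (λ i → κ * (χ r * σ r * (I i * J) * d r) + (- κ * dₙ) * (χ r * σ r * (I i * J) * pw i)) N∸r ⟨
        κ * (c[ N , r ] * d r) + (- κ * dₙ) * (c[ N , r ] * pw (N ∸ r)) ∎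
        where
        J : Carrier
        J = I (N ℕ.+ r ℕ.+ s)
        N∸r : suc (r ℕ.+ k) ∸ r ≡ suc k
        N∸r = ≡.trans (≡.cong (_∸ r) (≡.sym (ℕ.+-suc r k))) (ℕ.m+n∸m≡n r (suc k))
      step : ∀ r → r ≤ n →
        c[ n , r ] * d r * dₙ ≈ κ * (c[ N , r ] * d r) + (- κ * dₙ) * (c[ N , r ] * pw (N ∸ r))
      step r r≤n = step′ r (n ∸ r) (ℕ.m+[n∸m]≡n r≤n)

    -- Bailey's lemma with both parameters sent to infinity. For n = r + k the exponent n(n+s)
    -- equals r(r+s) + k(k+2r+s), so the inner sum is `durfee` with 2r + s in place of s.
    bailey : ∀ (d b : ℕ → Carrier) → (∀ n → b n ≈ Σ≤ (λ r → c[ n , r ] * d r) n) → ∀ N →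
      Σ≤ (λ n → pw (n ℕ.* (n ℕ.+ s)) * I (N ∸ n) * b n) N
        ≈ Σ≤ (λ r → χ r * σ r * pw (r ℕ.* (r ℕ.+ s)) * d r * (I (N ∸ r) * I (N ℕ.+ r ℕ.+ s))) N
    bailey d b b≈ N = begin
      Σ≤ (λ n → pw (n ℕ.* (n ℕ.+ s)) * I (N ∸ n) * b n) N
        ≈⟨ Σ-cong N (λ n → trans (*-congˡ (b≈ n)) (sym (Σ-*ˡ _ _ n))) ⟩
      Σ≤ (λ n → Σ≤ (λ r → a n r) n) N
        ≈⟨ Σ-triangle a N ⟩
      Σ≤ (λ r → Σ≤ (λ k → a (r ℕ.+ k) r) (N ∸ r)) N
        ≈⟨ Σ-cong N (λ r → trans (Σ-cong (N ∸ r) (factor r)) (Σ-*ˡ _ _ (N ∸ r))) ⟩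
      Σ≤ (λ r → χ r * σ r * pw (r ℕ.* (r ℕ.+ s)) * d r * Σ≤ (λ k → I k * I (N ∸ r ∸ k) * (pw (k ℕ.* (k ℕ.+ (r ℕ.+ r ℕ.+ s))) * I (k ℕ.+ (r ℕ.+ r ℕ.+ s)))) (N ∸ r)) N
        ≈⟨ Σ-cong≤ N (λ r r≤N → *-congˡ (trans (durfee (N ∸ r) (r ℕ.+ r ℕ.+ s)) (*-congˡ (reflexive (≡.cong I (total r r≤N)))))) ⟩
      Σ≤ (λ r → χ r * σ r * pw (r ℕ.* (r ℕ.+ s)) * d r * (I (N ∸ r) * I (N ℕ.+ r ℕ.+ s))) N ∎
      where
      open ℕS using () renaming (solve to ℕsolve; _:+_ to _⊕_; _:*_ to _⊗_; _:=_ to _⊜_)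
      a : ℕ → ℕ → Carrier
      a n r = pw (n ℕ.* (n ℕ.+ s)) * I (N ∸ n) * (c[ n , r ] * d r)
      total : ∀ r → r ≤ N → N ∸ r ℕ.+ (r ℕ.+ r ℕ.+ s) ≡ N ℕ.+ r ℕ.+ s
      total r r≤N = ≡.trans (ℕsolve 3 (λ a r s → a ⊕ (r ⊕ r ⊕ s) ⊜ a ⊕ r ⊕ r ⊕ s) ≡.refl (N ∸ r) r s)
                            (≡.cong (λ i → i ℕ.+ r ℕ.+ s) (ℕ.m∸n+n≡m r≤N))
      exponent : ∀ r k → (r ℕ.+ k) ℕ.* (r ℕ.+ k ℕ.+ s) ≡ r ℕ.* (r ℕ.+ s) ℕ.+ k ℕ.* (k ℕ.+ (r ℕ.+ r ℕ.+ s))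
      exponent r k = ℕsolve 3 (λ r k s → (r ⊕ k) ⊗ (r ⊕ k ⊕ s) ⊜ r ⊗ (r ⊕ s) ⊕ k ⊗ (k ⊕ (r ⊕ r ⊕ s))) ≡.refl r k s
      index : ∀ r k → r ℕ.+ k ℕ.+ r ℕ.+ s ≡ k ℕ.+ (r ℕ.+ r ℕ.+ s)
      index r k = ℕsolve 3 (λ r k s → r ⊕ k ⊕ r ⊕ s ⊜ k ⊕ (r ⊕ r ⊕ s)) ≡.refl r k s
      factor : ∀ r k → a (r ℕ.+ k) r ≈ χ r * σ r * pw (r ℕ.* (r ℕ.+ s)) * d r
        * (I k * I (N ∸ r ∸ k) * (pw (k ℕ.* (k ℕ.+ (r ℕ.+ r ℕ.+ s))) * I (k ℕ.+ (r ℕ.+ r ℕ.+ s))))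
      factor r k = trans
        (*-cong (*-cong (trans (pw-≡ (exponent r k)) (pw-+ _ _)) (reflexive (≡.cong I (≡.sym (ℕ.∸-+-assoc N r k)))))
                (*-congʳ (*-congˡ (*-cong (reflexive (≡.cong I (ℕ.m+n∸m≡n r k))) (reflexive (≡.cong I (index r k)))))))
        (solve 8 (λ u v i χ σ j l d → u :* v :* i :* (χ :* σ :* (j :* l) :* d) := χ :* σ :* u :* d :* (j :* i :* (v :* l)))
          refl _ _ _ _ _ _ _ _)

-- Products of two partial fraction expansions

module TwoFamilies {c ℓ} (R : CommutativeRing c ℓ) where

  open CommutativeRing R
  open RingKit R
  open SetoidReasoning setoid

  -- Think of κ μ r j as the value of e j at the r-th pole of the first family, and of ν r j as the
  -- value of d r at the j-th pole of the second. The inner sums are then expansions evaluated at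
  -- foreign poles, and the hypotheses supply their closed forms `M` and `N`.
  product-expansion : ∀ κ n m (a b d e M N : ℕ → Carrier) (μ ν : ℕ → ℕ → Carrier) →
    (∀ r j → d r * e j ≈ κ * (μ r j * d r) + ν r j * e j) →
    (∀ r → Σ≤ (λ j → b j * μ r j) m ≈ M r) → (∀ j → Σ≤ (λ r → a r * ν r j) n ≈ N j) →
    Σ≤ (λ r → a r * d r) n * Σ≤ (λ j → b j * e j) m
      ≈ κ * Σ≤ (λ r → a r * d r * M r) n + Σ≤ (λ j → b j * e j * N j) m
  product-expansion κ n m a b d e M N μ ν split ΣM ΣN = begin
    Σ≤ (λ r → a r * d r) n * Σ≤ (λ j → b j * e j) m
      ≈⟨ sym (Σ-*ʳ _ _ n) ⟩
    Σ≤ (λ r → a r * d r * Σ≤ (λ j → b j * e j) m) n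
      ≈⟨ Σ-cong n (λ r → trans (sym (Σ-*ˡ _ _ m)) (trans (Σ-cong m (term r)) (Σ-+ _ _ m))) ⟩
    Σ≤ (λ r → Σ≤ (λ j → κ * (a r * d r) * (b j * μ r j)) m + Σ≤ (λ j → b j * e j * (a r * ν r j)) m) n
      ≈⟨ Σ-+ _ _ n ⟩
    Σ≤ (λ r → Σ≤ (λ j → κ * (a r * d r) * (b j * μ r j)) m) n + Σ≤ (λ r → Σ≤ (λ j → b j * e j * (a r * ν r j)) m) n
      ≈⟨ +-cong (Σ-cong n (λ r → trans (Σ-*ˡ _ _ m) (trans (*-congˡ (ΣM r)) (*-assoc _ _ _))))
                (trans (Σ-swap _ n m) (Σ-cong m (λ j → trans (Σ-*ˡ _ _ n) (*-congˡ (ΣN j))))) ⟩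
    Σ≤ (λ r → κ * (a r * d r * M r)) n + Σ≤ (λ j → b j * e j * N j) m
      ≈⟨ +-congʳ (Σ-*ˡ κ _ n) ⟩
    κ * Σ≤ (λ r → a r * d r * M r) n + Σ≤ (λ j → b j * e j * N j) m ∎
    where
    term : ∀ r j → a r * d r * (b j * e j) ≈ κ * (a r * d r) * (b j * μ r j) + b j * e j * (a r * ν r j)
    term r j = trans (solve 4 (λ a d b e → a :* d :* (b :* e) := a :* b :* (d :* e)) refl _ _ _ _)
      (trans (*-congˡ (split r j))
        (solve 7 (λ a b κ μ d ν e → a :* b :* (κ :* (μ :* d) :+ ν :* e) := κ :* (a :* d) :* (b :* μ) :+ b :* e :* (a :* ν))
          refl _ _ _ _ _ _ _))

-- Power series modulo powers of q

open CommutativeRing psRing public hiding (zero; _≈_; isCommutativeRing) renaming (-_ to ⊝_)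
open 𝒮 using (Σ≤; Π<; ι; solve; _:=_; _:+_; _:*_; _:-_; :-_; _:^_; con) public
module ≐-Reasoning = SetoidReasoning setoid

infix 4 _≈[_]_
record _≈[_]_ (F : PS) (N : ℕ) (G : PS) : Set where
  constructor ptw
  field
    below : ∀ n → n < N → F n ≡ G n
open _≈[_]_ public

mod : ℕ → Setoid _ _
mod N = record
  { Carrier = PS
  ; _≈_ = _≈[ N ]_
  ; isEquivalence = record
    { refl = ptw λ _ _ → ≡.refl
    ; sym = λ e → ptw λ n n<N → ≡.sym (below e n n<N)
    ; trans = λ e e′ → ptw λ n n<N → ≡.trans (below e n n<N) (below e′ n n<N)
    }
  }

module Mod {N} = Setoid (mod N)

≐⇒≈ : ∀ {F G N} → F ≐ G → F ≈[ N ] G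
≐⇒≈ e = ptw λ n _ → at e n

≈⇒≐ : ∀ {F G} → (∀ N → F ≈[ suc N ] G) → F ≐ G
≈⇒≐ e = ptw λ n → below (e n) n ℕ.≤-refl

weaken : ∀ {F G M N} → M ≤ N → F ≈[ N ] G → F ≈[ M ] G
weaken M≤N e = ptw λ n n<M → below e n (ℕ.<-≤-trans n<M M≤N)

+-mod : ∀ {F F′ G G′ N} → F ≈[ N ] F′ → G ≈[ N ] G′ → F + G ≈[ N ] F′ + G′
+-mod {F} {F′} {G} {G′} e e′ = ptw λ n n<N → ≡.trans (⊞-at F G n)
  (≡.trans (≡.cong₂ ℤ._+_ (below e n n<N) (below e′ n n<N)) (≡.sym (⊞-at F′ G′ n)))

-- A left factor of order k makes the right factor matter only modulo q^l. In `limit-sum` the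
-- growing order of the terms thus pays for the shrinking precision of the weights.
*-order : ∀ {F G H k l} → F ≈[ k ] 0# → G ≈[ l ] H → F * G ≈[ k ℕ.+ l ] F * H
*-order {F} {G} {H} {k} {l} F0 GH = ptw λ n n<k+l →
  ≡.trans (⊛-at F G n) (≡.trans (ℤΣ.Σ-cong≤ n (term n n<k+l)) (≡.sym (⊛-at F H n)))
  where
  term : ∀ n → n < k ℕ.+ l → ∀ i → i ≤ n → F i ℤ.* G (n ∸ i) ≡ F i ℤ.* H (n ∸ i)
  term n n<k+l i i≤n with i ℕ.<? k
  ... | yes i<k rewrite below F0 i i<k | 𝟘-at i = ≡.refl
  ... | no  i≮k = ≡.cong (F i ℤ.*_) (below GH (n ∸ i) (ℕ.+-cancelˡ-< i (n ∸ i) l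
          (ℕ.≤-<-trans (ℕ.≤-reflexive (ℕ.m+[n∸m]≡n i≤n))
            (ℕ.<-≤-trans n<k+l (ℕ.+-monoˡ-≤ l (ℕ.≮⇒≥ i≮k))))))

*-modˡ : ∀ {F G H N} → G ≈[ N ] H → F * G ≈[ N ] F * H
*-modˡ e = *-order {k = 0} (ptw λ _ ()) e

*-modʳ : ∀ {F G H N} → F ≈[ N ] G → F * H ≈[ N ] G * H
*-modʳ e = Mod.trans (≐⇒≈ (*-comm _ _)) (Mod.trans (*-modˡ e) (≐⇒≈ (*-comm _ _)))

*-mod : ∀ {F F′ G G′ N} → F ≈[ N ] F′ → G ≈[ N ] G′ → F * G ≈[ N ] F′ * G′
*-mod e e′ = Mod.trans (*-modˡ e′) (*-modʳ e)

*-mod-1 : ∀ {F G N} → F ≈[ N ] 1# → G ≈[ N ] 1# → F * G ≈[ N ] 1#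
*-mod-1 e e′ = Mod.trans (*-mod e e′) (≐⇒≈ (*-identityˡ 1#))

order-* : ∀ {F k} G → F ≈[ k ] 0# → F * G ≈[ k ] 0#
order-* G e = Mod.trans (*-modʳ e) (≐⇒≈ (zeroˡ G))

*-order′ : ∀ {G k} F → G ≈[ k ] 0# → F * G ≈[ k ] 0#
*-order′ F e = Mod.trans (*-modˡ e) (≐⇒≈ (zeroʳ F))

Σ-mod : ∀ {f g N} n → (∀ i → i ≤ n → f i ≈[ N ] g i) → Σ≤ f n ≈[ N ] Σ≤ g n
Σ-mod zero    e = e 0 z≤n
Σ-mod (suc n) e = +-mod (Σ-mod n (λ i i≤n → e i (ℕ.m≤n⇒m≤1+n i≤n))) (e (suc n) ℕ.≤-refl)

q^-≢ : ∀ {k n} → n ≢ k → (q^ k) n ≡ + 0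
q^-≢ {k} {n} n≢k = ≡.trans (q^-at k n) (qpow-≢ {k} {n} n≢k)

q^-refl : ∀ k → (q^ k) k ≡ + 1
q^-refl k = ≡.trans (q^-at k k) (qpow-≡ k)

q^-order : ∀ k → q^ k ≈[ k ] 0#
q^-order k = ptw λ n n<k → ≡.trans (q^-≢ (ℕ.<⇒≢ n<k)) (≡.sym (𝟘-at n))

q^-order≤ : ∀ {k m} → m ≤ k → q^ k ≈[ m ] 0#
q^-order≤ m≤k = weaken m≤k (q^-order _)

q^-≡ : ∀ {m n} → m ≡ n → q^ m ≐ q^ n
q^-≡ ≡.refl = refl

q^-+ : ∀ m n → q^ (m ℕ.+ n) ≐ q^ m * q^ n
q^-+ m n = ptw coefficient
  where
  coefficient : ∀ i → (q^ (m ℕ.+ n)) i ≡ (q^ m * q^ n) i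
  coefficient i with m ℕ.≤? i
  ... | no m≰i = ≡.trans (q^-≢ (λ { ≡.refl → m≰i (ℕ.m≤m+n m n) }))
                         (≡.sym (q^-⊛-< m (q^ n) i (ℕ.≰⇒> m≰i)))
  ... | yes m≤i with i ∸ m ℕ.≟ n
  ...   | yes ≡.refl = ≡.trans (≡.trans (≡.cong (λ k → (q^ k) i) (ℕ.m+[n∸m]≡n m≤i)) (q^-refl i))
                         (≡.sym (≡.trans (q^-⊛-≥ m (q^ n) i m≤i) (q^-refl n)))
  ...   | no i∸m≢n = ≡.trans (q^-≢ (λ { ≡.refl → i∸m≢n (ℕ.m+n∸m≡n m n) }))
                         (≡.sym (≡.trans (q^-⊛-≥ m (q^ n) i m≤i) (q^-≢ i∸m≢n)))

q^-cancel : ∀ k {F G} → q^ k * F ≐ q^ k * G → F ≐ G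
q^-cancel k {F} {G} e = ptw λ n → ≡.trans (≡.sym (shifted n F)) (≡.trans (at e (k ℕ.+ n)) (shifted n G))
  where
  shifted : ∀ n F → (q^ k * F) (k ℕ.+ n) ≡ F n
  shifted n F = ≡.trans (q^-⊛-≥ k F (k ℕ.+ n) (ℕ.m≤m+n k n)) (≡.cong F (ℕ.m+n∸m≡n k n))

-- Geometric series as inverses of 1 - q^m and 1 + q^m

private
  geomInv-small : ∀ c m n → n < suc m → geomInv c (suc m) n ≡ 1ₛ n
  geomInv-small c m zero    _   = ≡.refl
  geomInv-small c m (suc n) n<M rewrite m<n⇒m%n≡m n<M = ≡.refl

  geomInv-large : ∀ c m n → suc m ≤ n → geomInv c (suc m) n ≡ c ℤ.* geomInv c (suc m) (n ∸ suc m)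
  geomInv-large c m n M≤n rewrite m≤n⇒[n∸m]%m≡n%m {suc m} {n} M≤n with n % suc m ℕ.≡ᵇ 0
  ... | true  rewrite m/n≡1+[m∸n]/n {n} {suc m} M≤n = ≡.refl
  ... | false = ≡.sym (ℤ.*-zeroʳ c)

  geomInv-shift : ∀ c m n → geomInv c (suc m) n ≡ 1ₛ n ℤ.+ c ℤ.* (q^ suc m * geomInv c (suc m)) n
  geomInv-shift c m n with suc m ℕ.≤? n
  ... | yes M≤n rewrite q^-⊛-≥ (suc m) (geomInv c (suc m)) n M≤n | qpow-≢ {0} {n} (ℕ.m<n⇒n≢0 M≤n) =
          ≡.trans (geomInv-large c m n M≤n) (≡.sym (ℤ.+-identityˡ _))
  ... | no  M≰n rewrite q^-⊛-< (suc m) (geomInv c (suc m)) n (ℕ.≰⇒> M≰n) | ℤ.*-zeroʳ c =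
          ≡.trans (geomInv-small c m n (ℕ.≰⇒> M≰n)) (≡.sym (ℤ.+-identityʳ (1ₛ n)))

opaque
  geo⁺ geo⁻ : ℕ → PS
  geo⁺ = geomInv (+ 1)
  geo⁻ = geomInv (ℤ.- + 1)

  geo⁺≐ : ∀ m → geomInv (+ 1) m ≐ geo⁺ m
  geo⁺≐ m = refl

  geo⁻≐ : ∀ m → geomInv (ℤ.- + 1) m ≐ geo⁻ m
  geo⁻≐ m = refl

  geo⁺-shift : ∀ m → geo⁺ (suc m) ≐ 1# + q^ suc m * geo⁺ (suc m)
  geo⁺-shift m = ptw λ n → ≡.trans (geomInv-shift (+ 1) m n)
    (≡.trans (≡.cong₂ ℤ._+_ (≡.sym (𝟙-at n)) (ℤ.*-identityˡ _)) (≡.sym (⊞-at 1# _ n)))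

  geo⁻-shift : ∀ m → geo⁻ (suc m) ≐ 1# - q^ suc m * geo⁻ (suc m)
  geo⁻-shift m = ptw λ n → ≡.trans (geomInv-shift (ℤ.- + 1) m n)
    (≡.trans (≡.cong₂ ℤ._+_ (≡.sym (𝟙-at n)) (≡.trans (ℤ.-1*i≡-i _) (≡.sym (⊟-at _ n)))) (≡.sym (⊞-at 1# _ n)))

geo⁺-inverse : ∀ {m} → 1 ≤ m → (1# - q^ m) * geo⁺ m ≐ 1#
geo⁺-inverse {suc m} _ = begin
  (1# - q^ suc m) * geo⁺ (suc m)
    ≈⟨ solve 2 (λ x g → (con (+ 1) :- x) :* g := g :- x :* g) refl _ _ ⟩
  geo⁺ (suc m) - q^ suc m * geo⁺ (suc m)
    ≈⟨ +-congʳ (geo⁺-shift m) ⟩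
  1# + q^ suc m * geo⁺ (suc m) - q^ suc m * geo⁺ (suc m)
    ≈⟨ solve 2 (λ x g → con (+ 1) :+ x :* g :- x :* g := con (+ 1)) refl (q^ suc m) (geo⁺ (suc m)) ⟩
  1# ∎
  where open ≐-Reasoning

geo⁻-inverse : ∀ {m} → 1 ≤ m → (1# + q^ m) * geo⁻ m ≐ 1#
geo⁻-inverse {suc m} _ = begin
  (1# + q^ suc m) * geo⁻ (suc m)
    ≈⟨ solve 2 (λ x g → (con (+ 1) :+ x) :* g := g :+ x :* g) refl _ _ ⟩
  geo⁻ (suc m) + q^ suc m * geo⁻ (suc m)
    ≈⟨ +-congʳ (geo⁻-shift m) ⟩
  1# - q^ suc m * geo⁻ (suc m) + q^ suc m * geo⁻ (suc m)
    ≈⟨ solve 2 (λ x g → con (+ 1) :- x :* g :+ x :* g := con (+ 1)) refl (q^ suc m) (geo⁻ (suc m)) ⟩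
  1# ∎
  where open ≐-Reasoning

inverse-unique : ∀ {A B C} → A * B ≐ 1# → A * C ≐ 1# → B ≐ C
inverse-unique {A} {B} {C} AB AC = begin
  B          ≈⟨ sym (*-identityˡ B) ⟩
  1# * B     ≈⟨ *-congʳ (sym AC) ⟩
  A * C * B  ≈⟨ solve 3 (λ a b c → a :* c :* b := a :* b :* c) refl A B C ⟩
  A * B * C  ≈⟨ *-congʳ AB ⟩
  1# * C     ≈⟨ *-identityˡ C ⟩
  C          ∎
  where open ≐-Reasoning

private
  unit-expand : ∀ {A A⁻¹} F → A * A⁻¹ ≐ 1# → F ≐ A⁻¹ * (A * F)
  unit-expand {A} {A⁻¹} F inv = trans (sym (*-identityˡ F)) (trans (*-congʳ (sym inv))
    (solve 3 (λ a b f → a :* b :* f := b :* (a :* f)) refl A A⁻¹ F))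

unit-cancel : ∀ {A A⁻¹ F G} → A * A⁻¹ ≐ 1# → A * F ≐ A * G → F ≐ G
unit-cancel inv e = trans (unit-expand _ inv) (trans (*-congˡ e) (sym (unit-expand _ inv)))

unit-cancel-mod : ∀ {A A⁻¹ F G N} → A * A⁻¹ ≐ 1# → A * F ≈[ N ] A * G → F ≈[ N ] G
unit-cancel-mod inv e =
  Mod.trans (≐⇒≈ (unit-expand _ inv)) (Mod.trans (*-modˡ e) (≐⇒≈ (sym (unit-expand _ inv))))

*-inverse : ∀ {A A⁻¹ B B⁻¹} → A * A⁻¹ ≐ 1# → B * B⁻¹ ≐ 1# → (A * B) * (A⁻¹ * B⁻¹) ≐ 1#
*-inverse e e′ = trans (solve 4 (λ a b c d → a :* b :* (c :* d) := a :* c :* (b :* d)) refl _ _ _ _)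
  (trans (*-cong e e′) (*-identityˡ 1#))

1-q^≈1 : ∀ m → 1# - q^ m ≈[ m ] 1#
1-q^≈1 m = Mod.trans (+-mod Mod.refl neg) (≐⇒≈ (+-identityʳ 1#))
  where
  neg : ⊝ q^ m ≈[ m ] 0#
  neg = Mod.trans (≐⇒≈ (solve 1 (λ x → :- x := con (ℤ.- + 1) :* x) refl _)) (*-order′ (ι (ℤ.- + 1)) (q^-order m))

1+q^≈1 : ∀ m → 1# + q^ m ≈[ m ] 1#
1+q^≈1 m = Mod.trans (+-mod Mod.refl (q^-order m)) (≐⇒≈ (+-identityʳ 1#))

private
  inverse≈1 : ∀ {A A⁻¹ N} → A * A⁻¹ ≐ 1# → A ≈[ N ] 1# → A⁻¹ ≈[ N ] 1#
  inverse≈1 inv e = unit-cancel-mod inv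
    (Mod.trans (≐⇒≈ inv) (Mod.trans (Mod.sym e) (≐⇒≈ (sym (*-identityʳ _)))))

geo⁺≈1 : ∀ {m} → 1 ≤ m → geo⁺ m ≈[ m ] 1#
geo⁺≈1 1≤m = inverse≈1 (geo⁺-inverse 1≤m) (1-q^≈1 _)

geo⁻≈1 : ∀ {m} → 1 ≤ m → geo⁻ m ≈[ m ] 1#
geo⁻≈1 1≤m = inverse≈1 (geo⁻-inverse 1≤m) (1+q^≈1 _)

Π-mod-1 : ∀ {u N} → (∀ j → u j ≈[ N ] 1#) → ∀ n → Π< u n ≈[ N ] 1#
Π-mod-1 e zero    = Mod.refl
Π-mod-1 e (suc n) = *-mod-1 (Π-mod-1 e n) (e n)

-- Infinite products and sums

opaque
  Π∞ : (ℕ → PS) → PS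
  Π∞ u n = Π< u n n

  Π∞-at : ∀ u n → Π∞ u n ≡ Π< u n n
  Π∞-at u n = ≡.refl

  Σ∞ : (ℕ → PS) → PS
  Σ∞ = tsum

  Σ∞-at : ∀ t n → Σ∞ t n ≡ Σ≤ t n n
  Σ∞-at t n = go n
    where
    go : ∀ m → sumTo (λ k → t k n) m ≡ Σ≤ t m n
    go zero    = ≡.refl
    go (suc m) = ≡.trans (≡.cong (ℤ._+ t (suc m) n) (go m)) (≡.sym (⊞-at (Σ≤ t m) (t (suc m)) n))

  tsum≐ : ∀ t → tsum t ≐ Σ∞ t
  tsum≐ t = refl

-- This growth condition makes the product of the first n factors stable modulo q^(n+1), so the
-- diagonal definition of `Π∞` is the limit. The truncation is the one used by `fq` and `fqInv`.
Factors : (ℕ → PS) → Set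
Factors u = ∀ j → u j ≈[ suc j ] 1#

Π<≈Π∞ : ∀ {u} → Factors u → ∀ n → Π< u n ≈[ suc n ] Π∞ u
Π<≈Π∞ {u} small n = ptw λ i i<1+n → ≡.trans
  (≡.cong (λ n → Π< u n i) (≡.sym (ℕ.m+[n∸m]≡n (ℕ.≤-pred i<1+n))))
  (≡.trans (below (stable i (n ∸ i)) i ℕ.≤-refl) (≡.sym (Π∞-at u i)))
  where
  stable : ∀ m d → Π< u (m ℕ.+ d) ≈[ suc m ] Π< u m
  stable m d = Mod.trans (≐⇒≈ (𝒮.Π-+ u m d))
    (Mod.trans (*-modˡ (Π-mod-1 (λ j → weaken (s≤s (ℕ.m≤m+n m j)) (small (m ℕ.+ j))) d))
               (≐⇒≈ (*-identityʳ (Π< u m))))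

Π∞-unique : ∀ {u F} → Factors u → (∀ n → Π< u n ≈[ suc n ] F) → Π∞ u ≐ F
Π∞-unique small e = ≈⇒≐ (λ n → Mod.trans (Mod.sym (Π<≈Π∞ small n)) (e n))

Π∞-cong : ∀ {u v} → (∀ j → u j ≐ v j) → Π∞ u ≐ Π∞ v
Π∞-cong {u} {v} e = ptw λ n → ≡.trans (Π∞-at u n) (≡.trans (at (𝒮.Π-cong {u} {v} n e) n) (≡.sym (Π∞-at v n)))

Factors-* : ∀ {u v} → Factors u → Factors v → Factors (λ j → u j * v j)
Factors-* e e′ j = *-mod-1 (e j) (e′ j)

Π∞-* : ∀ {u v} → Factors u → Factors v → Π∞ (λ j → u j * v j) ≐ Π∞ u * Π∞ v
Π∞-* {u} {v} e e′ = Π∞-unique (Factors-* e e′) (λ n → Mod.trans (≐⇒≈ (𝒮.Π-* u v n))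
  (*-mod (Π<≈Π∞ e n) (Π<≈Π∞ e′ n)))

Π∞-inverse : ∀ {u v} → Factors u → Factors v → (∀ j → u j * v j ≐ 1#) → Π∞ u * Π∞ v ≐ 1#
Π∞-inverse {u} {v} e e′ inv = trans (sym (Π∞-* e e′)) (Π∞-unique (Factors-* e e′)
  (λ n → Π-mod-1 (λ j → ≐⇒≈ (inv j)) n))

Π∞-2* : ∀ {u} → Factors u → Π∞ (λ j → u (2 ℕ.* j) * u (suc (2 ℕ.* j))) ≐ Π∞ u
Π∞-2* {u} e = Π∞-unique
  (λ j → *-mod-1 (weaken (s≤s (ℕ.m≤n*m j 2)) (e (2 ℕ.* j)))
                 (weaken (s≤s (ℕ.≤-trans (ℕ.m≤n*m j 2) (ℕ.n≤1+n _))) (e (suc (2 ℕ.* j)))))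
  (λ n → Mod.trans (≐⇒≈ (sym (𝒮.Π-2* u n))) (weaken (s≤s (ℕ.m≤n*m n 2)) (Π<≈Π∞ e (2 ℕ.* n))))

prodL-map-upTo : ∀ (u : ℕ → PS) n → prodL (map u (upTo n)) ≐ Π< u n
prodL-map-upTo u = go u id
  where
  go : ∀ (u : ℕ → PS) (h : ℕ → ℕ) n → prodL (map u (applyUpTo h n)) ≐ Π< (u ∘ h) n
  go u h zero    = 1ₛ≐
  go u h (suc n) = trans (*ₛ≐ _ _) (trans (*-congˡ (go u (h ∘ suc) n)) (sym (𝒮.Π-first (u ∘ h) n)))

Terms : (ℕ → PS) → Set
Terms t = ∀ n → t n ≈[ n ] 0#

Σ≤≈Σ∞ : ∀ {t} → Terms t → ∀ n → Σ≤ t n ≈[ suc n ] Σ∞ t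
Σ≤≈Σ∞ {t} small n = ptw λ i i<1+n →
  ≡.trans (≡.cong (λ n → Σ≤ t n i) (≡.sym (ℕ.m∸n+n≡m (ℕ.≤-pred i<1+n))))
    (≡.trans (stable i (n ∸ i)) (≡.sym (Σ∞-at t i)))
  where
  stable : ∀ i d → Σ≤ t (d ℕ.+ i) i ≡ Σ≤ t i i
  stable i zero    = ≡.refl
  stable i (suc d) = ≡.trans (⊞-at (Σ≤ t (d ℕ.+ i)) (t (suc d ℕ.+ i)) i)
    (≡.trans (≡.cong₂ ℤ._+_ (stable i d)
      (≡.trans (below (small (suc d ℕ.+ i)) i (s≤s (ℕ.m≤n+m i d))) (𝟘-at i))) (ℤ.+-identityʳ _))

Σ∞-unique : ∀ {t F} → Terms t → (∀ n → Σ≤ t n ≈[ suc n ] F) → Σ∞ t ≐ F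
Σ∞-unique {t} small e = ≈⇒≐ (λ n → Mod.trans (Mod.sym (Σ≤≈Σ∞ {t} small n)) (e n))

Σ∞-cong : ∀ {t t′} → (∀ n → t n ≐ t′ n) → Σ∞ t ≐ Σ∞ t′
Σ∞-cong {t} {t′} e = ptw λ n → ≡.trans (Σ∞-at t n) (≡.trans (at (𝒮.Σ-cong {t} {t′} n e) n) (≡.sym (Σ∞-at t′ n)))

Σ∞-+ : ∀ t t′ → Σ∞ (λ n → t n + t′ n) ≐ Σ∞ t + Σ∞ t′
Σ∞-+ t t′ = ptw λ n → ≡.trans (Σ∞-at (λ n → t n + t′ n) n) (≡.trans (at (𝒮.Σ-+ t t′ n) n)
  (≡.trans (⊞-at (Σ≤ t n) (Σ≤ t′ n) n)
    (≡.trans (≡.cong₂ ℤ._+_ (≡.sym (Σ∞-at t n)) (≡.sym (Σ∞-at t′ n))) (≡.sym (⊞-at (Σ∞ t) (Σ∞ t′) n)))))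

Σ∞-*ˡ : ∀ F {t} → Terms t → Σ∞ (λ n → F * t n) ≐ F * Σ∞ t
Σ∞-*ˡ F {t} small = Σ∞-unique {λ n → F * t n} (λ n → *-order′ F (small n))
  (λ n → Mod.trans (≐⇒≈ (𝒮.Σ-*ˡ F t n)) (*-modˡ (Σ≤≈Σ∞ {t} small n)))

-- Tannery's theorem: U depends on N, and U r → V r as N → ∞.
limit-sum : ∀ {t V : ℕ → PS} → Terms t → ∀ N (U : ℕ → PS) → (∀ r → r ≤ N → U r ≈[ suc (N ∸ r) ] V r) →
  Σ≤ (λ r → t r * U r) N ≈[ suc N ] Σ∞ (λ r → t r * V r)
limit-sum {t} {V} small N U lim = Mod.trans
  (Σ-mod {λ r → t r * U r} {λ r → t r * V r} N (λ r r≤N →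
    weaken (ℕ.≤-reflexive (≡.sym (≡.trans (ℕ.+-suc r (N ∸ r)) (≡.cong suc (ℕ.m+[n∸m]≡n r≤N)))))
      (*-order (small r) (lim r r≤N))))
  (Σ≤≈Σ∞ {λ r → t r * V r} (λ r → order-* (V r) (small r)) N)

-- Specialisation to Q = q^b and limits of the finite identities

tri : ℕ → ℕ
tri zero    = 0
tri (suc r) = tri r ℕ.+ suc r

r≤tri : ∀ r → r ≤ tri r
r≤tri zero    = z≤n
r≤tri (suc r) = ℕ.m≤n+m (suc r) (tri r)

n≤n*[n+s] : ∀ n s → n ≤ n ℕ.* (n ℕ.+ s)
n≤n*[n+s] zero    s = z≤n
n≤n*[n+s] (suc n) s = ℕ.m≤m*n (suc n) (suc n ℕ.+ s)

sgn : ℕ → PS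
sgn zero    = 1#
sgn (suc r) = ⊝ sgn r

eta etaInv : ℕ → PS
eta k    = Π∞ (λ j → 1# - q^ (k ℕ.* suc j))
etaInv k = Π∞ (λ j → geo⁺ (k ℕ.* suc j))

1-cancel : ∀ {F G} → 1# * F ≐ 1# * G → F ≐ G
1-cancel e = trans (sym (*-identityˡ _)) (trans e (*-identityˡ _))

module Base (b : ℕ) (1≤b : 1 ≤ b) where

  m≤b*m : ∀ m → m ≤ b ℕ.* m
  m≤b*m m = ℕ.≤-trans (ℕ.≤-reflexive (≡.sym (ℕ.*-identityˡ m))) (ℕ.*-monoˡ-≤ m 1≤b)

  base : QBase psRing
  base = record
    { pw        = λ e → q^ (b ℕ.* e)
    ; pw-0      = trans (q^-≡ (ℕ.*-zeroʳ b)) q^0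
    ; pw-+      = λ m n → trans (q^-≡ (ℕ.*-distribˡ-+ b m n)) (q^-+ (b ℕ.* m) (b ℕ.* n))
    ; g         = λ k → geo⁺ (b ℕ.* suc k)
    ; g-inverse = λ k → geo⁺-inverse (ℕ.≤-trans (s≤s z≤n) (m≤b*m (suc k)))
    }

  open QBase base public
  open FiniteQ psRing base public
  open PartialFractions psRing base public

  private
    factors⁺ : Factors (λ j → geo⁺ (b ℕ.* suc j))
    factors⁺ j = weaken (m≤b*m (suc j)) (geo⁺≈1 (ℕ.≤-trans (s≤s z≤n) (m≤b*m (suc j))))

    factors⁻ : Factors (λ j → 1# - q^ (b ℕ.* suc j))
    factors⁻ j = weaken (m≤b*m (suc j)) (1-q^≈1 (b ℕ.* suc j))

  eta-inverse : eta b * etaInv b ≐ 1#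
  eta-inverse = Π∞-inverse factors⁻ factors⁺ g-inverse

  I≈ : ∀ {m k} → m ≤ suc k → I k ≈[ m ] etaInv b
  I≈ {m} {k} m≤1+k = weaken m≤1+k (Mod.trans (≐⇒≈ (I≐ k)) (Π<≈Π∞ factors⁺ k))
    where
    I≐ : ∀ k → I k ≐ Π< (λ j → geo⁺ (b ℕ.* suc j)) k
    I≐ zero    = refl
    I≐ (suc k) = *-congʳ (I≐ k)

  χ≐ : ∀ r → χ r ≐ sgn r * q^ (b ℕ.* tri r)
  χ≐ zero    = trans (sym (*-identityˡ 1#)) (*-congˡ (sym pw-0))
  χ≐ (suc r) = trans (-‿cong (*-congʳ (χ≐ r)))
    (trans (solve 3 (λ s x y → :- (s :* x :* y) := :- s :* (x :* y)) refl _ _ _)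
           (*-congˡ (sym (pw-+ (tri r) (suc r)))))

  χ-order : ∀ r → χ r ≈[ r ] 0#
  χ-order r = Mod.trans (≐⇒≈ (χ≐ r))
    (*-order′ (sgn r) (q^-order≤ (ℕ.≤-trans (r≤tri r) (m≤b*m (tri r)))))

  module Limits (W : Weight) where
    open Weight W public
    open Expansion W public

    II≈ : ∀ N r → r ≤ N → I (N ∸ r) * I (N ℕ.+ r ℕ.+ s) ≈[ suc (N ∸ r) ] etaInv b * etaInv b
    II≈ N r _ = *-mod (I≈ ℕ.≤-refl)
      (I≈ (s≤s (ℕ.≤-trans (ℕ.m∸n≤m N r) (ℕ.≤-trans (ℕ.m≤m+n N r) (ℕ.m≤m+n (N ℕ.+ r) s)))))

    square-order : ∀ n → pw (n ℕ.* (n ℕ.+ s)) ≈[ n ] 0#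
    square-order n = q^-order≤ (ℕ.≤-trans (n≤n*[n+s] n s) (m≤b*m _))

    -- As N grows, `I (N ∸ n)` on the left of `bailey` tends to 1/f_b, while the two factors on the
    -- right tend to 1/f_b². Cancelling one of them leaves the single factor 1/f_b.
    bailey-limit : ∀ (d c : ℕ → PS) → (∀ n → c n ≐ Σ≤ (λ r → c[ n , r ] * d r) n) →
      Σ∞ (λ n → pw (n ℕ.* (n ℕ.+ s)) * c n)
        ≐ etaInv b * Σ∞ (λ r → χ r * σ r * pw (r ℕ.* (r ℕ.+ s)) * d r)
    bailey-limit d c c≐ = unit-cancel (trans (*-comm _ _) eta-inverse) (begin
      ε * Σ∞ t            ≈⟨ sym (Σ∞-*ˡ ε t-order) ⟩
      Σ∞ (λ n → ε * t n)  ≈⟨ Σ∞-cong (λ n → *-comm ε (t n)) ⟩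
      Σ∞ (λ n → t n * ε)  ≈⟨ ≈⇒≐ (λ N → Mod.trans (Mod.sym (left N)) (Mod.trans (≐⇒≈ (bailey d c c≐ N)) (right N))) ⟩
      Σ∞ (λ r → t′ r * (ε * ε))  ≈⟨ Σ∞-cong (λ r → *-comm (t′ r) (ε * ε)) ⟩
      Σ∞ (λ r → ε * ε * t′ r)  ≈⟨ Σ∞-*ˡ (ε * ε) t′-order ⟩
      ε * ε * Σ∞ t′       ≈⟨ *-assoc ε ε _ ⟩
      ε * (ε * Σ∞ t′)     ∎)
      where
      open ≐-Reasoning
      ε : PS
      ε = etaInv b
      t t′ : ℕ → PS
      t n = pw (n ℕ.* (n ℕ.+ s)) * c n
      t′ r = χ r * σ r * pw (r ℕ.* (r ℕ.+ s)) * d r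
      t-order : Terms t
      t-order n = order-* (c n) (square-order n)
      t′-order : Terms t′
      t′-order r = order-* (d r) (*-order′ (χ r * σ r) (square-order r))
      left : ∀ N → Σ≤ (λ n → pw (n ℕ.* (n ℕ.+ s)) * I (N ∸ n) * c n) N ≈[ suc N ] Σ∞ (λ n → t n * ε)
      left N = Mod.trans
        (≐⇒≈ (𝒮.Σ-cong N (λ n → solve 3 (λ p i c → p :* i :* c := p :* c :* i) refl (pw (n ℕ.* (n ℕ.+ s))) (I (N ∸ n)) (c n))))
        (limit-sum {t} {λ _ → ε} t-order N (λ n → I (N ∸ n)) (λ n _ → I≈ ℕ.≤-refl))
      right : ∀ N → Σ≤ (λ r → t′ r * (I (N ∸ r) * I (N ℕ.+ r ℕ.+ s))) N ≈[ suc N ] Σ∞ (λ r → t′ r * (ε * ε))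
      right N = limit-sum {t′} {λ _ → ε * ε} t′-order N (λ r → I (N ∸ r) * I (N ℕ.+ r ℕ.+ s)) (II≈ N)

    -- The weights U are the inner products of a double expansion and have not reached their limit V
    -- at stage N. A precision of about N - r suffices for `U r`, because `χ r` has order r.
    weighted-limit : ∀ {d V : ℕ → PS} N (U : ℕ → PS) → (∀ r → r ≤ N → U r ≈[ suc (N ∸ r) ] V r) →
      Σ≤ (λ r → c[ N , r ] * d r * U r) N
        ≈[ suc N ] etaInv b * etaInv b * Σ∞ (λ r → χ r * σ r * d r * V r)
    weighted-limit {d} {V} N U lim = begin
      Σ≤ (λ r → c[ N , r ] * d r * U r) N
        ≈⟨ ≐⇒≈ (𝒮.Σ-cong N (λ r → solve 5 (λ χ σ i d u → χ :* σ :* i :* d :* u := χ :* σ :* d :* (i :* u)) refl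
             (χ r) (σ r) (I (N ∸ r) * I (N ℕ.+ r ℕ.+ s)) (d r) (U r))) ⟩
      Σ≤ (λ r → χ r * σ r * d r * (I (N ∸ r) * I (N ℕ.+ r ℕ.+ s) * U r)) N
        ≈⟨ limit-sum {t} {λ r → ε * ε * V r} t-order N (λ r → I (N ∸ r) * I (N ℕ.+ r ℕ.+ s) * U r)
             (λ r r≤N → *-mod (II≈ N r r≤N) (lim r r≤N)) ⟩
      Σ∞ (λ r → t r * (ε * ε * V r))
        ≈⟨ ≐⇒≈ (Σ∞-cong (λ r → solve 3 (λ t e v → t :* (e :* v) := e :* (t :* v)) refl (t r) (ε * ε) (V r))) ⟩
      Σ∞ (λ r → ε * ε * (t r * V r))
        ≈⟨ ≐⇒≈ (Σ∞-*ˡ (ε * ε) (λ r → order-* (V r) (t-order r))) ⟩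
      ε * ε * Σ∞ (λ r → t r * V r) ∎
      where
      open SetoidReasoning (mod (suc N))
      ε : PS
      ε = etaInv b
      t : ℕ → PS
      t r = χ r * σ r * d r
      t-order : Terms t
      t-order r = order-* (d r) (order-* (σ r) (χ-order r))

    expansion-limit : ∀ (d c : ℕ → PS) {L} → (∀ n → c n ≐ Σ≤ (λ r → c[ n , r ] * d r) n) →
      (∀ N → c N ≈[ suc N ] L) → L ≐ etaInv b * etaInv b * Σ∞ (λ r → χ r * σ r * d r)
    expansion-limit d c {L} c≐ c→L = ≈⇒≐ (λ N → begin
      L                                              ≈⟨ Mod.sym (c→L N) ⟩
      c N                                            ≈⟨ ≐⇒≈ (c≐ N) ⟩
      Σ≤ (λ r → c[ N , r ] * d r) N                  ≈⟨ ≐⇒≈ (𝒮.Σ-cong N (λ r → sym (*-identityʳ _))) ⟩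
      Σ≤ (λ r → c[ N , r ] * d r * 1#) N             ≈⟨ weighted-limit {d} {λ _ → 1#} N (λ _ → 1#) (λ _ _ → Mod.refl) ⟩
      etaInv b * etaInv b * Σ∞ (λ r → χ r * σ r * d r * 1#)  ≈⟨ ≐⇒≈ (*-congˡ (Σ∞-cong (λ r → *-identityʳ _))) ⟩
      etaInv b * etaInv b * Σ∞ (λ r → χ r * σ r * d r)       ∎)
      where
      open module R {N} = SetoidReasoning (mod (suc N))

-- From the defining series to Appell-Lerch series

module ℤS = Data.Integer.Solver.+-*-Solver

square : PS → PS
square F = F * F

^ₛ2≐ : ∀ {F G} → F ≐ G → F ^ₛ 2 ≐ square G
^ₛ2≐ {F} {G} e = trans (*ₛ≐ _ _) (trans (*-congˡ (trans (*ₛ≐ _ _) (trans (*-congˡ 1ₛ≐) (*-identityʳ F)))) (*-cong e e))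

·ₛ2≐ : ∀ F → (+ 2) ·ₛ F ≐ ι (+ 2) * F
·ₛ2≐ F = trans (ptw λ n → ≡.trans (ℤS.solve 1 (λ x → ℤS.con (+ 2) ℤS.:* x ℤS.:= x ℤS.:+ x) ≡.refl (F n)) (≡.sym (⊞-at F F n)))
  (solve 1 (λ f → f :+ f := con (+ 2) :* f) refl F)

·ₛ4≐ : ∀ F → (+ 4) ·ₛ F ≐ ι (+ 4) * F
·ₛ4≐ F = trans (ptw λ n → ≡.trans (ℤS.solve 1 (λ x → ℤS.con (+ 4) ℤS.:* x ℤS.:= (x ℤS.:+ x) ℤS.:+ (x ℤS.:+ x)) ≡.refl (F n))
    (≡.sym (≡.trans (⊞-at (F + F) (F + F) n) (≡.cong₂ ℤ._+_ (⊞-at F F n) (⊞-at F F n)))))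
  (solve 1 (λ f → (f :+ f) :+ (f :+ f) := con (+ 4) :* f) refl F)

4-cancel : ∀ {F G} → ι (+ 4) * F ≐ ι (+ 4) * G → F ≐ G
4-cancel {F} {G} e = ptw λ n → ℤ.*-cancelˡ-≡ (+ 4) (F n) (G n)
  (at (trans (·ₛ4≐ F) (trans e (sym (·ₛ4≐ G)))) n)

fq≐ : ∀ k → fq k ≐ eta k
fq≐ k = ptw λ n → ≡.trans (at (trans (prodL-map-upTo (λ j → oneMinus (+ 1) (k ℕ.* suc j)) n)
  (𝒮.Π-cong n (λ j → factor (k ℕ.* suc j)))) n) (≡.sym (Π∞-at _ n))
  where
  factor : ∀ m → oneMinus (+ 1) m ≐ 1# - q^ m
  factor m = trans (-ₛ≐ _ _) (+-cong 1ₛ≐ (-‿cong (trans (ptw λ n → ℤ.*-identityˡ (qpow m n)) (qpow≐ m))))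

fqInv≐ : ∀ k → fqInv k ≐ etaInv k
fqInv≐ k = ptw λ n → ≡.trans (at (trans (prodL-map-upTo (λ j → geomInv (+ 1) (k ℕ.* suc j)) n)
  (𝒮.Π-cong n (λ j → geo⁺≐ (k ℕ.* suc j)))) n) (≡.sym (Π∞-at _ n))

pochInv⁺≐ : ∀ a d n → pochInv (+ 1) a d n ≐ Π< (λ j → geo⁺ (a ℕ.+ d ℕ.* j)) n
pochInv⁺≐ a d n = trans (prodL-map-upTo _ n) (𝒮.Π-cong n (λ j → geo⁺≐ _))

pochInv⁻≐ : ∀ a d n → pochInv (ℤ.- + 1) a d n ≐ Π< (λ j → geo⁻ (a ℕ.+ d ℕ.* j)) n
pochInv⁻≐ a d n = trans (prodL-map-upTo _ n) (𝒮.Π-cong n (λ j → geo⁻≐ _))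

module Q1 = Base 1 (s≤s z≤n)
module Q2 = Base 2 (s≤s z≤n)
module Q4 = Base 4 (s≤s z≤n)
module Q6 = Base 6 (s≤s z≤n)
module L2 = Q2.Limits Q2.weight₁
module L6 = Q6.Limits Q6.weight₁

odd : ℕ → ℕ
odd r = suc (2 ℕ.* r)

δ : ℕ → PS
δ r = square (geo⁺ (odd r))

δ-inverse : ∀ r → square (1# - q^ odd r) * δ r ≐ 1#
δ-inverse r = *-inverse (geo⁺-inverse (s≤s z≤n)) (geo⁺-inverse (s≤s z≤n))

odd-shift : ∀ r k → odd (suc (r ℕ.+ k)) ≡ odd r ℕ.+ 2 ℕ.* suc k
odd-shift r k = ℕS.solve 2 (λ r k → κ 1 ⊕ κ 2 ⊗ (κ 1 ⊕ (r ⊕ k)) ⊜ κ 1 ⊕ κ 2 ⊗ r ⊕ κ 2 ⊗ (κ 1 ⊕ k)) ≡.refl r k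
  where open ℕS using () renaming (_:+_ to _⊕_; _:*_ to _⊗_; _:=_ to _⊜_; con to κ)

odd-product : ∀ r k → odd r ℕ.+ odd (suc (r ℕ.+ k)) ≡ 2 ℕ.* (suc (r ℕ.+ k) ℕ.+ r ℕ.+ 1)
odd-product r k = ℕS.solve 2 (λ r k → κ 1 ⊕ κ 2 ⊗ r ⊕ (κ 1 ⊕ κ 2 ⊗ (κ 1 ⊕ (r ⊕ k))) ⊜ κ 2 ⊗ (κ 1 ⊕ (r ⊕ k) ⊕ r ⊕ κ 1)) ≡.refl r k
  where open ℕS using () renaming (_:+_ to _⊕_; _:*_ to _⊗_; _:=_ to _⊜_; con to κ)

-- The fixed point is z = 1: V = z + 1/z = 2 makes the denominator 1 - 2X + X² = (1 - X)² with X =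
-- q^(2r+1).
δ-poles : L2.Poles 1# δ
δ-poles = L2.poles {1#} {ι (+ 2)} {1#} {1#} {λ r → q^ odd r} {δ} 1-cancel
  (λ r k → trans (q^-≡ (odd-shift r k)) (q^-+ (odd r) _))
  (λ r k → trans (*-congʳ (*-identityˡ _)) (trans (sym (q^-+ (odd r) _)) (q^-≡ (odd-product r k))))
  (λ r → trans (*-congʳ (solve 1 (λ x → con (+ 1) :* (con (+ 1) :+ con (+ 1) :* x :* x) :- con (+ 2) :* x
                                     := (con (+ 1) :- x) :* (con (+ 1) :- x)) refl _))
               (trans (δ-inverse r) (sym (*-identityˡ 1#))))

δ-expansion : ∀ n → Π< δ (suc n) ≐ Σ≤ (λ r → L2.c[ n , r ] * δ r) n
δ-expansion = L2.expansion 1# 1-cancel δ (λ n → Π< δ (suc n)) δ-poles (*-identityˡ _) (λ n → *-identityˡ _)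

ω-lerch : ω ≐ etaInv 2 * Σ∞ (λ r → Q2.χ r * Q2.σ₁ r * q^ (2 ℕ.* (r ℕ.* (r ℕ.+ 1))) * δ r)
ω-lerch = trans (tsum≐ _) (trans (Σ∞-cong term) (L2.bailey-limit δ (λ n → Π< δ (suc n)) δ-expansion))
  where
  term : ∀ n → qpow (2 ℕ.* n ℕ.* suc n) *ₛ pochInv (+ 1) 1 2 (suc n) ^ₛ 2 ≐ q^ (2 ℕ.* (n ℕ.* (n ℕ.+ 1))) * Π< δ (suc n)
  term n = trans (*ₛ≐ _ _) (*-cong
    (trans (qpow≐ _) (q^-≡ (≡.trans (ℕ.*-assoc 2 n (suc n)) (≡.cong (λ k → 2 ℕ.* (n ℕ.* k)) (≡.sym (ℕ.+-comm n 1))))))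
    (trans (^ₛ2≐ (pochInv⁺≐ 1 2 (suc n))) (sym (𝒮.Π-* (λ r → geo⁺ (odd r)) (λ r → geo⁺ (odd r)) (suc n)))))

-- The pole at -1 is normalised to have value 1, whence κ = 4.
module Even (b : ℕ) (1≤b : 1 ≤ b) where
  open Base b 1≤b
  module L = Limits weight₀

  ε : ℕ → PS
  ε zero    = 1#
  ε (suc r) = ι (+ 4) * square (geo⁻ (b ℕ.* suc r))

  partial : ℕ → PS
  partial = Π< (λ j → square (geo⁻ (b ℕ.* suc j)))

  ε-inverse : ∀ r → square (1# + pw r) * ε r ≐ ι (+ 4)
  ε-inverse zero    = trans (*-congʳ (*-cong (+-congˡ pw-0) (+-congˡ pw-0)))
    (solve 0 ((con (+ 1) :+ con (+ 1)) :* (con (+ 1) :+ con (+ 1)) :* con (+ 1) := con (+ 4)) refl)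
  ε-inverse (suc r) = trans (solve 2 (λ d g → d :* (con (+ 4) :* g) := con (+ 4) :* (d :* g)) refl _ _)
    (trans (*-congˡ (*-inverse inverse inverse)) (*-identityʳ _))
    where
    inverse : (1# + pw (suc r)) * geo⁻ (b ℕ.* suc r) ≐ 1#
    inverse = geo⁻-inverse (ℕ.≤-trans (s≤s z≤n) (m≤b*m (suc r)))

  ε-poles : L.Poles (ι (+ 4)) ε
  ε-poles = L.poles {1#} { ⊝ ι (+ 2)} {1#} {ι (+ 4)} {pw} {ε} 1-cancel
    (λ r k → trans (pw-≡ (≡.sym (ℕ.+-suc r k))) (pw-+ r (suc k)))
    (λ r k → trans (*-congʳ (*-identityˡ _)) (trans (sym (pw-+ r _))
       (pw-≡ (≡.trans (ℕ.+-comm r _) (≡.sym (ℕ.+-identityʳ _))))))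
    (λ r → trans (*-congʳ (solve 1 (λ x → con (+ 1) :* (con (+ 1) :+ con (+ 1) :* x :* x) :- :- con (+ 2) :* x
                                     := (con (+ 1) :+ x) :* (con (+ 1) :+ x)) refl _))
                 (trans (ε-inverse r) (sym (*-identityʳ _))))

  ε-expansion : ∀ n → partial n ≐ Σ≤ (λ r → L.c[ n , r ] * ε r) n
  ε-expansion = L.expansion (ι (+ 4)) 4-cancel ε partial ε-poles refl
    (λ n → solve 2 (λ x y → con (+ 4) :* (x :* y) := x :* (con (+ 4) :* y)) refl _ _)

module E1 = Even 1 (s≤s z≤n)
module E4 = Even 4 (s≤s z≤n)

-- After simplification this is Watson's series: f₁ f(q) = 1 + 4 Σ (-1)^r q^(r(3r+1)/2) / (1 + q^r),
-- summed over r ≥ 1.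
fmock-lerch : fmock ≐ etaInv 1 * Σ∞ (λ r → Q1.χ r * Q1.σ₀ r * q^ (1 ℕ.* (r ℕ.* (r ℕ.+ 0))) * E1.ε r)
fmock-lerch = trans (tsum≐ _) (trans (Σ∞-cong term) (E1.L.bailey-limit E1.ε E1.partial E1.ε-expansion))
  where
  term : ∀ n → qpow (n ℕ.* n) *ₛ pochInv (ℤ.- + 1) 1 1 n ^ₛ 2 ≐ q^ (1 ℕ.* (n ℕ.* (n ℕ.+ 0))) * E1.partial n
  term n = trans (*ₛ≐ _ _) (*-cong
    (trans (qpow≐ _) (q^-≡ (≡.sym (≡.trans (ℕ.*-identityˡ _) (≡.cong (n ℕ.*_) (ℕ.+-identityʳ n))))))
    (trans (^ₛ2≐ (trans (pochInv⁻≐ 1 1 n) (𝒮.Π-cong n (λ j → reflexive (≡.cong geo⁻ (index j))))))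
      (sym (𝒮.Π-* (λ j → geo⁻ (1 ℕ.* suc j)) (λ j → geo⁻ (1 ℕ.* suc j)) n))))
    where
    index : ∀ j → 1 ℕ.+ 1 ℕ.* j ≡ 1 ℕ.* suc j
    index j = ≡.sym (ℕ.*-suc 1 j)

ζ : ℕ → PS
ζ r = geo⁺ (1 ℕ.+ 6 ℕ.* r) * geo⁺ (5 ℕ.+ 6 ℕ.* r)

-- The denominator is (1 - q X)(1 - q^5 X) with X = Q^r and Q = q^6. Hence V = q + q^5, and c = q
-- q^5 = Q provides the shift s = 1.
ζ-poles : L6.Poles 1# ζ
ζ-poles = L6.poles {1#} {q^ 1 + q^ 5} {Q6.pw 1} {1#} {Q6.pw} {ζ} 1-cancel
  (λ r k → trans (Q6.pw-≡ (≡.sym (ℕ.+-suc r k))) (Q6.pw-+ r (suc k)))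
  (λ r k → trans (*-congʳ (sym (Q6.pw-+ 1 r))) (trans (sym (Q6.pw-+ (1 ℕ.+ r) _)) (Q6.pw-≡ (index r k))))
  (λ r → trans (*-congʳ (trans
      (+-congʳ (*-congˡ (+-congˡ (*-congʳ (*-congʳ (q^-+ 1 5))))))
      (trans (solve 3 (λ a b x → con (+ 1) :* (con (+ 1) :+ (a :* b) :* x :* x) :- (a :+ b) :* x
                           := (con (+ 1) :- a :* x) :* (con (+ 1) :- b :* x)) refl (q^ 1) (q^ 5) (Q6.pw r))
             (sym (*-cong (+-congˡ (-‿cong (q^-+ 1 (6 ℕ.* r)))) (+-congˡ (-‿cong (q^-+ 5 (6 ℕ.* r)))))))))
    (trans (*-inverse (geo⁺-inverse (s≤s z≤n)) (geo⁺-inverse (s≤s z≤n))) (sym (*-identityˡ 1#))))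
  where
  open ℕS using () renaming (_:+_ to _⊕_; _:=_ to _⊜_; con to κ)
  index : ∀ r k → 1 ℕ.+ r ℕ.+ suc (r ℕ.+ k) ≡ suc (r ℕ.+ k) ℕ.+ r ℕ.+ 1
  index = ℕS.solve 2 (λ r k → κ 1 ⊕ r ⊕ (κ 1 ⊕ (r ⊕ k)) ⊜ κ 1 ⊕ (r ⊕ k) ⊕ r ⊕ κ 1) ≡.refl

ζ-expansion : ∀ n → Π< ζ (suc n) ≐ Σ≤ (λ r → L6.c[ n , r ] * ζ r) n
ζ-expansion = L6.expansion 1# 1-cancel ζ (λ n → Π< ζ (suc n)) ζ-poles (*-identityˡ _) (λ n → *-identityˡ _)

Σ∞-tail : ∀ {t} → Terms t → t 0 ≐ 0# → Σ∞ t ≐ Σ∞ (λ n → t (suc n))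
Σ∞-tail {t} small t₀ = sym (Σ∞-unique (λ n → weaken (ℕ.n≤1+n n) (small (suc n)))
  (λ n → Mod.trans (≐⇒≈ (sym (trans (𝒮.Σ-first t n) (trans (+-congʳ t₀) (+-identityˡ _)))))
    (weaken (ℕ.n≤1+n (suc n)) (Σ≤≈Σ∞ {t} small (suc n)))))

-- The series for ξ begins at n = 1. For n = m + 1 its exponent is 1 + 6m(m+1): the Bailey exponent
-- for s = 1 in base q^6, with one factor q left over.
ξ-lerch : ξ ≐ 1# + ι (+ 2) * (q^ 1 * (etaInv 6 * Σ∞ (λ r → Q6.χ r * Q6.σ₁ r * q^ (6 ℕ.* (r ℕ.* (r ℕ.+ 1))) * ζ r)))
ξ-lerch = trans (+ₛ≐ _ _) (+-cong 1ₛ≐ (trans (·ₛ2≐ _) (*-congˡ (begin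
  tsum ξTerm
    ≈⟨ tsum≐ _ ⟩
  Σ∞ ξTerm
    ≈⟨ Σ∞-tail order 0ₛ≐ ⟩
  Σ∞ (λ m → ξTerm (suc m))
    ≈⟨ Σ∞-cong term ⟩
  Σ∞ (λ m → q^ 1 * (Q6.pw (m ℕ.* (m ℕ.+ 1)) * Π< ζ (suc m)))
    ≈⟨ Σ∞-*ˡ (q^ 1) (λ m → order-* (Π< ζ (suc m)) (L6.square-order m)) ⟩
  q^ 1 * Σ∞ (λ m → Q6.pw (m ℕ.* (m ℕ.+ 1)) * Π< ζ (suc m))
    ≈⟨ *-congˡ (L6.bailey-limit ζ (λ n → Π< ζ (suc n)) ζ-expansion) ⟩
  q^ 1 * (etaInv 6 * _) ∎))))
  where
  open ≐-Reasoning
  open ℕS using () renaming (_:+_ to _⊕_; _:*_ to _⊗_; _:=_ to _⊜_; con to κ)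
  exponent : ∀ m → 6 ℕ.* suc m ℕ.* suc m ∸ 6 ℕ.* suc m ℕ.+ 1 ≡ 1 ℕ.+ 6 ℕ.* (m ℕ.* (m ℕ.+ 1))
  exponent m = ≡.trans (ℕ.+-comm (6 ℕ.* suc m ℕ.* suc m ∸ 6 ℕ.* suc m) 1) (≡.cong suc (≡.trans
    (≡.cong (_∸ 6 ℕ.* suc m) (ℕS.solve 1 (λ m → κ 6 ⊗ (κ 1 ⊕ m) ⊗ (κ 1 ⊕ m) ⊜ κ 6 ⊗ (m ⊗ (m ⊕ κ 1)) ⊕ κ 6 ⊗ (κ 1 ⊕ m)) ≡.refl m))
    (ℕ.m+n∸n≡m (6 ℕ.* (m ℕ.* (m ℕ.+ 1))) (6 ℕ.* suc m))))
  term : ∀ m → ξTerm (suc m) ≐ q^ 1 * (Q6.pw (m ℕ.* (m ℕ.+ 1)) * Π< ζ (suc m))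
  term m = begin
    qpow (6 ℕ.* suc m ℕ.* suc m ∸ 6 ℕ.* suc m ℕ.+ 1) *ₛ pochInv (+ 1) 1 6 (suc m) *ₛ pochInv (+ 1) 5 6 (suc m)
      ≈⟨ trans (*ₛ≐ _ _) (*-cong (trans (*ₛ≐ _ _) (*-cong (qpow≐ _) (pochInv⁺≐ 1 6 (suc m)))) (pochInv⁺≐ 5 6 (suc m))) ⟩
    q^ (6 ℕ.* suc m ℕ.* suc m ∸ 6 ℕ.* suc m ℕ.+ 1) * A * B
      ≈⟨ *-congʳ (*-congʳ (trans (q^-≡ (exponent m)) (q^-+ 1 _))) ⟩
    q^ 1 * Q6.pw (m ℕ.* (m ℕ.+ 1)) * A * B
      ≈⟨ solve 4 (λ a b c d → a :* b :* c :* d := a :* (b :* (c :* d))) refl _ _ _ _ ⟩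
    q^ 1 * (Q6.pw (m ℕ.* (m ℕ.+ 1)) * (A * B))
      ≈⟨ *-congˡ (*-congˡ (sym (𝒮.Π-* (λ r → geo⁺ (1 ℕ.+ 6 ℕ.* r)) (λ r → geo⁺ (5 ℕ.+ 6 ℕ.* r)) (suc m)))) ⟩
    q^ 1 * (Q6.pw (m ℕ.* (m ℕ.+ 1)) * Π< ζ (suc m)) ∎
    where
    A B : PS
    A = Π< (λ r → geo⁺ (1 ℕ.+ 6 ℕ.* r)) (suc m)
    B = Π< (λ r → geo⁺ (5 ℕ.+ 6 ℕ.* r)) (suc m)
  order : Terms ξTerm
  order zero    = ptw λ _ ()
  order (suc m) = Mod.trans (≐⇒≈ (trans (term m) (sym (*-assoc _ _ _))))
    (order-* (Π< ζ (suc m)) (Mod.trans (≐⇒≈ (sym (q^-+ 1 _))) (q^-order≤ (s≤s (ℕ.≤-trans (n≤n*[n+s] m 1) (Q6.m≤b*m _))))))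

-- The Jacobi triple product in the limit

Σ∞-first : ∀ {t} → Terms t → Σ∞ t ≐ t 0 + Σ∞ (λ n → t (suc n))
Σ∞-first {t} small = ≈⇒≐ (λ n → Mod.trans (weaken (ℕ.n≤1+n (suc n)) (Mod.sym (Σ≤≈Σ∞ {t} small (suc n))))
  (Mod.trans (≐⇒≈ (𝒮.Σ-first t n)) (+-mod Mod.refl (Σ≤≈Σ∞ {t ∘ suc} (λ n → weaken (ℕ.n≤1+n n) (small (suc n))) n))))

Terms-+ : ∀ {t t′} → Terms t → Terms t′ → Terms (λ n → t n + t′ n)
Terms-+ e e′ n = Mod.trans (+-mod (e n) (e′ n)) (≐⇒≈ (+-identityˡ 0#))

Σ∞-2* : ∀ {t} → Terms t → Σ∞ t ≐ Σ∞ (λ n → t (2 ℕ.* n) + t (1 ℕ.+ 2 ℕ.* n))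
Σ∞-2* {t} small = sym (Σ∞-unique
  (Terms-+ (λ n → weaken (ℕ.m≤n*m n 2) (small (2 ℕ.* n))) (λ n → weaken (ℕ.≤-trans (ℕ.m≤n*m n 2) (ℕ.n≤1+n _)) (small (1 ℕ.+ 2 ℕ.* n))))
  (λ n → Mod.trans (≐⇒≈ (sym (𝒮.Σ-2* t n))) (weaken (s≤s (ℕ.≤-trans (ℕ.m≤n*m n 2) (ℕ.n≤1+n _))) (Σ≤≈Σ∞ {t} small (1 ℕ.+ 2 ℕ.* n)))))

Σ∞-3* : ∀ {t} → Terms t → Σ∞ t ≐ Σ∞ (λ n → t (3 ℕ.* n) + t (1 ℕ.+ 3 ℕ.* n) + t (2 ℕ.+ 3 ℕ.* n))
Σ∞-3* {t} small = sym (Σ∞-unique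
  (Terms-+ (Terms-+ (λ n → weaken (ℕ.m≤n*m n 3) (small (3 ℕ.* n)))
                    (λ n → weaken (ℕ.≤-trans (ℕ.m≤n*m n 3) (ℕ.n≤1+n _)) (small (1 ℕ.+ 3 ℕ.* n))))
           (λ n → weaken (ℕ.≤-trans (ℕ.m≤n*m n 3) (ℕ.m≤n+m _ 2)) (small (2 ℕ.+ 3 ℕ.* n))))
  (λ n → Mod.trans (≐⇒≈ (sym (𝒮.Σ-3* t n))) (weaken (s≤s (ℕ.≤-trans (ℕ.m≤n*m n 3) (ℕ.m≤n+m _ 2))) (Σ≤≈Σ∞ {t} small (2 ℕ.+ 3 ℕ.* n)))))

Π∞-3* : ∀ {u} → Factors u → Π∞ (λ j → u (3 ℕ.* j) * u (1 ℕ.+ 3 ℕ.* j) * u (2 ℕ.+ 3 ℕ.* j)) ≐ Π∞ u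
Π∞-3* {u} e = Π∞-unique
  (λ j → *-mod-1 (*-mod-1 (weaken (s≤s (ℕ.m≤n*m j 3)) (e (3 ℕ.* j)))
                          (weaken (s≤s (ℕ.≤-trans (ℕ.m≤n*m j 3) (ℕ.n≤1+n _))) (e (1 ℕ.+ 3 ℕ.* j))))
                 (weaken (s≤s (ℕ.≤-trans (ℕ.m≤n*m j 3) (ℕ.m≤n+m _ 2))) (e (2 ℕ.+ 3 ℕ.* j))))
  (λ n → Mod.trans (≐⇒≈ (sym (𝒮.Π-3* u n))) (weaken (s≤s (ℕ.m≤n*m n 3)) (Π<≈Π∞ e (3 ℕ.* n))))

module Jacobi (b : ℕ) (1≤b : 1 ≤ b) where
  open Base b 1≤b

  -- The order comes from the factor Q^l alone, so the bound also covers X = 1.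
  T-order : ∀ X → Terms (λ l → T X (suc l))
  T-order X l = *-order′ (T X l) (*-order′ X (q^-order≤ (m≤b*m l)))

  -- The limits of the products are passed as hypotheses since the case X = 1 occurs: its first
  -- factor 2 violates `Factors`. The 2N + 1 summands of the finite identity are cut at the centre k
  -- = N, and each half is a Tannery limit.
  jacobi-limit : ∀ {X Y PX PY} → X * Y ≐ pw 1 →
    (∀ M → Π< (λ j → 1# + X * pw j) (suc M) ≈[ suc M ] PX) →
    (∀ M → Π< (λ j → 1# + Y * pw j) (suc M) ≈[ suc M ] PY) →
    eta b * (PY * PX) ≐ 1# + (Σ∞ (λ l → T Y (suc l)) + Σ∞ (λ l → T X (suc l)))
  jacobi-limit {X} {Y} {PX} {PY} XY PX≈ PY≈ =
    trans (*-congˡ (unit-cancel (trans (*-comm _ _) eta-inverse) scaled))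
      (trans (solve 3 (λ e i s → e :* (i :* s) := e :* i :* s) refl _ _ _) (trans (*-congʳ eta-inverse) (*-identityˡ _)))
    where
    ε S : PS
    ε = etaInv b
    S = 1# + (Σ∞ (λ l → T Y (suc l)) + Σ∞ (λ l → T X (suc l)))
    scaled : ε * (PY * PX) ≐ ε * (ε * S)
    scaled = ≈⇒≐ step
      where
      step : ∀ M → ε * (PY * PX) ≈[ suc M ] ε * (ε * S)
      step M = begin
        ε * (PY * PX)
          ≈⟨ *-mod (Mod.sym (I≈ (ℕ.≤-trans (ℕ.m≤m+n N N) (ℕ.n≤1+n _)))) (*-mod (Mod.sym (PY≈ M)) (Mod.sym (PX≈ M))) ⟩
        I (N ℕ.+ N) * (Π< (λ j → 1# + Y * pw j) N * Π< (λ j → 1# + X * pw j) N)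
          ≈⟨ ≐⇒≈ (sym (jacobi XY N N)) ⟩
        Σ≤ f (N ℕ.+ suc M)
          ≈⟨ ≐⇒≈ (trans (𝒮.Σ-middle f N M) (+-congʳ (trans (𝒮.Σ-rev f N) (𝒮.Σ-first (λ i → f (N ∸ i)) M)))) ⟩
        f N + Σ≤ (λ l → f (M ∸ l)) M + Σ≤ (λ l → f (N ℕ.+ suc l)) M
          ≈⟨ +-mod (+-mod middle (Mod.trans (≐⇒≈ (𝒮.Σ-cong≤ M lower)) lower-limit)) (Mod.trans (≐⇒≈ (𝒮.Σ-cong M upper)) upper-limit) ⟩
        ε * ε * 1# + ε * ε * Σ∞ (λ l → T Y (suc l)) + ε * ε * Σ∞ (λ l → T X (suc l))
          ≈⟨ ≐⇒≈ (solve 3 (λ e a b → e :* e :* con (+ 1) :+ e :* e :* a :+ e :* e :* b := e :* (e :* (con (+ 1) :+ (a :+ b)))) refl _ _ _) ⟩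
        ε * (ε * S) ∎
        where
        open SetoidReasoning (mod (suc M))
        N : ℕ
        N = suc M
        f : ℕ → PS
        f k = I k * I (N ℕ.+ N ∸ k) * τ X Y N k
        middle : f N ≈[ suc M ] ε * ε * 1#
        middle = *-mod (*-mod (I≈ (ℕ.n≤1+n N)) (I≈ (ℕ.≤-trans (ℕ.≤-reflexive (≡.sym (ℕ.m+n∸m≡n N N))) (ℕ.n≤1+n _))))
          (≐⇒≈ (trans (reflexive (≡.cong (λ i → T Y i * T X i) (ℕ.n∸n≡0 N))) (*-identityˡ 1#)))
        upper : ∀ l → f (N ℕ.+ suc l) ≐ T X (suc l) * (I (N ℕ.+ suc l) * I (M ∸ l))
        upper l = trans
          (reflexive (≡.cong₂ (λ i j → I (N ℕ.+ suc l) * I i * j) (ℕ.[m+n]∸[m+o]≡n∸o N N (suc l))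
            (≡.cong₂ (λ i j → T Y i * T X j) (m∸[m+n]≡0 N (suc l)) (ℕ.m+n∸m≡n N (suc l)))))
          (solve 3 (λ i j t → i :* j :* (con (+ 1) :* t) := t :* (i :* j)) refl _ _ _)
        lower : ∀ l → l ≤ M → f (M ∸ l) ≐ T Y (suc l) * (I (M ∸ l) * I (N ℕ.+ N ∸ (M ∸ l)))
        lower l l≤M = trans
          (reflexive (≡.cong (λ j → I (M ∸ l) * I (N ℕ.+ N ∸ (M ∸ l)) * j)
            (≡.cong₂ (λ i j → T Y i * T X j)
              (≡.trans (ℕ.+-∸-assoc 1 (ℕ.m∸n≤m M l)) (≡.cong suc (ℕ.m∸[m∸n]≡n l≤M)))
              (ℕ.m≤n⇒m∸n≡0 (ℕ.≤-trans (ℕ.m∸n≤m M l) (ℕ.n≤1+n M))))))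
          (solve 3 (λ i j t → i :* j :* (t :* con (+ 1)) := t :* (i :* j)) refl _ _ _)
        collect : ∀ Z → Σ∞ (λ l → T Z (suc l) * (ε * ε)) ≐ ε * ε * Σ∞ (λ l → T Z (suc l))
        collect Z = trans (Σ∞-cong (λ l → *-comm (T Z (suc l)) (ε * ε))) (Σ∞-*ˡ (ε * ε) (T-order Z))
        upper-limit : Σ≤ (λ l → T X (suc l) * (I (N ℕ.+ suc l) * I (M ∸ l))) M ≈[ suc M ] ε * ε * Σ∞ (λ l → T X (suc l))
        upper-limit = Mod.trans
          (limit-sum {λ l → T X (suc l)} {λ _ → ε * ε} (T-order X) M (λ l → I (N ℕ.+ suc l) * I (M ∸ l))
            (λ l _ → *-mod (I≈ (ℕ.≤-trans (s≤s (ℕ.m∸n≤m M l)) (ℕ.≤-trans (ℕ.m≤m+n (suc M) (suc l)) (ℕ.n≤1+n _)))) (I≈ ℕ.≤-refl)))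
          (≐⇒≈ (collect X))
        lower-limit : Σ≤ (λ l → T Y (suc l) * (I (M ∸ l) * I (N ℕ.+ N ∸ (M ∸ l)))) M ≈[ suc M ] ε * ε * Σ∞ (λ l → T Y (suc l))
        lower-limit = Mod.trans
          (limit-sum {λ l → T Y (suc l)} {λ _ → ε * ε} (T-order Y) M (λ l → I (M ∸ l) * I (N ℕ.+ N ∸ (M ∸ l)))
            (λ l _ → *-mod (I≈ ℕ.≤-refl) (I≈ (s≤s (large M l)))))
          (≐⇒≈ (collect Y))
          where
          large : ∀ M l → M ∸ l ≤ suc M ℕ.+ suc M ∸ (M ∸ l)
          large M l = ℕ.≤-trans (ℕ.m∸n≤m M l) (ℕ.≤-trans (ℕ.n≤1+n M)
            (ℕ.≤-trans (ℕ.≤-reflexive (≡.sym (ℕ.m+n∸n≡m (suc M) (suc M))))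
              (ℕ.∸-monoʳ-≤ (suc M ℕ.+ suc M) (ℕ.≤-trans (ℕ.m∸n≤m M l) (ℕ.n≤1+n M)))))

module Pochhammer (b : ℕ) (1≤b : 1 ≤ b) (a : ℕ) (1≤a : 1 ≤ a) where
  exponent≥ : ∀ j → suc j ≤ a ℕ.+ b ℕ.* j
  exponent≥ j = ℕ.+-mono-≤ 1≤a (ℕ.≤-trans (ℕ.≤-reflexive (≡.sym (ℕ.*-identityˡ j))) (ℕ.*-monoˡ-≤ j 1≤b))

  minus plus : ℕ → PS
  minus j = 1# - q^ (a ℕ.+ b ℕ.* j)
  plus  j = 1# + q^ (a ℕ.+ b ℕ.* j)

  minus-factors : Factors minus
  minus-factors j = weaken (exponent≥ j) (1-q^≈1 _)

  plus-factors : Factors plus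
  plus-factors j = weaken (exponent≥ j) (1+q^≈1 _)

  Π-minus : ∀ M → Π< (λ j → 1# + (⊝ q^ a) * q^ (b ℕ.* j)) (suc M) ≈[ suc M ] Π∞ minus
  Π-minus M = Mod.trans (≐⇒≈ (𝒮.Π-cong (suc M) (λ j → trans
      (solve 2 (λ x y → con (+ 1) :+ (:- x) :* y := con (+ 1) :- x :* y) refl _ _) (+-congˡ (-‿cong (sym (q^-+ a (b ℕ.* j))))))))
    (weaken (ℕ.n≤1+n _) (Π<≈Π∞ minus-factors (suc M)))

  Π-plus : ∀ M → Π< (λ j → 1# + q^ a * q^ (b ℕ.* j)) (suc M) ≈[ suc M ] Π∞ plus
  Π-plus M = Mod.trans (≐⇒≈ (𝒮.Π-cong (suc M) (λ j → +-congˡ (sym (q^-+ a (b ℕ.* j))))))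
    (weaken (ℕ.n≤1+n _) (Π<≈Π∞ plus-factors (suc M)))

P⁻ P⁺ : ℕ → ℕ → PS
P⁻ a b = Π∞ (λ j → 1# - q^ (a ℕ.+ b ℕ.* j))
P⁺ a b = Π∞ (λ j → 1# + q^ (a ℕ.+ b ℕ.* j))

module J18 = Jacobi 18 (s≤s z≤n)
module Q18 = Base 18 (s≤s z≤n)

-- Exponents of T (± q^a) l in base b: (b l (l - 1)) / 2 + a l.
theta-exponent : ℕ → ℕ → ℕ → ℕ
theta-exponent b a zero    = 0
theta-exponent b a (suc l) = theta-exponent b a l ℕ.+ (a ℕ.+ b ℕ.* l)

module ThetaTerms (b : ℕ) (1≤b : 1 ≤ b) where
  open Base b 1≤b
  T-plus : ∀ a l → T (q^ a) l ≐ q^ (theta-exponent b a l)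
  T-plus a zero    = sym q^0
  T-plus a (suc l) = trans (*-cong (T-plus a l) (sym (q^-+ a (b ℕ.* l)))) (sym (q^-+ (theta-exponent b a l) _))

  T-minus : ∀ a l → T (⊝ q^ a) l ≐ sgn l * q^ (theta-exponent b a l)
  T-minus a zero    = trans (sym q^0) (sym (*-identityˡ _))
  T-minus a (suc l) = trans (*-congʳ (T-minus a l))
    (trans (solve 4 (λ s x y z → s :* x :* ((:- y) :* z) := (:- s) :* (x :* (y :* z))) refl _ _ _ _)
      (*-congˡ (trans (*-congˡ (sym (q^-+ a (b ℕ.* l)))) (sym (q^-+ (theta-exponent b a l) _)))))

-- Reduction of ξ to ω

open ℕS using () renaming (_:+_ to _⊕_; _:*_ to _⊗_; _:=_ to _⊜_; con to κ)

2*tri : ∀ r → 2 ℕ.* tri r ≡ r ℕ.* (r ℕ.+ 1)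
2*tri zero    = ≡.refl
2*tri (suc r) = ≡.trans (ℕ.*-distribˡ-+ 2 (tri r) (suc r)) (≡.trans (≡.cong (ℕ._+ 2 ℕ.* suc r) (2*tri r))
  (ℕS.solve 1 (λ r → r ⊗ (r ⊕ κ 1) ⊕ κ 2 ⊗ (κ 1 ⊕ r) ⊜ (κ 1 ⊕ r) ⊗ (κ 1 ⊕ r ⊕ κ 1)) ≡.refl r))

half-square : ∀ {y g} → (1# - y) * g ≐ 1# → (1# - y * y) * (g * g) ≐ (1# + y) * g
half-square {y} {g} e = trans
  (solve 2 (λ y g → (con (+ 1) :- y :* y) :* (g :* g) := (con (+ 1) :+ y) :* g :* ((con (+ 1) :- y) :* g)) refl y g)
  (trans (*-congˡ e) (*-identityʳ _))

ratio : ℕ → PS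
ratio m = (1# + q^ m) * geo⁺ m

lerch-term : ℕ → ℕ → PS
lerch-term e m = q^ e * ratio m

δ-ratio : ∀ r → Q2.σ₁ r * δ r ≐ ratio (odd r)
δ-ratio r = trans (*-congʳ (+-congˡ (-‿cong (trans (q^-≡ index) (q^-+ (odd r) (odd r))))))
  (half-square (geo⁺-inverse (s≤s z≤n)))
  where
  index : 2 ℕ.* suc (r ℕ.+ r) ≡ odd r ℕ.+ odd r
  index = ℕS.solve 1 (λ r → κ 2 ⊗ (κ 1 ⊕ (r ⊕ r)) ⊜ κ 1 ⊕ κ 2 ⊗ r ⊕ (κ 1 ⊕ κ 2 ⊗ r)) ≡.refl r

ψ-term : ℕ → PS
ψ-term r = sgn r * lerch-term (r ℕ.* (r ℕ.+ 1)) (odd r)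

ψ-term-order : Terms ψ-term
ψ-term-order r = *-order′ (sgn r) (order-* (ratio (odd r)) (q^-order≤ (n≤n*[n+s] r 1)))

odd-factors : Factors (geo⁺ ∘ odd)
odd-factors j = weaken (s≤s (ℕ.m≤n*m j 2)) (geo⁺≈1 (s≤s z≤n))

δ-factors : Factors δ
δ-factors = Factors-* odd-factors odd-factors

ψ²-lerch : eta 2 * eta 2 * Π∞ δ ≐ Σ∞ ψ-term
ψ²-lerch = trans (*-congˡ (L2.expansion-limit δ (λ n → Π< δ (suc n)) δ-expansion
    (λ N → weaken (ℕ.n≤1+n _) (Π<≈Π∞ δ-factors (suc N)))))
  (trans (solve 3 (λ a b c → a :* a :* (b :* b :* c) := a :* b :* (a :* b) :* c) refl _ _ _)
  (trans (*-congʳ (trans (*-cong Q2.eta-inverse Q2.eta-inverse) (*-identityˡ 1#)))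
  (trans (*-identityˡ _) (Σ∞-cong term))))
  where
  term : ∀ r → Q2.χ r * Q2.σ₁ r * δ r ≐ ψ-term r
  term r = trans (*-assoc _ _ _) (trans (*-cong (Q2.χ≐ r) (δ-ratio r)) (trans (*-assoc _ _ _)
    (*-congˡ (*-congʳ (q^-≡ (2*tri r))))))

ω-term : ℕ → PS
ω-term r = sgn r * lerch-term (3 ℕ.* (r ℕ.* (r ℕ.+ 1))) (odd r)

ω≐ : ω ≐ etaInv 2 * Σ∞ ω-term
ω≐ = trans ω-lerch (*-congˡ (Σ∞-cong term))
  where
  term : ∀ r → Q2.χ r * Q2.σ₁ r * q^ (2 ℕ.* (r ℕ.* (r ℕ.+ 1))) * δ r ≐ ω-term r
  term r = trans (solve 4 (λ a b c d → a :* b :* c :* d := a :* c :* (b :* d)) refl _ _ _ _)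
    (trans (*-cong (trans (*-congʳ (Q2.χ≐ r)) (trans (*-assoc _ _ _) (*-congˡ (trans (sym (q^-+ (2 ℕ.* tri r) _)) (q^-≡ index))))) (δ-ratio r))
      (*-assoc _ _ _))
    where
    index : 2 ℕ.* tri r ℕ.+ 2 ℕ.* (r ℕ.* (r ℕ.+ 1)) ≡ 3 ℕ.* (r ℕ.* (r ℕ.+ 1))
    index = ≡.cong (ℕ._+ 2 ℕ.* (r ℕ.* (r ℕ.+ 1))) (2*tri r)

ω₃-term : ℕ → PS
ω₃-term m = sgn m * lerch-term (9 ℕ.* (m ℕ.* (m ℕ.+ 1))) (3 ℕ.* odd m)

ω₃-term-order : Terms ω₃-term
ω₃-term-order m = *-order′ (sgn m) (order-* (ratio (3 ℕ.* odd m))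
  (q^-order≤ (ℕ.≤-trans (n≤n*[n+s] m 1) (ℕ.m≤n*m (m ℕ.* (m ℕ.+ 1)) 9))))

ξ-term : ℕ → PS
ξ-term r = Q6.χ r * Q6.σ₁ r * q^ (6 ℕ.* (r ℕ.* (r ℕ.+ 1))) * ζ r

ξ-term-order : Terms ξ-term
ξ-term-order r = order-* (ζ r) (*-order′ (Q6.χ r * Q6.σ₁ r) (L6.square-order r))

eta≐P⁻ : ∀ k → eta k ≐ P⁻ k k
eta≐P⁻ k = Π∞-cong (λ j → +-congˡ (-‿cong (q^-≡ (ℕ.*-suc k j))))

-- The bilateral series of (-1)^n q^(9n²+3n), with the indices n = m and n = -(m+1) paired. They
-- arise from the residue classes 0 and 2 of r modulo 3 in `trisection`.
pentagonal-term : ℕ → PS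
pentagonal-term m = sgn m * q^ (9 ℕ.* (m ℕ.* m) ℕ.+ 3 ℕ.* m) + sgn (suc m) * q^ (9 ℕ.* (m ℕ.* m) ℕ.+ 15 ℕ.* m ℕ.+ 6)

private
  n≤9n²+3n : ∀ m → m ≤ 9 ℕ.* (m ℕ.* m) ℕ.+ 3 ℕ.* m
  n≤9n²+3n m = ℕ.≤-trans (ℕ.m≤n*m m 3) (ℕ.m≤n+m (3 ℕ.* m) (9 ℕ.* (m ℕ.* m)))

  pentagonal-order₁ : Terms (λ m → sgn m * q^ (9 ℕ.* (m ℕ.* m) ℕ.+ 3 ℕ.* m))
  pentagonal-order₁ m = *-order′ (sgn m) (q^-order≤ (n≤9n²+3n m))

-- The triple product in base q^18 at X = -q^6, Y = -q^12: multiples of 6 split into the classes 6,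
-- 12 and 18 modulo 18.
pentagonal : eta 6 ≐ Σ∞ pentagonal-term
pentagonal = begin
  eta 6
    ≈⟨ sym (trans (*-congʳ (eta≐P⁻ 18)) product) ⟩
  eta 18 * (P⁻ 12 18 * P⁻ 6 18)
    ≈⟨ J18.jacobi-limit {⊝ q^ 6} {⊝ q^ 12} XY (Pochhammer.Π-minus 18 (s≤s z≤n) 6 (s≤s z≤n)) (Pochhammer.Π-minus 18 (s≤s z≤n) 12 (s≤s z≤n)) ⟩
  1# + (Σ∞ (λ l → Q18.T (⊝ q^ 12) (suc l)) + Σ∞ (λ l → Q18.T (⊝ q^ 6) (suc l)))
    ≈⟨ +-congˡ (+-cong (Σ∞-cong upper) (Σ∞-cong lower)) ⟩
  1# + (Σ∞ (λ l → t (suc l)) + Σ∞ t′)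
    ≈⟨ trans (sym (+-assoc _ _ _)) (+-congʳ (trans (+-congʳ (trans (sym q^0) (sym (*-identityˡ _)))) (sym (Σ∞-first pentagonal-order₁)))) ⟩
  Σ∞ t + Σ∞ t′
    ≈⟨ sym (Σ∞-+ t t′) ⟩
  Σ∞ pentagonal-term ∎
  where
  open ≐-Reasoning
  t t′ : ℕ → PS
  t m = sgn m * q^ (9 ℕ.* (m ℕ.* m) ℕ.+ 3 ℕ.* m)
  t′ m = sgn (suc m) * q^ (9 ℕ.* (m ℕ.* m) ℕ.+ 15 ℕ.* m ℕ.+ 6)
  module T18 = ThetaTerms 18 (s≤s z≤n)
  XY : (⊝ q^ 6) * (⊝ q^ 12) ≐ q^ 18
  XY = trans (solve 2 (λ x y → (:- x) :* (:- y) := x :* y) refl _ _) (sym (q^-+ 6 12))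
  product : P⁻ 18 18 * (P⁻ 12 18 * P⁻ 6 18) ≐ eta 6
  product = begin
    P⁻ 18 18 * (P⁻ 12 18 * P⁻ 6 18)
      ≈⟨ solve 3 (λ a b c → a :* (b :* c) := c :* b :* a) refl _ _ _ ⟩
    P⁻ 6 18 * P⁻ 12 18 * P⁻ 18 18
      ≈⟨ *-congʳ (sym (Π∞-* (f 6 (s≤s z≤n)) (f 12 (s≤s z≤n)))) ⟩
    Π∞ (λ j → (1# - q^ (6 ℕ.+ 18 ℕ.* j)) * (1# - q^ (12 ℕ.+ 18 ℕ.* j))) * P⁻ 18 18
      ≈⟨ sym (Π∞-* (Factors-* (f 6 (s≤s z≤n)) (f 12 (s≤s z≤n))) (f 18 (s≤s z≤n))) ⟩
    Π∞ (λ j → (1# - q^ (6 ℕ.+ 18 ℕ.* j)) * (1# - q^ (12 ℕ.+ 18 ℕ.* j)) * (1# - q^ (18 ℕ.+ 18 ℕ.* j)))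
      ≈⟨ Π∞-cong (λ j → *-cong (*-cong (c (i₀ j)) (c (i₁ j))) (c (i₂ j))) ⟩
    Π∞ (λ j → u (3 ℕ.* j) * u (1 ℕ.+ 3 ℕ.* j) * u (2 ℕ.+ 3 ℕ.* j))
      ≈⟨ Π∞-3* (Pochhammer.minus-factors 6 (s≤s z≤n) 6 (s≤s z≤n)) ⟩
    P⁻ 6 6
      ≈⟨ sym (eta≐P⁻ 6) ⟩
    eta 6 ∎
    where
    f : ∀ a (1≤a : 1 ≤ a) → Factors (λ j → 1# - q^ (a ℕ.+ 18 ℕ.* j))
    f = Pochhammer.minus-factors 18 (s≤s z≤n)
    u : ℕ → PS
    u j = 1# - q^ (6 ℕ.+ 6 ℕ.* j)
    c : ∀ {m n} → m ≡ n → 1# - q^ m ≐ 1# - q^ n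
    c ≡.refl = refl
    i₀ : ∀ j → 6 ℕ.+ 18 ℕ.* j ≡ 6 ℕ.+ 6 ℕ.* (3 ℕ.* j)
    i₀ = ℕS.solve 1 (λ j → κ 6 ⊕ κ 18 ⊗ j ⊜ κ 6 ⊕ κ 6 ⊗ (κ 3 ⊗ j)) ≡.refl
    i₁ : ∀ j → 12 ℕ.+ 18 ℕ.* j ≡ 6 ℕ.+ 6 ℕ.* (1 ℕ.+ 3 ℕ.* j)
    i₁ = ℕS.solve 1 (λ j → κ 12 ⊕ κ 18 ⊗ j ⊜ κ 6 ⊕ κ 6 ⊗ (κ 1 ⊕ κ 3 ⊗ j)) ≡.refl
    i₂ : ∀ j → 18 ℕ.+ 18 ℕ.* j ≡ 6 ℕ.+ 6 ℕ.* (2 ℕ.+ 3 ℕ.* j)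
    i₂ = ℕS.solve 1 (λ j → κ 18 ⊕ κ 18 ⊗ j ⊜ κ 6 ⊕ κ 6 ⊗ (κ 2 ⊕ κ 3 ⊗ j)) ≡.refl
  upper : ∀ l → Q18.T (⊝ q^ 12) (suc l) ≐ t (suc l)
  upper l = trans (T18.T-minus 12 (suc l)) (*-congˡ (q^-≡ (index (suc l))))
    where
    index : ∀ l → theta-exponent 18 12 l ≡ 9 ℕ.* (l ℕ.* l) ℕ.+ 3 ℕ.* l
    index zero    = ≡.refl
    index (suc l) = ≡.trans (≡.cong (ℕ._+ (12 ℕ.+ 18 ℕ.* l)) (index l))
      (ℕS.solve 1 (λ l → κ 9 ⊗ (l ⊗ l) ⊕ κ 3 ⊗ l ⊕ (κ 12 ⊕ κ 18 ⊗ l) ⊜ κ 9 ⊗ ((κ 1 ⊕ l) ⊗ (κ 1 ⊕ l)) ⊕ κ 3 ⊗ (κ 1 ⊕ l)) ≡.refl l)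
  lower : ∀ l → Q18.T (⊝ q^ 6) (suc l) ≐ t′ l
  lower l = trans (T18.T-minus 6 (suc l)) (*-congˡ (q^-≡ (index l)))
    where
    index : ∀ l → theta-exponent 18 6 (suc l) ≡ 9 ℕ.* (l ℕ.* l) ℕ.+ 15 ℕ.* l ℕ.+ 6
    index zero    = ≡.refl
    index (suc l) = ≡.trans (≡.cong (ℕ._+ (6 ℕ.+ 18 ℕ.* suc l)) (index l))
      (ℕS.solve 1 (λ l → κ 9 ⊗ (l ⊗ l) ⊕ κ 15 ⊗ l ⊕ κ 6 ⊕ (κ 6 ⊕ κ 18 ⊗ (κ 1 ⊕ l))
        ⊜ κ 9 ⊗ ((κ 1 ⊕ l) ⊗ (κ 1 ⊕ l)) ⊕ κ 15 ⊗ (κ 1 ⊕ l) ⊕ κ 6) ≡.refl l)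

sgn-3* : ∀ m → sgn (3 ℕ.* m) ≐ sgn m
sgn-3* zero    = refl
sgn-3* (suc m) = trans (reflexive (≡.cong sgn (ℕ.*-suc 3 m)))
  (trans (solve 1 (λ s → :- :- :- s := :- s) refl _) (-‿cong (sgn-3* m)))

-- The class 1 gives the term of -q² ω(q³). For the classes 0 and 2 put y = q^(6m+1), y′ = q^(6m+5)
-- and write (1+y)/(1-y) = 1 + 2y/(1-y) and (1+y′)/(1-y′) = 2/(1-y′) - 1. The constants are the
-- pentagonal terms. The remainders combine by 1/(1-y) + y′/(1-y′) = (1 - y y′)/((1-y)(1-y′)) into
-- the term of ξ.
trisection : ∀ m → ψ-term (3 ℕ.* m) + ψ-term (1 ℕ.+ 3 ℕ.* m) + ψ-term (2 ℕ.+ 3 ℕ.* m)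
  ≐ pentagonal-term m + (ι (+ 2) * (q^ 1 * ξ-term m) + (⊝ q^ 2) * ω₃-term m)
trisection m = begin
  ψ-term (3 ℕ.* m) + ψ-term (1 ℕ.+ 3 ℕ.* m) + ψ-term (2 ℕ.+ 3 ℕ.* m)
    ≈⟨ +-cong (+-cong t₀ t₁) t₂ ⟩
  s * (P * ((1# + y) * g)) + ⊝ s * ((q^ 2 * Z) * ρ) + s * ((P * y * y′) * ((1# + y′) * g′))
    ≈⟨ solve 9 (λ s P y g qq Z ρ y′ g′ →
         s :* (P :* ((con (+ 1) :+ y) :* g)) :+ (:- s) :* ((qq :* Z) :* ρ) :+ s :* ((P :* y :* y′) :* ((con (+ 1) :+ y′) :* g′))
         := s :* P :* ((con (+ 1) :- y) :* g :+ con (+ 2) :* y :* g :+ y :* y′ :* (con (+ 2) :* g′ :- (con (+ 1) :- y′) :* g′)) :+ (:- qq) :* (s :* (Z :* ρ)))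
         refl s P y g (q^ 2) Z ρ y′ g′ ⟩
  s * P * ((1# - y) * g + ι (+ 2) * y * g + y * y′ * (ι (+ 2) * g′ - (1# - y′) * g′)) + ⊝ q^ 2 * (s * (Z * ρ))
    ≈⟨ +-congʳ (*-congˡ (+-cong (+-congʳ inv) (*-congˡ (+-congˡ (-‿cong inv′))))) ⟩
  s * P * (1# + ι (+ 2) * y * g + y * y′ * (ι (+ 2) * g′ - 1#)) + ⊝ q^ 2 * (s * (Z * ρ))
    ≈⟨ +-congʳ (solve 6 (λ s P y g y′ g′ →
         s :* P :* (con (+ 1) :+ con (+ 2) :* y :* g :+ y :* y′ :* (con (+ 2) :* g′ :- con (+ 1)))
         := s :* P :+ (:- s) :* (P :* y :* y′) :+ con (+ 2) :* (P :* y) :* (s :* (con (+ 1) :* g :+ y′ :* (con (+ 1) :* g′)))) refl s P y g y′ g′) ⟩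
  s * P + ⊝ s * (P * y * y′) + ι (+ 2) * (P * y) * (s * (1# * g + y′ * (1# * g′))) + ⊝ q^ 2 * (s * (Z * ρ))
    ≈⟨ +-congʳ (+-cong (+-congˡ (*-congˡ (sym P′≐))) (*-cong (*-congˡ (sym qZ≐)) (*-congˡ (+-cong (*-congʳ (sym inv′)) (*-congˡ (*-congʳ (sym inv))))))) ⟩
  pentagonal-term m + ι (+ 2) * (q^ 1 * Z) * (s * ((1# - y′) * g′ * g + y′ * ((1# - y) * g * g′))) + ⊝ q^ 2 * (s * (Z * ρ))
    ≈⟨ trans (+-assoc _ _ _) (+-congˡ (+-congʳ (solve 7 (λ q Z s y g y′ g′ →
         con (+ 2) :* (q :* Z) :* (s :* ((con (+ 1) :- y′) :* g′ :* g :+ y′ :* ((con (+ 1) :- y) :* g :* g′)))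
         := con (+ 2) :* (q :* (s :* Z :* (con (+ 1) :- y :* y′) :* (g :* g′)))) refl (q^ 1) Z s y g y′ g′))) ⟩
  pentagonal-term m + (ι (+ 2) * (q^ 1 * (s * Z * (1# - y * y′) * (g * g′))) + ⊝ q^ 2 * (s * (Z * ρ)))
    ≈⟨ +-congˡ (+-congʳ (*-congˡ (*-congˡ (sym ξ≐)))) ⟩
  pentagonal-term m + (ι (+ 2) * (q^ 1 * ξ-term m) + ⊝ q^ 2 * ω₃-term m) ∎
  where
  open ≐-Reasoning
  s P Z y y′ g g′ ρ : PS
  s = sgn m
  P = q^ (9 ℕ.* (m ℕ.* m) ℕ.+ 3 ℕ.* m)
  Z = q^ (9 ℕ.* (m ℕ.* (m ℕ.+ 1)))
  y = q^ (1 ℕ.+ 6 ℕ.* m)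
  y′ = q^ (5 ℕ.+ 6 ℕ.* m)
  g = geo⁺ (1 ℕ.+ 6 ℕ.* m)
  g′ = geo⁺ (5 ℕ.+ 6 ℕ.* m)
  ρ = ratio (3 ℕ.* odd m)
  inv : (1# - y) * g ≐ 1#
  inv = geo⁺-inverse (s≤s z≤n)
  inv′ : (1# - y′) * g′ ≐ 1#
  inv′ = geo⁺-inverse (s≤s z≤n)
  qZ≐ : q^ 1 * Z ≐ P * y
  qZ≐ = trans (sym (q^-+ 1 _)) (trans (q^-≡ (ℕS.solve 1 (λ m →
    κ 1 ⊕ κ 9 ⊗ (m ⊗ (m ⊕ κ 1)) ⊜ κ 9 ⊗ (m ⊗ m) ⊕ κ 3 ⊗ m ⊕ (κ 1 ⊕ κ 6 ⊗ m)) ≡.refl m)) (q^-+ _ _))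
  P′-index : 9 ℕ.* (m ℕ.* m) ℕ.+ 15 ℕ.* m ℕ.+ 6 ≡ 9 ℕ.* (m ℕ.* m) ℕ.+ 3 ℕ.* m ℕ.+ (1 ℕ.+ 6 ℕ.* m) ℕ.+ (5 ℕ.+ 6 ℕ.* m)
  P′-index = ℕS.solve 1 (λ m → κ 9 ⊗ (m ⊗ m) ⊕ κ 15 ⊗ m ⊕ κ 6 ⊜ κ 9 ⊗ (m ⊗ m) ⊕ κ 3 ⊗ m ⊕ (κ 1 ⊕ κ 6 ⊗ m) ⊕ (κ 5 ⊕ κ 6 ⊗ m)) ≡.refl m
  P′≐ : q^ (9 ℕ.* (m ℕ.* m) ℕ.+ 15 ℕ.* m ℕ.+ 6) ≐ P * y * y′
  P′≐ = trans (q^-≡ P′-index) (trans (q^-+ _ _) (*-congʳ (q^-+ _ _)))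
  ratio≡ : ∀ {m n} → m ≡ n → ratio m ≐ ratio n
  ratio≡ ≡.refl = refl
  t₀ : ψ-term (3 ℕ.* m) ≐ s * (P * ((1# + y) * g))
  t₀ = *-cong (sgn-3* m) (*-cong
    (q^-≡ (ℕS.solve 1 (λ m → κ 3 ⊗ m ⊗ (κ 3 ⊗ m ⊕ κ 1) ⊜ κ 9 ⊗ (m ⊗ m) ⊕ κ 3 ⊗ m) ≡.refl m))
    (ratio≡ (ℕS.solve 1 (λ m → κ 1 ⊕ κ 2 ⊗ (κ 3 ⊗ m) ⊜ κ 1 ⊕ κ 6 ⊗ m) ≡.refl m)))
  t₁ : ψ-term (1 ℕ.+ 3 ℕ.* m) ≐ ⊝ s * ((q^ 2 * Z) * ρ)
  t₁ = *-cong (-‿cong (sgn-3* m)) (*-cong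
    (trans (q^-≡ (ℕS.solve 1 (λ m → (κ 1 ⊕ κ 3 ⊗ m) ⊗ (κ 1 ⊕ κ 3 ⊗ m ⊕ κ 1) ⊜ κ 2 ⊕ κ 9 ⊗ (m ⊗ (m ⊕ κ 1))) ≡.refl m)) (q^-+ 2 _))
    (ratio≡ (ℕS.solve 1 (λ m → κ 1 ⊕ κ 2 ⊗ (κ 1 ⊕ κ 3 ⊗ m) ⊜ κ 3 ⊗ (κ 1 ⊕ κ 2 ⊗ m)) ≡.refl m)))
  t₂ : ψ-term (2 ℕ.+ 3 ℕ.* m) ≐ s * ((P * y * y′) * ((1# + y′) * g′))
  t₂ = *-cong (trans (solve 1 (λ s → :- :- s := s) refl _) (sgn-3* m)) (*-cong
    (trans (q^-≡ (≡.trans (ℕS.solve 1 (λ m → (κ 2 ⊕ κ 3 ⊗ m) ⊗ (κ 2 ⊕ κ 3 ⊗ m ⊕ κ 1) ⊜ κ 9 ⊗ (m ⊗ m) ⊕ κ 15 ⊗ m ⊕ κ 6) ≡.refl m) P′-index))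
      (trans (q^-+ _ _) (*-congʳ (q^-+ _ _))))
    (ratio≡ (ℕS.solve 1 (λ m → κ 1 ⊕ κ 2 ⊗ (κ 2 ⊕ κ 3 ⊗ m) ⊜ κ 5 ⊕ κ 6 ⊗ m) ≡.refl m)))
  ξ≐ : ξ-term m ≐ s * Z * (1# - y * y′) * (g * g′)
  ξ≐ = *-congʳ (trans (solve 3 (λ a b c → a :* b :* c := a :* c :* b) refl _ _ _) (*-cong
    (trans (*-congʳ (Q6.χ≐ m)) (trans (*-assoc _ _ _) (*-congˡ (trans (sym (q^-+ (6 ℕ.* tri m) _)) (q^-≡ index)))))
    (+-congˡ (-‿cong (trans (q^-≡ (ℕS.solve 1 (λ m → κ 6 ⊗ (κ 1 ⊕ (m ⊕ m)) ⊜ κ 1 ⊕ κ 6 ⊗ m ⊕ (κ 5 ⊕ κ 6 ⊗ m)) ≡.refl m)) (q^-+ _ _))))))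
    where
    index : 6 ℕ.* tri m ℕ.+ 6 ℕ.* (m ℕ.* (m ℕ.+ 1)) ≡ 9 ℕ.* (m ℕ.* (m ℕ.+ 1))
    index = ≡.trans (≡.cong (ℕ._+ 6 ℕ.* (m ℕ.* (m ℕ.+ 1))) (≡.trans (ℕ.*-assoc 3 2 (tri m)) (≡.cong (3 ℕ.*_) (2*tri m))))
      (ℕS.solve 1 (λ x → κ 3 ⊗ x ⊕ κ 6 ⊗ x ⊜ κ 9 ⊗ x) ≡.refl (m ℕ.* (m ℕ.+ 1)))

-- The isolated 1 in `ξ-lerch` equals f₆/f₆, and that f₆ is exactly the pentagonal part of the
-- trisected ψ².
ξ-decomposition : ξ ≐ etaInv 6 * (eta 2 * eta 2 * Π∞ δ) + q^ 2 * (etaInv 6 * Σ∞ ω₃-term)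
ξ-decomposition = begin
  ξ
    ≈⟨ ξ-lerch ⟩
  1# + ι (+ 2) * (q^ 1 * (etaInv 6 * Σ∞ ξ-term))
    ≈⟨ +-congʳ (sym Q6.eta-inverse) ⟩
  eta 6 * etaInv 6 + ι (+ 2) * (q^ 1 * (etaInv 6 * Σ∞ ξ-term))
    ≈⟨ solve 6 (λ f e q x qq w → f :* e :+ con (+ 2) :* (q :* (e :* x))
         := e :* (f :+ (con (+ 2) :* (q :* x) :+ (:- qq) :* w)) :+ qq :* (e :* w)) refl _ _ _ _ (q^ 2) (Σ∞ ω₃-term) ⟩
  etaInv 6 * (eta 6 + (ι (+ 2) * (q^ 1 * Σ∞ ξ-term) + ⊝ q^ 2 * Σ∞ ω₃-term)) + q^ 2 * (etaInv 6 * Σ∞ ω₃-term)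
    ≈⟨ +-congʳ (*-congˡ (sym collected)) ⟩
  etaInv 6 * (eta 2 * eta 2 * Π∞ δ) + q^ 2 * (etaInv 6 * Σ∞ ω₃-term) ∎
  where
  open ≐-Reasoning
  collected : eta 2 * eta 2 * Π∞ δ ≐ eta 6 + (ι (+ 2) * (q^ 1 * Σ∞ ξ-term) + ⊝ q^ 2 * Σ∞ ω₃-term)
  collected = begin
    eta 2 * eta 2 * Π∞ δ
      ≈⟨ trans ψ²-lerch (trans (Σ∞-3* ψ-term-order) (Σ∞-cong trisection)) ⟩
    Σ∞ (λ m → pentagonal-term m + (ι (+ 2) * (q^ 1 * ξ-term m) + ⊝ q^ 2 * ω₃-term m))
      ≈⟨ trans (Σ∞-+ _ _) (+-congˡ (Σ∞-+ _ _)) ⟩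
    Σ∞ pentagonal-term + (Σ∞ (λ m → ι (+ 2) * (q^ 1 * ξ-term m)) + Σ∞ (λ m → ⊝ q^ 2 * ω₃-term m))
      ≈⟨ +-cong (sym pentagonal) (+-cong
           (trans (Σ∞-*ˡ (ι (+ 2)) (λ m → *-order′ (q^ 1) (ξ-term-order m))) (*-congˡ (Σ∞-*ˡ (q^ 1) ξ-term-order)))
           (Σ∞-*ˡ (⊝ q^ 2) ω₃-term-order)) ⟩
    eta 6 + (ι (+ 2) * (q^ 1 * Σ∞ ξ-term) + ⊝ q^ 2 * Σ∞ ω₃-term) ∎

-- Limits of the products occurring in double partial fractions

-- u a b = q^a / (q^a + q^b)
u : ℕ → ℕ → PS
u zero    b       = geo⁻ b
u (suc a) zero    = q^ suc a * geo⁻ (suc a)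
u (suc a) (suc b) = u a b

u-inverse : ∀ {a b} → a ≢ b → (q^ a + q^ b) * u a b ≐ q^ a
u-inverse {zero}  {zero}  0≢0 = contradiction ≡.refl 0≢0
u-inverse {zero}  {suc b} _   = trans (*-congʳ (+-congʳ q^0)) (trans (geo⁻-inverse (s≤s z≤n)) (sym q^0))
u-inverse {suc a} {zero}  _   = trans (*-congʳ (+-congˡ q^0))
  (trans (solve 2 (λ x g → (x :+ con (+ 1)) :* (x :* g) := x :* ((con (+ 1) :+ x) :* g)) refl _ _)
    (trans (*-congˡ (geo⁻-inverse (s≤s z≤n))) (*-identityʳ _)))
u-inverse {suc a} {suc b} a≢b = trans (*-congʳ (+-cong (q^-+ 1 a) (q^-+ 1 b)))
  (trans (solve 4 (λ q x y g → (q :* x :+ q :* y) :* g := q :* ((x :+ y) :* g)) refl _ _ _ _)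
    (trans (*-congˡ (u-inverse (λ e → a≢b (≡.cong suc e)))) (sym (q^-+ 1 a))))

u≈1 : ∀ a b → u a b ≈[ b ∸ a ] 1#
u≈1 zero    zero    = ptw λ _ ()
u≈1 zero    (suc b) = geo⁻≈1 (s≤s z≤n)
u≈1 (suc a) zero    = ptw λ _ ()
u≈1 (suc a) (suc b) = u≈1 a b

u-shift : ∀ k a b → u (k ℕ.+ a) (k ℕ.+ b) ≡ u a b
u-shift zero    a b = ≡.refl
u-shift (suc k) a b = u-shift k a b

-- Multiplication by `u a b` turns q^a + q^b into q^a, which can be cancelled although it is not a
-- unit for a > 0. For a = b this would fail, 2 having no inverse.
sum-cancel : ∀ {a b F G} → a ≢ b → (q^ a + q^ b) * F ≐ (q^ a + q^ b) * G → F ≐ G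
sum-cancel {a} {b} {F} {G} a≢b e = q^-cancel a (trans (expand F) (trans (*-congˡ e) (sym (expand G))))
  where
  expand : ∀ F → q^ a * F ≐ u a b * ((q^ a + q^ b) * F)
  expand F = trans (*-congʳ (sym (u-inverse a≢b))) (solve 3 (λ s u f → s :* u :* f := u :* (s :* f)) refl _ _ _)

-- v a b = q^a / ((q^a + q^b) (1 + q^(a+b))) is the value of 1 / ((1 + q^b z) (1 + q^b / z)) at z = q^(± a),
-- and of 1 / ((1 - q^b z) (1 - q^b / z)) at z = - q^(± a).
v : ℕ → ℕ → PS
v a b = u a b * geo⁻ (a ℕ.+ b)

v-inverse : ∀ {a b} → a ≢ b → 1 ≤ a ℕ.+ b → (q^ a + q^ b) * (1# + q^ a * q^ b) * v a b ≐ q^ a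
v-inverse {a} {b} a≢b pos = trans
  (solve 4 (λ s p u g → s :* p :* (u :* g) := s :* u :* (p :* g)) refl _ _ _ _)
  (trans (*-cong (u-inverse a≢b) (trans (*-congʳ (+-congˡ (sym (q^-+ a b)))) (geo⁻-inverse pos))) (*-identityʳ _))

-- Partial fractions for a pole q^a of the first family and a pole - q^b of the second.
cross : ∀ {a b D E K} → a ≢ b → 1 ≤ a ℕ.+ b →
  square (1# - q^ a) * D ≐ 1# → square (1# + q^ b) * E ≐ K → D * E ≐ K * (v a b * D) + v b a * E
cross {a} {b} {D} {E} {K} a≢b pos D⁻¹ E⁻¹ = begin
  D * E
    ≈⟨ sym (*-identityʳ _) ⟩
  D * E * 1#
    ≈⟨ *-congˡ (sym unity) ⟩
  D * E * (square (1# + q^ b) * v a b + square (1# - q^ a) * v b a)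
    ≈⟨ solve 6 (λ D E x y v w → D :* E :* (x :* v :+ y :* w) := x :* E :* (v :* D) :+ y :* D :* (w :* E)) refl _ _ _ _ _ _ ⟩
  square (1# + q^ b) * E * (v a b * D) + square (1# - q^ a) * D * (v b a * E)
    ≈⟨ +-cong (*-congʳ E⁻¹) (trans (*-congʳ D⁻¹) (*-identityˡ _)) ⟩
  K * (v a b * D) + v b a * E ∎
  where
  open ≐-Reasoning
  A B h : PS
  A = q^ a
  B = q^ b
  h = geo⁻ (a ℕ.+ b)
  -- This partition of 1 between the two poles rests on (1+B)² A + (1-A)² B = (A+B)(1+AB).
  unity : square (1# + B) * v a b + square (1# - A) * v b a ≐ 1#
  unity = sum-cancel a≢b (begin
    (A + B) * (square (1# + B) * (u a b * h) + square (1# - A) * (u b a * geo⁻ (b ℕ.+ a)))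
      ≈⟨ *-congˡ (+-congˡ (*-congˡ (*-congˡ (reflexive (≡.cong geo⁻ (ℕ.+-comm b a)))))) ⟩
    (A + B) * (square (1# + B) * (u a b * h) + square (1# - A) * (u b a * h))
      ≈⟨ solve 7 (λ A B x y u w h → (A :+ B) :* (x :* (u :* h) :+ y :* (w :* h))
           := x :* ((A :+ B) :* u) :* h :+ y :* ((B :+ A) :* w) :* h) refl _ _ _ _ _ _ _ ⟩
    square (1# + B) * ((A + B) * u a b) * h + square (1# - A) * ((B + A) * u b a) * h
      ≈⟨ +-cong (*-congʳ (*-congˡ (u-inverse a≢b))) (*-congʳ (*-congˡ (u-inverse (λ e → a≢b (≡.sym e))))) ⟩
    square (1# + B) * A * h + square (1# - A) * B * h
      ≈⟨ solve 3 (λ A B h → (con (+ 1) :+ B) :* (con (+ 1) :+ B) :* A :* h :+ (con (+ 1) :- A) :* (con (+ 1) :- A) :* B :* h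
           := (A :+ B) :* ((con (+ 1) :+ A :* B) :* h)) refl A B h ⟩
    (A + B) * ((1# + A * B) * h)
      ≈⟨ *-congˡ (trans (*-congʳ (+-congˡ (sym (q^-+ a b)))) (geo⁻-inverse pos)) ⟩
    (A + B) * 1# ∎)

geo⁻-mod : ∀ {M k} → M ≤ k → geo⁻ k ≈[ M ] 1#
geo⁻-mod {M} {zero}  z≤n = ptw λ _ ()
geo⁻-mod {M} {suc k} M≤k = weaken M≤k (geo⁻≈1 (s≤s z≤n))

module Progression (b : ℕ) (x₀ : ℕ) where

  x : ℕ → ℕ
  x j = x₀ ℕ.+ b ℕ.* j

  x-suc : ∀ j → x (suc j) ≡ b ℕ.+ x j
  x-suc j = ℕS.solve 3 (λ x b j → x ⊕ b ⊗ (κ 1 ⊕ j) ⊜ b ⊕ (x ⊕ b ⊗ j)) ≡.refl x₀ b j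

  Πv : ℕ → ℕ → PS
  Πv e m = Π< (λ j → v e (x j)) m

  -- A finite form of the quasi-periodicity of theta functions: raising e by the step b moves each
  -- factor to the neighbouring index, in opposite directions for `u` and `geo⁻`, and only boundary
  -- factors remain.
  Πv-shift : ∀ e m → Πv (b ℕ.+ e) (suc m) * (u e (x m) * geo⁻ (e ℕ.+ x 0))
                   ≐ Πv e (suc m) * (u (b ℕ.+ e) (x 0) * geo⁻ (e ℕ.+ x (suc m)))
  Πv-shift e m = begin
    Πv (b ℕ.+ e) (suc m) * (u e (x m) * geo⁻ (e ℕ.+ x 0))
      ≈⟨ *-congʳ (𝒮.Π-* U′ G′ (suc m)) ⟩
    Π< U′ (suc m) * Π< G′ (suc m) * (u e (x m) * G 0)
      ≈⟨ *-congʳ (*-cong (𝒮.Π-first U′ m) (𝒮.Π-cong (suc m) (λ j → reflexive (≡.cong geo⁻ (index j))))) ⟩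
    U′ 0 * Π< (U′ ∘ suc) m * Π< (G ∘ suc) (suc m) * (u e (x m) * G 0)
      ≈⟨ *-congʳ (*-congʳ (*-congˡ (𝒮.Π-cong m (λ j → reflexive (≡.trans (≡.cong (u (b ℕ.+ e)) (x-suc j)) (u-shift b e (x j))))))) ⟩
    U′ 0 * Π< U m * Π< (G ∘ suc) (suc m) * (U m * G 0)
      ≈⟨ solve 5 (λ a p g u h → a :* p :* g :* (u :* h) := p :* u :* (h :* g) :* a) refl _ _ _ _ _ ⟩
    Π< U (suc m) * (G 0 * Π< (G ∘ suc) (suc m)) * U′ 0
      ≈⟨ *-congʳ (*-congˡ (sym (𝒮.Π-first G (suc m)))) ⟩
    Π< U (suc m) * (Π< G (suc m) * G (suc m)) * U′ 0
      ≈⟨ solve 4 (λ p g h a → p :* (g :* h) :* a := p :* g :* (a :* h)) refl _ _ _ _ ⟩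
    Π< U (suc m) * Π< G (suc m) * (U′ 0 * G (suc m))
      ≈⟨ *-congʳ (sym (𝒮.Π-* U G (suc m))) ⟩
    Πv e (suc m) * (U′ 0 * G (suc m)) ∎
    where
    open ≐-Reasoning
    U U′ G G′ : ℕ → PS
    U j = u e (x j)
    U′ j = u (b ℕ.+ e) (x j)
    G j = geo⁻ (e ℕ.+ x j)
    G′ j = geo⁻ (b ℕ.+ e ℕ.+ x j)
    index : ∀ j → b ℕ.+ e ℕ.+ x j ≡ e ℕ.+ x (suc j)
    index j = ≡.trans (ℕS.solve 3 (λ b e x → b ⊕ e ⊕ x ⊜ e ⊕ (b ⊕ x)) ≡.refl b e (x j)) (≡.cong (e ℕ.+_) (≡.sym (x-suc j)))

  -- Two of the four boundary factors in `Πv-shift` have index close to m and equal 1 to the stated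
  -- precision. The other two form the multiplier of the theta function.
  Πv-limit-shift : ∀ {e m M L} → M ℕ.+ (b ℕ.+ e) ≤ x (suc m) → Πv e (suc m) ≈[ M ] L →
    Πv (b ℕ.+ e) (suc m) * geo⁻ (e ℕ.+ x 0) ≈[ M ] L * u (b ℕ.+ e) (x 0)
  Πv-limit-shift {e} {m} {M} {L} bound lim = begin
    Πv (b ℕ.+ e) (suc m) * geo⁻ (e ℕ.+ x 0)
      ≈⟨ *-modˡ (Mod.trans (≐⇒≈ (sym (*-identityˡ _))) (*-modʳ (Mod.sym (weaken M≤ (u≈1 e (x m)))))) ⟩
    Πv (b ℕ.+ e) (suc m) * (u e (x m) * geo⁻ (e ℕ.+ x 0))
      ≈⟨ ≐⇒≈ (Πv-shift e m) ⟩
    Πv e (suc m) * (u (b ℕ.+ e) (x 0) * geo⁻ (e ℕ.+ x (suc m)))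
      ≈⟨ *-mod lim (Mod.trans (*-modˡ last) (≐⇒≈ (*-identityʳ _))) ⟩
    L * u (b ℕ.+ e) (x 0) ∎
    where
    open SetoidReasoning (mod M)
    M≤ : M ≤ x m ∸ e
    M≤ = ℕ.m+n≤o⇒m≤o∸n M (ℕ.+-cancelˡ-≤ b _ _ (ℕ.≤-trans (ℕ.≤-reflexive
      (ℕS.solve 3 (λ b M e → b ⊕ (M ⊕ e) ⊜ M ⊕ (b ⊕ e)) ≡.refl b M e)) (ℕ.≤-trans bound (ℕ.≤-reflexive (x-suc m)))))
    last : geo⁻ (e ℕ.+ x (suc m)) ≈[ M ] 1#
    last = geo⁻-mod (ℕ.≤-trans (ℕ.m+n≤o⇒m≤o M bound) (ℕ.m≤n+m (x (suc m)) e))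

h : ℕ → PS
h j = geo⁻ (odd j)

-- In product notation this is 1/(-q; q²)_∞.
H : PS
H = Π∞ h

h-factors : Factors h
h-factors j = geo⁻-mod (s≤s (ℕ.m≤n*m j 2))

geo⁻-inverse′ : ∀ {m} → 1 ≤ m → geo⁻ m * (1# + q^ m) ≐ 1#
geo⁻-inverse′ 1≤m = trans (*-comm _ _) (geo⁻-inverse 1≤m)

module Odd = Progression 2 1

-- At e = 0 the product is a squared partial product of `H`. Each shift of e by 2 contributes
-- q^(2k+1), and these odd exponents add up to k².
odd-limit : ∀ k n M → M ≤ suc (suc n) → M ℕ.+ 2 ℕ.* k ≤ odd (suc n) →
  Odd.Πv (2 ℕ.* k) (suc n) ≈[ M ] q^ (k ℕ.* k) * (H * H)
odd-limit zero n M M≤ _ = Mod.trans (≐⇒≈ (𝒮.Π-* h h (suc n)))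
  (Mod.trans (*-mod (weaken M≤ (Π<≈Π∞ h-factors (suc n))) (weaken M≤ (Π<≈Π∞ h-factors (suc n))))
    (≐⇒≈ (trans (sym (*-identityˡ _)) (*-congʳ (sym q^0)))))
odd-limit (suc k) n M M≤ bound = ≡.subst (λ e → Odd.Πv e (suc n) ≈[ M ] q^ (suc k ℕ.* suc k) * (H * H)) (≡.sym (ℕ.*-suc 2 k))
  (unit-cancel-mod (geo⁻-inverse′ (s≤s z≤n)) (begin
    geo⁻ (suc (2 ℕ.* k)) * Odd.Πv (2 ℕ.+ 2 ℕ.* k) (suc n)
      ≈⟨ ≐⇒≈ (trans (*-comm _ _) (*-congˡ (reflexive (≡.cong geo⁻ (ℕ.+-comm 1 (2 ℕ.* k)))))) ⟩
    Odd.Πv (2 ℕ.+ 2 ℕ.* k) (suc n) * geo⁻ (2 ℕ.* k ℕ.+ 1)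
      ≈⟨ Odd.Πv-limit-shift bound′ (odd-limit k n M M≤ (ℕ.≤-trans (ℕ.+-monoʳ-≤ M (ℕ.m≤n+m (2 ℕ.* k) 2)) bound′)) ⟩
    q^ (k ℕ.* k) * (H * H) * (q^ suc (2 ℕ.* k) * geo⁻ (suc (2 ℕ.* k)))
      ≈⟨ ≐⇒≈ (trans (solve 4 (λ a b c d → a :* b :* (c :* d) := d :* (c :* a :* b)) refl _ _ _ _)
           (*-congˡ (*-congʳ (trans (sym (q^-+ (suc (2 ℕ.* k)) (k ℕ.* k)))
             (q^-≡ (ℕS.solve 1 (λ k → κ 1 ⊕ κ 2 ⊗ k ⊕ k ⊗ k ⊜ (κ 1 ⊕ k) ⊗ (κ 1 ⊕ k)) ≡.refl k)))))) ⟩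
    geo⁻ (suc (2 ℕ.* k)) * (q^ (suc k ℕ.* suc k) * (H * H)) ∎))
  where
  open SetoidReasoning (mod M)
  bound′ : M ℕ.+ (2 ℕ.+ 2 ℕ.* k) ≤ odd (suc n)
  bound′ = ≡.subst (λ e → M ℕ.+ e ≤ odd (suc n)) (ℕ.*-suc 2 k) bound

h₁ h₃ : ℕ → PS
h₁ j = geo⁻ (1 ℕ.+ 4 ℕ.* j)
h₃ j = geo⁻ (3 ℕ.+ 4 ℕ.* j)

h₁h₃-limit : ∀ m M → M ≤ suc (2 ℕ.* suc m) → Π< h₁ (suc m) * Π< h₃ (suc m) ≈[ M ] H
h₁h₃-limit m M M≤ = Mod.trans
  (≐⇒≈ (trans (sym (𝒮.Π-* h₁ h₃ (suc m))) (trans (𝒮.Π-cong (suc m) (λ j → *-cong (reflexive (≡.cong geo⁻ (i₁ j))) (reflexive (≡.cong geo⁻ (i₃ j)))))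
    (sym (𝒮.Π-2* h (suc m))))))
  (weaken M≤ (Π<≈Π∞ h-factors (2 ℕ.* suc m)))
  where
  i₁ : ∀ j → 1 ℕ.+ 4 ℕ.* j ≡ odd (2 ℕ.* j)
  i₁ = ℕS.solve 1 (λ j → κ 1 ⊕ κ 4 ⊗ j ⊜ κ 1 ⊕ κ 2 ⊗ (κ 2 ⊗ j)) ≡.refl
  i₃ : ∀ j → 3 ℕ.+ 4 ℕ.* j ≡ odd (suc (2 ℕ.* j))
  i₃ = ℕS.solve 1 (λ j → κ 3 ⊕ κ 4 ⊗ j ⊜ κ 1 ⊕ κ 2 ⊗ (κ 1 ⊕ κ 2 ⊗ j)) ≡.refl

private
  u-4+ : ∀ a c j → u a (c ℕ.+ 4 ℕ.* suc j) ≡ u a (4 ℕ.+ (c ℕ.+ 4 ℕ.* j))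
  u-4+ a c j = ≡.cong (u a) (ℕS.solve 2 (λ c j → c ⊕ κ 4 ⊗ (κ 1 ⊕ j) ⊜ κ 4 ⊕ (c ⊕ κ 4 ⊗ j)) ≡.refl c j)

  bound-4 : ∀ {M r x} → M ℕ.+ odd (2 ℕ.+ r) ≤ x → M ℕ.+ (4 ℕ.+ odd r) ≤ x
  bound-4 {M} {r} {x} = ≡.subst (λ e → M ℕ.+ e ≤ x) (ℕS.solve 1 (λ r → κ 1 ⊕ κ 2 ⊗ (κ 2 ⊕ r) ⊜ κ 4 ⊕ (κ 1 ⊕ κ 2 ⊗ r)) ≡.refl r)

  odd-4+ : ∀ r → odd (2 ℕ.+ r) ≡ 4 ℕ.+ odd r
  odd-4+ = ℕS.solve 1 (λ r → κ 1 ⊕ κ 2 ⊗ (κ 2 ⊕ r) ⊜ κ 4 ⊕ (κ 1 ⊕ κ 2 ⊗ r)) ≡.refl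

  complete : ∀ {M F g L} → g ≈[ M ] 1# → F * g ≈[ M ] L → F ≈[ M ] L
  complete g≈1 e = Mod.trans (≐⇒≈ (sym (*-identityʳ _))) (Mod.trans (*-modˡ (Mod.sym g≈1)) e)

module Two = Progression 4 2

-- The shift moves e by 4, hence r by 2, so e = 1 and e = 3 both serve as starting points. There the
-- exponents 1 and 3 modulo 4 together make up the odd exponents of `H`.
two-limit : ∀ r m M → M ≤ suc (2 ℕ.* suc m) → M ℕ.+ odd r ≤ Two.x (suc m) →
  Two.Πv (odd r) (suc m) ≈[ M ] q^ (tri r) * H
two-limit zero m M M≤ _ = Mod.trans (≐⇒≈ (𝒮.Π-* h₁ h₃ (suc m)))
  (Mod.trans (h₁h₃-limit m M M≤) (≐⇒≈ (trans (sym (*-identityˡ H)) (*-congʳ (sym q^0)))))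
-- At e = 3 the factor x = 2 yields the power q, and the product is one factor `h₃ m` short of
-- `h₁h₃-limit`. That factor is 1 modulo q^M, so it may be supplied.
two-limit (suc zero) m M M≤ bound = complete (geo⁻-mod M≤3+4m) (begin
  Two.Πv 3 (suc m) * h₃ m
    ≈⟨ ≐⇒≈ (*-congʳ (𝒮.Π-* (λ j → u 3 (2 ℕ.+ 4 ℕ.* j)) g₅ (suc m))) ⟩
  Π< (λ j → u 3 (2 ℕ.+ 4 ℕ.* j)) (suc m) * Π< g₅ (suc m) * h₃ m
    ≈⟨ ≐⇒≈ (*-congʳ (*-congʳ (trans (𝒮.Π-first (λ j → u 3 (2 ℕ.+ 4 ℕ.* j)) m) (*-congˡ (𝒮.Π-cong m (λ j → reflexive (u-4+ 3 2 j))))))) ⟩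
  q^ 1 * geo⁻ 1 * Π< (λ j → geo⁻ (3 ℕ.+ 4 ℕ.* j)) m * Π< g₅ (suc m) * h₃ m
    ≈⟨ ≐⇒≈ (solve 5 (λ q g p r s → q :* g :* p :* r :* s := q :* ((g :* r) :* (p :* s))) refl _ _ _ _ _) ⟩
  q^ 1 * (geo⁻ 1 * Π< g₅ (suc m) * Π< h₃ (suc m))
    ≈⟨ ≐⇒≈ (*-congˡ (*-congʳ (trans (*-congˡ (𝒮.Π-cong (suc m) (λ j → reflexive (≡.cong geo⁻ (≡.cong suc (≡.sym (ℕ.*-suc 4 j)))))))
         (sym (𝒮.Π-first h₁ (suc m)))))) ⟩
  q^ 1 * (Π< h₁ (suc m) * h₁ (suc m) * Π< h₃ (suc m))
    ≈⟨ *-modˡ (Mod.trans (≐⇒≈ (solve 3 (λ a b c → a :* b :* c := b :* (a :* c)) refl _ _ _))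
         (Mod.trans (*-mod (geo⁻-mod M≤5+4m) (h₁h₃-limit m M M≤)) (≐⇒≈ (*-identityˡ H)))) ⟩
  q^ 1 * H ∎)
  where
  open SetoidReasoning (mod M)
  g₅ : ℕ → PS
  g₅ j = geo⁻ (5 ℕ.+ 4 ℕ.* j)
  M≤3+4m : M ≤ 3 ℕ.+ 4 ℕ.* m
  M≤3+4m = ℕ.+-cancelʳ-≤ 3 M _ (ℕ.≤-trans bound (ℕ.≤-reflexive (ℕS.solve 1 (λ m → κ 2 ⊕ κ 4 ⊗ (κ 1 ⊕ m) ⊜ κ 3 ⊕ κ 4 ⊗ m ⊕ κ 3) ≡.refl m)))
  M≤5+4m : M ≤ 1 ℕ.+ 4 ℕ.* suc m
  M≤5+4m = ℕ.≤-trans M≤3+4m (ℕ.≤-trans (ℕ.+-monoˡ-≤ (4 ℕ.* m) (s≤s (s≤s (s≤s (z≤n {2}))))) (ℕ.≤-reflexive (≡.cong suc (≡.sym (ℕ.*-suc 4 m)))))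
two-limit (suc (suc r)) m M M≤ bound = ≡.subst (λ e → Two.Πv e (suc m) ≈[ M ] q^ (tri (2 ℕ.+ r)) * H) (≡.sym (odd-4+ r))
  (unit-cancel-mod (geo⁻-inverse′ (s≤s z≤n)) (begin
    geo⁻ (2 ℕ.+ odd r) * Two.Πv (4 ℕ.+ odd r) (suc m)
      ≈⟨ ≐⇒≈ (trans (*-comm _ _) (*-congˡ (reflexive (≡.cong geo⁻ (ℕ.+-comm 2 (odd r)))))) ⟩
    Two.Πv (4 ℕ.+ odd r) (suc m) * geo⁻ (odd r ℕ.+ 2)
      ≈⟨ Two.Πv-limit-shift (bound-4 bound) (two-limit r m M M≤ (ℕ.≤-trans (ℕ.+-monoʳ-≤ M (ℕ.m≤n+m (odd r) 4)) (bound-4 bound))) ⟩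
    q^ (tri r) * H * (q^ (2 ℕ.+ odd r) * geo⁻ (2 ℕ.+ odd r))
      ≈⟨ ≐⇒≈ (trans (solve 4 (λ a b c d → a :* b :* (c :* d) := d :* (a :* c :* b)) refl _ _ _ _)
           (*-congˡ (*-congʳ (trans (sym (q^-+ (tri r) _))
             (q^-≡ (ℕS.solve 2 (λ t r → t ⊕ (κ 2 ⊕ (κ 1 ⊕ κ 2 ⊗ r)) ⊜ t ⊕ (κ 1 ⊕ r) ⊕ (κ 2 ⊕ r)) ≡.refl (tri r) r)))))) ⟩
    geo⁻ (2 ℕ.+ odd r) * (q^ (tri (2 ℕ.+ r)) * H) ∎))
  where open SetoidReasoning (mod M)

module Zero = Progression 4 0

zero-factor : ℕ → PS
zero-factor r = q^ (tri r ℕ.+ suc r) * geo⁻ (odd r) * H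

-- The induction is that of `two-limit`, but the factor x = 0 is q^e/(1+q^e)². This accounts for the
-- additional 1/(1+q^(2r+1)) in the limit.
zero-limit : ∀ r m M → M ≤ suc (2 ℕ.* suc m) → M ℕ.+ odd r ≤ Zero.x (suc m) →
  Zero.Πv (odd r) (suc m) ≈[ M ] zero-factor r
zero-limit zero m M M≤ bound = complete (geo⁻-mod M≤3+4m) (begin
  Zero.Πv 1 (suc m) * h₃ m
    ≈⟨ ≐⇒≈ (*-congʳ (𝒮.Π-* (λ j → u 1 (4 ℕ.* j)) h₁ (suc m))) ⟩
  Π< (λ j → u 1 (4 ℕ.* j)) (suc m) * Π< h₁ (suc m) * h₃ m
    ≈⟨ ≐⇒≈ (*-congʳ (*-congʳ (trans (𝒮.Π-first (λ j → u 1 (4 ℕ.* j)) m) (*-congˡ (𝒮.Π-cong m (λ j → reflexive (u-4+ 1 0 j))))))) ⟩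
  q^ 1 * geo⁻ 1 * Π< h₃ m * Π< h₁ (suc m) * h₃ m
    ≈⟨ ≐⇒≈ (solve 5 (λ q g p r s → q :* g :* p :* r :* s := q :* g :* (r :* (p :* s))) refl _ _ _ _ _) ⟩
  q^ 1 * geo⁻ 1 * (Π< h₁ (suc m) * Π< h₃ (suc m))
    ≈⟨ *-modˡ (h₁h₃-limit m M M≤) ⟩
  q^ 1 * geo⁻ 1 * H ∎)
  where
  open SetoidReasoning (mod M)
  M≤3+4m : M ≤ 3 ℕ.+ 4 ℕ.* m
  M≤3+4m = ℕ.+-cancelʳ-≤ 1 M _ (ℕ.≤-trans bound (ℕ.≤-reflexive (ℕS.solve 1 (λ m → κ 4 ⊗ (κ 1 ⊕ m) ⊜ κ 3 ⊕ κ 4 ⊗ m ⊕ κ 1) ≡.refl m)))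
zero-limit (suc zero) m M M≤ bound = complete (geo⁻-mod M≤1+4m) (begin
  Zero.Πv 3 (suc m) * h₁ m
    ≈⟨ ≐⇒≈ (*-congʳ (𝒮.Π-* (λ j → u 3 (4 ℕ.* j)) h₃ (suc m))) ⟩
  Π< (λ j → u 3 (4 ℕ.* j)) (suc m) * Π< h₃ (suc m) * h₁ m
    ≈⟨ ≐⇒≈ (*-congʳ (*-congʳ (trans (𝒮.Π-first (λ j → u 3 (4 ℕ.* j)) m) (*-congˡ (𝒮.Π-cong m (λ j → reflexive (u-4+ 3 0 j))))))) ⟩
  q^ 3 * geo⁻ 3 * Π< h₁ m * Π< h₃ (suc m) * h₁ m
    ≈⟨ ≐⇒≈ (solve 5 (λ q g p r s → q :* g :* p :* r :* s := q :* g :* ((p :* s) :* r)) refl _ _ _ _ _) ⟩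
  q^ 3 * geo⁻ 3 * (Π< h₁ (suc m) * Π< h₃ (suc m))
    ≈⟨ *-modˡ (h₁h₃-limit m M M≤) ⟩
  q^ 3 * geo⁻ 3 * H ∎)
  where
  open SetoidReasoning (mod M)
  M≤1+4m : M ≤ 1 ℕ.+ 4 ℕ.* m
  M≤1+4m = ℕ.+-cancelʳ-≤ 3 M _ (ℕ.≤-trans bound (ℕ.≤-reflexive (ℕS.solve 1 (λ m → κ 4 ⊗ (κ 1 ⊕ m) ⊜ κ 1 ⊕ κ 4 ⊗ m ⊕ κ 3) ≡.refl m)))
zero-limit (suc (suc r)) m M M≤ bound = ≡.subst (λ e → Zero.Πv e (suc m) ≈[ M ] q^ (tri (2 ℕ.+ r) ℕ.+ (3 ℕ.+ r)) * geo⁻ e * H) (≡.sym (odd-4+ r))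
  (unit-cancel-mod (geo⁻-inverse′ (s≤s z≤n)) (begin
    geo⁻ (odd r) * Zero.Πv (4 ℕ.+ odd r) (suc m)
      ≈⟨ ≐⇒≈ (trans (*-comm _ _) (*-congˡ (reflexive (≡.cong geo⁻ (≡.sym (ℕ.+-identityʳ (odd r))))))) ⟩
    Zero.Πv (4 ℕ.+ odd r) (suc m) * geo⁻ (odd r ℕ.+ 0)
      ≈⟨ Zero.Πv-limit-shift (bound-4 bound) (zero-limit r m M M≤ (ℕ.≤-trans (ℕ.+-monoʳ-≤ M (ℕ.m≤n+m (odd r) 4)) (bound-4 bound))) ⟩
    q^ (tri r ℕ.+ suc r) * geo⁻ (odd r) * H * (q^ (4 ℕ.+ odd r) * geo⁻ (4 ℕ.+ odd r))
      ≈⟨ ≐⇒≈ (trans (solve 5 (λ a g b c d → a :* g :* b :* (c :* d) := g :* (a :* c :* d :* b)) refl _ _ _ _ _)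
           (*-congˡ (*-congʳ (*-congʳ (trans (sym (q^-+ (tri r ℕ.+ suc r) _))
             (q^-≡ (ℕS.solve 2 (λ t r → t ⊕ (κ 1 ⊕ r) ⊕ (κ 4 ⊕ (κ 1 ⊕ κ 2 ⊗ r)) ⊜ t ⊕ (κ 1 ⊕ r) ⊕ (κ 2 ⊕ r) ⊕ (κ 3 ⊕ r)) ≡.refl (tri r) r))))))) ⟩
    geo⁻ (odd r) * (q^ (tri (2 ℕ.+ r) ℕ.+ (3 ℕ.+ r)) * geo⁻ (4 ℕ.+ odd r) * H) ∎))
  where open SetoidReasoning (mod M)

-- Watson's relations from double partial fractions

module VFamily (b : ℕ) (1≤b : 1 ≤ b) (W : Base.Weight b 1≤b) where
  open Base b 1≤b
  open Limits W

  -- With E = q^e and X = q^(x r), `v e (x r)` is E/((E+X)(1+EX)), a fraction of the type covered by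
  -- `poles` with V = -(1+E²). The values of one family at a fixed foreign pole therefore satisfy
  -- the same expansion, and their weighted sum is a product. E is not a unit for e > 0, but it
  -- cancels.
  v-expansion : ∀ e (x : ℕ → ℕ) →
    (∀ r k → x (suc (r ℕ.+ k)) ≡ x r ℕ.+ b ℕ.* suc k) →
    (∀ r k → x r ℕ.+ x (suc (r ℕ.+ k)) ≡ b ℕ.* (suc (r ℕ.+ k) ℕ.+ r ℕ.+ s)) →
    (∀ r → e ≢ x r) → (∀ r → 1 ≤ e ℕ.+ x r) →
    ∀ n → Π< (λ r → v e (x r)) (suc n) ≐ Σ≤ (λ r → c[ n , r ] * v e (x r)) n
  v-expansion e x shift product e≢x pos = expansion 1# 1-cancel (λ r → v e (x r)) (λ n → Π< (λ r → v e (x r)) (suc n))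
    v-poles (*-identityˡ _) (λ n → *-identityˡ _)
    where
    v-poles : Poles 1# (λ r → v e (x r))
    v-poles = poles {q^ e} {⊝ (1# + q^ e * q^ e)} {1#} {1#} {λ r → q^ (x r)} {λ r → v e (x r)} (q^-cancel e)
      (λ r k → trans (q^-≡ (shift r k)) (q^-+ (x r) _))
      (λ r k → trans (*-congʳ (*-identityˡ _)) (trans (sym (q^-+ (x r) _)) (q^-≡ (product r k))))
      (λ r → trans (*-congʳ (solve 2 (λ E X → E :* (con (+ 1) :+ con (+ 1) :* X :* X) :- :- (con (+ 1) :+ E :* E) :* X
                                       := (E :+ X) :* (con (+ 1) :+ E :* X)) refl (q^ e) (q^ x r)))
                   (trans (v-inverse (e≢x r) (pos r)) (sym (*-identityˡ _))))

module TwoPole (W : Q4.Weight) (K PE : PS) (ε R partial : ℕ → PS) where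
  module L4 = Q4.Limits W
  open L4 using (s; σ; c[_,_])
  open Progression 4 (2 ℕ.* s)

  private
    x≡ : ∀ j → x j ≡ 2 ℕ.* (s ℕ.+ 2 ℕ.* j)
    x≡ j = ℕS.solve 2 (λ s j → κ 2 ⊗ s ⊕ κ 4 ⊗ j ⊜ κ 2 ⊗ (s ⊕ κ 2 ⊗ j)) ≡.refl s j

    odd≢x : ∀ r j → odd r ≢ x j
    odd≢x r j e = ℕ.even≢odd (s ℕ.+ 2 ℕ.* j) r (≡.sym (≡.trans e (x≡ j)))

    Σμ : ∀ r m → Σ≤ (λ j → c[ m , j ] * v (odd r) (x j)) m ≐ Πv (odd r) (suc m)
    Σμ r m = sym (VFamily.v-expansion 4 (s≤s z≤n) W (odd r) x
      (λ r k → ℕS.solve 3 (λ s r k → κ 2 ⊗ s ⊕ κ 4 ⊗ (κ 1 ⊕ (r ⊕ k)) ⊜ κ 2 ⊗ s ⊕ κ 4 ⊗ r ⊕ κ 4 ⊗ (κ 1 ⊕ k)) ≡.refl s r k)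
      (λ r k → ℕS.solve 3 (λ s r k → κ 2 ⊗ s ⊕ κ 4 ⊗ r ⊕ (κ 2 ⊗ s ⊕ κ 4 ⊗ (κ 1 ⊕ (r ⊕ k))) ⊜ κ 4 ⊗ (κ 1 ⊕ (r ⊕ k) ⊕ r ⊕ s)) ≡.refl s r k)
      (odd≢x r) (λ _ → s≤s z≤n) m)

    Σν : ∀ j n → Σ≤ (λ r → L2.c[ n , r ] * v (x j) (odd r)) n ≐ Odd.Πv (x j) (suc n)
    Σν j n = sym (VFamily.v-expansion 2 (s≤s z≤n) Q2.weight₁ (x j) odd odd-shift odd-product
      (λ r e → odd≢x r j (≡.sym e)) (λ r → ℕ.≤-trans (s≤s z≤n) (ℕ.m≤n+m (odd r) (x j))) n)

  -- `R r` is the limit of the second family's product at q^(±(2r+1)), up to the constant numerators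
  -- K, and the power of q times H² is that of the first family's product at -q^(±(2s+4j)). The
  -- poles of the two families never collide, since odd and even exponents differ.
  two-pole : s ≤ 1 →
    (∀ n → partial n ≐ Σ≤ (λ j → c[ n , j ] * ε j) n) →
    (∀ N → partial N ≈[ suc N ] PE) →
    (∀ j → square (1# + q^ x j) * ε j ≐ K) →
    (∀ r m M → M ≤ suc (2 ℕ.* suc m) → M ℕ.+ odd r ≤ x (suc m) → Πv (odd r) (suc m) ≈[ M ] R r) →
    Π∞ δ * PE ≐ K * (etaInv 2 * etaInv 2 * Σ∞ (λ r → Q2.χ r * Q2.σ₁ r * δ r * R r))
      + etaInv 4 * etaInv 4 * Σ∞ (λ j → Q4.χ j * σ j * ε j * (q^ ((s ℕ.+ 2 ℕ.* j) ℕ.* (s ℕ.+ 2 ℕ.* j)) * (H * H)))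
  two-pole s≤1 expansion partial→ ε-inverse R-limit = ≈⇒≐ step
    where
    step : ∀ N → Π∞ δ * PE ≈[ suc N ] K * (etaInv 2 * etaInv 2 * Σ∞ (λ r → Q2.χ r * Q2.σ₁ r * δ r * R r))
      + etaInv 4 * etaInv 4 * Σ∞ (λ j → Q4.χ j * σ j * ε j * (q^ ((s ℕ.+ 2 ℕ.* j) ℕ.* (s ℕ.+ 2 ℕ.* j)) * (H * H)))
    step N = begin
      Π∞ δ * PE
        ≈⟨ *-mod (Mod.sym (weaken (ℕ.≤-trans (s≤s N≤n) (ℕ.n≤1+n _)) (Π<≈Π∞ δ-factors (suc n)))) (Mod.sym (partial→ N)) ⟩
      Π< δ (suc n) * partial N
        ≈⟨ ≐⇒≈ (*-cong (δ-expansion n) (expansion N)) ⟩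
      Σ≤ (λ r → L2.c[ n , r ] * δ r) n * Σ≤ (λ j → c[ N , j ] * ε j) N
        ≈⟨ ≐⇒≈ (TwoFamilies.product-expansion psRing K n N (λ r → L2.c[ n , r ]) (λ j → c[ N , j ]) δ ε
             (λ r → Πv (odd r) (suc N)) (λ j → Odd.Πv (x j) (suc n)) (λ r j → v (odd r) (x j)) (λ r j → v (x j) (odd r))
             (λ r j → cross (odd≢x r j) (s≤s z≤n) (δ-inverse r) (ε-inverse j))
             (λ r → Σμ r N) (λ j → Σν j n)) ⟩
      K * Σ≤ (λ r → L2.c[ n , r ] * δ r * Πv (odd r) (suc N)) n + Σ≤ (λ j → c[ N , j ] * ε j * Odd.Πv (x j) (suc n)) N
        ≈⟨ +-mod
             (*-modˡ (weaken (s≤s N≤n) (L2.weighted-limit {δ} {R} n (λ r → Πv (odd r) (suc N)) μ-limit)))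
             (L4.weighted-limit {ε} {λ j → q^ ((s ℕ.+ 2 ℕ.* j) ℕ.* (s ℕ.+ 2 ℕ.* j)) * (H * H)} N (λ j → Odd.Πv (x j) (suc n)) ν-limit) ⟩
      _ ∎
      where
      open SetoidReasoning (mod (suc N))
      -- The exponents of the first family advance by 2 and those of the second by 4. With n = 2N
      -- both reach about 4N, as the precision bounds of both inner limits demand.
      n : ℕ
      n = 2 ℕ.* N
      N≤n : N ≤ n
      N≤n = ℕ.m≤n*m N 2
      μ-limit : ∀ r → r ≤ n → Πv (odd r) (suc N) ≈[ suc (n ∸ r) ] R r
      μ-limit r r≤n = R-limit r N (suc (n ∸ r))
        (s≤s (ℕ.≤-trans (ℕ.m∸n≤m n r) (ℕ.*-monoʳ-≤ 2 (ℕ.n≤1+n N))))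
        (ℕ.≤-trans (ℕ.≤-reflexive (ℕS.solve 2 (λ a r → κ 1 ⊕ a ⊕ (κ 1 ⊕ κ 2 ⊗ r) ⊜ κ 2 ⊕ (a ⊕ r) ⊕ r) ≡.refl (n ∸ r) r))
          (ℕ.≤-trans (ℕ.+-mono-≤ (ℕ.≤-reflexive (≡.cong (2 ℕ.+_) (ℕ.m∸n+n≡m r≤n))) r≤n)
            (ℕ.≤-trans (ℕ.m≤m+n (2 ℕ.+ n ℕ.+ n) (2 ℕ.+ 2 ℕ.* s))
              (ℕ.≤-reflexive (ℕS.solve 2 (λ s N → κ 2 ⊕ κ 2 ⊗ N ⊕ κ 2 ⊗ N ⊕ (κ 2 ⊕ κ 2 ⊗ s) ⊜ κ 2 ⊗ s ⊕ κ 4 ⊗ (κ 1 ⊕ N)) ≡.refl s N)))))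
      ν-limit : ∀ j → j ≤ N → Odd.Πv (x j) (suc n) ≈[ suc (N ∸ j) ] q^ ((s ℕ.+ 2 ℕ.* j) ℕ.* (s ℕ.+ 2 ℕ.* j)) * (H * H)
      ν-limit j j≤N = ≡.subst (λ e → Odd.Πv e (suc n) ≈[ suc (N ∸ j) ] q^ ((s ℕ.+ 2 ℕ.* j) ℕ.* (s ℕ.+ 2 ℕ.* j)) * (H * H)) (≡.sym (x≡ j))
        (odd-limit (s ℕ.+ 2 ℕ.* j) n (suc (N ∸ j)) (s≤s (ℕ.≤-trans (ℕ.m∸n≤m N j) (ℕ.≤-trans N≤n (ℕ.n≤1+n n))))
          (ℕ.≤-trans (ℕ.≤-reflexive (ℕS.solve 3 (λ a j s → κ 1 ⊕ a ⊕ κ 2 ⊗ (s ⊕ κ 2 ⊗ j) ⊜ a ⊕ j ⊕ κ 3 ⊗ j ⊕ (κ 1 ⊕ κ 2 ⊗ s)) ≡.refl (N ∸ j) j s))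
            (ℕ.≤-trans (ℕ.+-mono-≤ (ℕ.+-mono-≤ (ℕ.≤-reflexive (ℕ.m∸n+n≡m j≤N)) (ℕ.*-monoʳ-≤ 3 j≤N)) (ℕ.+-monoʳ-≤ 1 (ℕ.*-monoʳ-≤ 2 s≤1)))
              (ℕ.≤-reflexive (ℕS.solve 1 (λ N → N ⊕ κ 3 ⊗ N ⊕ κ 3 ⊜ κ 1 ⊕ κ 2 ⊗ (κ 1 ⊕ κ 2 ⊗ N)) ≡.refl N)))))

module L4 = Q4.Limits Q4.weight₁

two : ℕ → ℕ
two j = 2 ℕ.+ 4 ℕ.* j

ε₂ : ℕ → PS
ε₂ j = square (geo⁻ (two j))

ε₂-inverse : ∀ j → square (1# + q^ two j) * ε₂ j ≐ 1#
ε₂-inverse j = *-inverse (geo⁻-inverse (s≤s z≤n)) (geo⁻-inverse (s≤s z≤n))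

two-factors : Factors (geo⁻ ∘ two)
two-factors j = geo⁻-mod (s≤s (ℕ.≤-trans (ℕ.m≤n*m j 4) (ℕ.n≤1+n _)))

ε₂-factors : Factors ε₂
ε₂-factors = Factors-* two-factors two-factors

ε₂-expansion : ∀ n → Π< ε₂ (suc n) ≐ Σ≤ (λ j → L4.c[ n , j ] * ε₂ j) n
ε₂-expansion = L4.expansion 1# 1-cancel ε₂ (λ n → Π< ε₂ (suc n))
  (L4.poles {1#} {⊝ ι (+ 2)} {1#} {1#} {λ j → q^ two j} {ε₂} 1-cancel
    (λ r k → trans (q^-≡ (ℕS.solve 2 (λ r k → κ 2 ⊕ κ 4 ⊗ (κ 1 ⊕ (r ⊕ k)) ⊜ κ 2 ⊕ κ 4 ⊗ r ⊕ κ 4 ⊗ (κ 1 ⊕ k)) ≡.refl r k)) (q^-+ (two r) _))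
    (λ r k → trans (*-congʳ (*-identityˡ _)) (trans (sym (q^-+ (two r) _))
      (q^-≡ (ℕS.solve 2 (λ r k → κ 2 ⊕ κ 4 ⊗ r ⊕ (κ 2 ⊕ κ 4 ⊗ (κ 1 ⊕ (r ⊕ k))) ⊜ κ 4 ⊗ (κ 1 ⊕ (r ⊕ k) ⊕ r ⊕ κ 1)) ≡.refl r k))))
    (λ r → trans (*-congʳ (solve 1 (λ x → con (+ 1) :* (con (+ 1) :+ con (+ 1) :* x :* x) :- :- con (+ 2) :* x
                                       := (con (+ 1) :+ x) :* (con (+ 1) :+ x)) refl _))
                 (trans (ε₂-inverse r) (sym (*-identityˡ 1#)))))
  (*-identityˡ _) (λ n → *-identityˡ _)

-- Replacing q by q² gives the part of `ω-term` even in q, the sign (-1)^r and the index r being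
-- kept.
even-term : ℕ → PS
even-term r = sgn r * lerch-term (3 ℕ.* tri r) (odd r)

even-term-order : Terms even-term
even-term-order r = *-order′ (sgn r) (order-* (ratio (odd r)) (q^-order≤ (ℕ.≤-trans (r≤tri r) (ℕ.m≤n*m (tri r) 3))))

ω⁻-term : ℕ → PS
ω⁻-term j = sgn j * (q^ (6 ℕ.* (j ℕ.* (j ℕ.+ 1))) * ((1# - q^ two j) * geo⁻ (two j)))

ω⁻-term-order : Terms ω⁻-term
ω⁻-term-order j = *-order′ (sgn j) (order-* _ (q^-order≤ (ℕ.≤-trans (n≤n*[n+s] j 1) (ℕ.m≤n*m _ 6))))

-- On the first side the limit adds `tri r` to the exponent 2 `tri r` of χ, which yields the even
-- half of ω. On the second, 4 `tri j` + (2j+1)² = 1 + 6j(j+1) is the exponent of q ω(-q²).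
watson-even : Π∞ δ * Π∞ ε₂ ≐ etaInv 2 * etaInv 2 * (H * Σ∞ even-term) + etaInv 4 * etaInv 4 * (q^ 1 * (H * H) * Σ∞ ω⁻-term)
watson-even = trans
  (TwoPole.two-pole Q4.weight₁ 1# (Π∞ ε₂) ε₂ (λ r → q^ (tri r) * H) (λ n → Π< ε₂ (suc n)) ℕ.≤-refl
    ε₂-expansion (λ N → weaken (ℕ.n≤1+n _) (Π<≈Π∞ ε₂-factors (suc N))) ε₂-inverse two-limit)
  (+-cong (trans (*-identityˡ _) (*-congˡ (trans (Σ∞-cong first) (Σ∞-*ˡ H even-term-order))))
          (*-congˡ (trans (Σ∞-cong second) (Σ∞-*ˡ (q^ 1 * (H * H)) ω⁻-term-order))))
  where
  first : ∀ r → Q2.χ r * Q2.σ₁ r * δ r * (q^ (tri r) * H) ≐ H * even-term r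
  first r = begin
    Q2.χ r * Q2.σ₁ r * δ r * (q^ (tri r) * H)
      ≈⟨ solve 5 (λ a b c d e → a :* b :* c :* (d :* e) := e :* (a :* d :* (b :* c))) refl _ _ _ _ _ ⟩
    H * (Q2.χ r * q^ (tri r) * (Q2.σ₁ r * δ r))
      ≈⟨ *-congˡ (*-cong (trans (*-congʳ (Q2.χ≐ r)) (trans (*-assoc _ _ _) (*-congˡ (trans (sym (q^-+ (2 ℕ.* tri r) (tri r)))
           (q^-≡ (ℕ.+-comm (2 ℕ.* tri r) (tri r))))))) (δ-ratio r)) ⟩
    H * (sgn r * q^ (3 ℕ.* tri r) * ratio (odd r))
      ≈⟨ *-congˡ (*-assoc _ _ _) ⟩
    H * even-term r ∎
    where open ≐-Reasoning
  second : ∀ j → Q4.χ j * Q4.σ₁ j * ε₂ j * (q^ ((1 ℕ.+ 2 ℕ.* j) ℕ.* (1 ℕ.+ 2 ℕ.* j)) * (H * H)) ≐ q^ 1 * (H * H) * ω⁻-term j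
  second j = begin
    Q4.χ j * Q4.σ₁ j * ε₂ j * (q^ ((1 ℕ.+ 2 ℕ.* j) ℕ.* (1 ℕ.+ 2 ℕ.* j)) * (H * H))
      ≈⟨ *-cong (*-congʳ (*-cong (Q4.χ≐ j) (+-congˡ (-‿cong (trans (q^-≡ double) (q^-+ (two j) (two j))))))) refl ⟩
    sgn j * q^ (4 ℕ.* tri j) * (1# - z * z) * (g * g) * (q^ ((1 ℕ.+ 2 ℕ.* j) ℕ.* (1 ℕ.+ 2 ℕ.* j)) * (H * H))
      ≈⟨ solve 6 (λ s a z g b k → s :* a :* (con (+ 1) :- z :* z) :* (g :* g) :* (b :* k)
           := a :* b :* (k :* (s :* ((con (+ 1) :- z) :* g :* ((con (+ 1) :+ z) :* g))))) refl _ _ z g _ _ ⟩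
    q^ (4 ℕ.* tri j) * q^ ((1 ℕ.+ 2 ℕ.* j) ℕ.* (1 ℕ.+ 2 ℕ.* j)) * (H * H * (sgn j * ((1# - z) * g * ((1# + z) * g))))
      ≈⟨ *-cong (trans (sym (q^-+ (4 ℕ.* tri j) _)) (trans (q^-≡ index) (q^-+ 1 _)))
           (*-congˡ (*-congˡ (trans (*-congˡ (geo⁻-inverse (s≤s z≤n))) (*-identityʳ _)))) ⟩
    q^ 1 * q^ (6 ℕ.* (j ℕ.* (j ℕ.+ 1))) * (H * H * (sgn j * ((1# - z) * g)))
      ≈⟨ solve 5 (λ q a k s r → q :* a :* (k :* (s :* r)) := q :* k :* (s :* (a :* r))) refl _ _ _ _ _ ⟩
    q^ 1 * (H * H) * ω⁻-term j ∎
    where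
    open ≐-Reasoning
    z g : PS
    z = q^ two j
    g = geo⁻ (two j)
    double : 4 ℕ.* suc (j ℕ.+ j) ≡ two j ℕ.+ two j
    double = ℕS.solve 1 (λ j → κ 4 ⊗ (κ 1 ⊕ (j ⊕ j)) ⊜ κ 2 ⊕ κ 4 ⊗ j ⊕ (κ 2 ⊕ κ 4 ⊗ j)) ≡.refl j
    index : 4 ℕ.* tri j ℕ.+ (1 ℕ.+ 2 ℕ.* j) ℕ.* (1 ℕ.+ 2 ℕ.* j) ≡ 1 ℕ.+ 6 ℕ.* (j ℕ.* (j ℕ.+ 1))
    index = ≡.trans (≡.cong (ℕ._+ (1 ℕ.+ 2 ℕ.* j) ℕ.* (1 ℕ.+ 2 ℕ.* j)) (≡.trans (ℕ.*-assoc 2 2 (tri j)) (≡.cong (2 ℕ.*_) (2*tri j))))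
      (ℕS.solve 1 (λ j → κ 2 ⊗ (j ⊗ (j ⊕ κ 1)) ⊕ (κ 1 ⊕ κ 2 ⊗ j) ⊗ (κ 1 ⊕ κ 2 ⊗ j) ⊜ κ 1 ⊕ κ 6 ⊗ (j ⊗ (j ⊕ κ 1))) ≡.refl j)

-- Replacing q by q² and multiplying by 2q gives the part of `ω-term` odd in q.
odd-term : ℕ → PS
odd-term r = sgn r * (q^ (3 ℕ.* tri r ℕ.+ r) * geo⁺ (odd r))

odd-term-order : Terms odd-term
odd-term-order r = *-order′ (sgn r) (order-* (geo⁺ (odd r)) (q^-order≤ (ℕ.m≤n+m r (3 ℕ.* tri r))))

f₄-term : ℕ → PS
f₄-term j = Q4.χ j * Q4.σ₀ j * q^ (4 ℕ.* (j ℕ.* (j ℕ.+ 0))) * E4.ε j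

f₄-term-order : Terms f₄-term
f₄-term-order j = order-* (E4.ε j) (*-order′ (Q4.χ j * Q4.σ₀ j) (q^-order≤ (ℕ.≤-trans (n≤n*[n+s] j 0) (ℕ.m≤n*m _ 4))))

four-factors : Factors (λ j → geo⁻ (4 ℕ.* suc j))
four-factors j = geo⁻-mod (ℕ.m≤n*m (suc j) 4)

-- The 4 is the normalising constant of `E4.ε`. The extra factor 1/(1+q^(2r+1)) of `zero-factor`
-- cancels the numerator of `ratio`, which leaves the pure geometric series of `odd-term`. The
-- second side is the Lerch series of f(q⁴).
watson-odd : Π∞ δ * Π∞ (λ j → square (geo⁻ (4 ℕ.* suc j)))
  ≐ ι (+ 4) * (etaInv 2 * etaInv 2 * (q^ 1 * H * Σ∞ odd-term)) + etaInv 4 * etaInv 4 * (H * H * Σ∞ f₄-term)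
watson-odd = trans
  (TwoPole.two-pole Q4.weight₀ (ι (+ 4)) (Π∞ (λ j → square (geo⁻ (4 ℕ.* suc j)))) E4.ε zero-factor E4.partial z≤n
    E4.ε-expansion (Π<≈Π∞ (Factors-* four-factors four-factors)) E4.ε-inverse zero-limit)
  (+-cong (*-congˡ (*-congˡ (trans (Σ∞-cong first) (Σ∞-*ˡ (q^ 1 * H) odd-term-order))))
          (*-congˡ (trans (Σ∞-cong second) (Σ∞-*ˡ (H * H) f₄-term-order))))
  where
  first : ∀ r → Q2.χ r * Q2.σ₁ r * δ r * zero-factor r ≐ q^ 1 * H * odd-term r
  first r = begin
    Q2.χ r * Q2.σ₁ r * δ r * (q^ (tri r ℕ.+ suc r) * geo⁻ (odd r) * H)
      ≈⟨ solve 6 (λ a b c d e f → a :* b :* c :* (d :* e :* f) := (b :* c) :* e :* (f :* (a :* d))) refl _ _ _ _ _ _ ⟩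
    Q2.σ₁ r * δ r * geo⁻ (odd r) * (H * (Q2.χ r * q^ (tri r ℕ.+ suc r)))
      ≈⟨ *-cong (*-congʳ (δ-ratio r)) (*-congˡ (trans (*-congʳ (Q2.χ≐ r)) (trans (*-assoc _ _ _) (*-congˡ (trans (sym (q^-+ (2 ℕ.* tri r) _)) (trans (q^-≡ index) (q^-+ 1 _))))))) ⟩
    (1# + q^ odd r) * geo⁺ (odd r) * geo⁻ (odd r) * (H * (sgn r * (q^ 1 * q^ (3 ℕ.* tri r ℕ.+ r))))
      ≈⟨ solve 7 (λ y g k H s q a → y :* g :* k :* (H :* (s :* (q :* a))) := y :* k :* (q :* H :* (s :* (a :* g)))) refl _ _ _ _ _ _ _ ⟩
    (1# + q^ odd r) * geo⁻ (odd r) * (q^ 1 * H * odd-term r)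
      ≈⟨ trans (*-congʳ (geo⁻-inverse (s≤s z≤n))) (*-identityˡ _) ⟩
    q^ 1 * H * odd-term r ∎
    where
    open ≐-Reasoning
    index : 2 ℕ.* tri r ℕ.+ (tri r ℕ.+ suc r) ≡ 1 ℕ.+ (3 ℕ.* tri r ℕ.+ r)
    index = ℕS.solve 2 (λ t r → κ 2 ⊗ t ⊕ (t ⊕ (κ 1 ⊕ r)) ⊜ κ 1 ⊕ (κ 3 ⊗ t ⊕ r)) ≡.refl (tri r) r
  second : ∀ j → Q4.χ j * Q4.σ₀ j * E4.ε j * (q^ ((0 ℕ.+ 2 ℕ.* j) ℕ.* (0 ℕ.+ 2 ℕ.* j)) * (H * H)) ≐ H * H * f₄-term j
  second j = trans (*-congˡ (*-congʳ (q^-≡ (ℕS.solve 1 (λ j → (κ 0 ⊕ κ 2 ⊗ j) ⊗ (κ 0 ⊕ κ 2 ⊗ j) ⊜ κ 4 ⊗ (j ⊗ (j ⊕ κ 0))) ≡.refl j))))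
    (solve 5 (λ a b c d e → a :* b :* c :* (d :* e) := e :* (a :* b :* d :* c)) refl _ _ _ _ _)

-- Dilation q ↦ c q^k

private
  Σ-last : ∀ f n → (∀ i → i < n → f i ≡ + 0) → ℤΣ≤ f n ≡ f n
  Σ-last f zero    _ = ≡.refl
  Σ-last f (suc n) e = ≡.trans (≡.cong (ℤ._+ f (suc n))
    (≡.trans (ℤΣ.Σ-cong≤ n (λ i i≤n → e i (s≤s i≤n))) (ℤΣ.Σ-0 n))) (ℤ.+-identityˡ _)

  Σ-multiples : ∀ k f m → (∀ i → i % suc k ≢ 0 → f i ≡ + 0) →
    ℤΣ≤ f (m ℕ.* suc k) ≡ ℤΣ≤ (λ j → f (j ℕ.* suc k)) m
  Σ-multiples k f zero    _   = ≡.refl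
  Σ-multiples k f (suc m) off = begin
    ℤΣ≤ f (suc k ℕ.+ m ℕ.* suc k)
      ≡⟨ ≡.cong (ℤΣ≤ f) (ℕ.+-comm (suc k) (m ℕ.* suc k)) ⟩
    ℤΣ≤ f (m ℕ.* suc k ℕ.+ suc k)
      ≡⟨ ℤΣ.Σ-middle f (m ℕ.* suc k) k ⟩
    ℤΣ≤ f (m ℕ.* suc k) ℤ.+ ℤΣ≤ (λ l → f (m ℕ.* suc k ℕ.+ suc l)) k
      ≡⟨ ≡.cong₂ ℤ._+_ (Σ-multiples k f m off) (Σ-last (λ l → f (m ℕ.* suc k ℕ.+ suc l)) k between) ⟩
    ℤΣ≤ (λ j → f (j ℕ.* suc k)) m ℤ.+ f (m ℕ.* suc k ℕ.+ suc k)
      ≡⟨ ≡.cong (λ i → ℤΣ≤ (λ j → f (j ℕ.* suc k)) m ℤ.+ f i) (ℕ.+-comm (m ℕ.* suc k) (suc k)) ⟩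
    ℤΣ≤ (λ j → f (j ℕ.* suc k)) (suc m) ∎
    where
    open ≡.≡-Reasoning
    between : ∀ l → l < k → f (m ℕ.* suc k ℕ.+ suc l) ≡ + 0
    between l l<k = off _ (λ e → ℕ.1+n≢0 (≡.trans (≡.sym (≡.trans
      (≡.cong (_% suc k) (ℕ.+-comm (m ℕ.* suc k) (suc l)))
      (≡.trans ([m+kn]%n≡m%n (suc l) m (suc k)) (m<n⇒m%n≡m (s≤s l<k))))) e))

opaque
  δil : ℤ → (k : ℕ) → .{{NonZero k}} → PS → PS
  δil = dil

  dil≐ : ∀ c k .{{_ : NonZero k}} F → dil c k F ≐ δil c k F
  dil≐ c k F = refl

  δil-on : ∀ c k .{{_ : NonZero k}} F i → δil c k F (i ℕ.* k) ≡ c ℤ.^ i ℤ.* F i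
  δil-on c k {{k≢0}} F i rewrite m*n%n≡0 i k {{k≢0}} | m*n/n≡m i k {{k≢0}} = ≡.refl

  δil-off : ∀ c k .{{_ : NonZero k}} F n → n % k ≢ 0 → δil c k F n ≡ + 0
  δil-off c k F n n%k≢0 with n % k
  ... | zero  = contradiction ≡.refl n%k≢0
  ... | suc _ = ≡.refl

module Dilation (c : ℤ) (k′ : ℕ) where
  private
    k : ℕ
    k = suc k′

  D : PS → PS
  D = δil c k

  D-unique : ∀ {F G} → (∀ i → G (i ℕ.* k) ≡ c ℤ.^ i ℤ.* F i) → (∀ n → n % k ≢ 0 → G n ≡ + 0) → D F ≐ G
  D-unique {F} {G} on off = ptw coefficient
    where
    coefficient : ∀ n → D F n ≡ G n
    coefficient n with n % k ℕ.≟ 0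
    ... | no  n%k≢0 = ≡.trans (δil-off c k F n n%k≢0) (≡.sym (off n n%k≢0))
    ... | yes n%k≡0 = ≡.subst (λ n → D F n ≡ G n) (≡.sym n≡) (≡.trans (δil-on c k F (n / k)) (≡.sym (on (n / k))))
      where
      n≡ : n ≡ n / k ℕ.* k
      n≡ = ≡.trans (m≡m%n+[m/n]*n n k) (≡.cong (ℕ._+ n / k ℕ.* k) n%k≡0)

  D-cong : ∀ {F G} → F ≐ G → D F ≐ D G
  D-cong {F} {G} e = D-unique (λ i → ≡.trans (δil-on c k G i) (≡.cong (c ℤ.^ i ℤ.*_) (≡.sym (at e i)))) (δil-off c k G)

  -- Coefficient n of a dilated series involves at most coefficient n / k of the original. This
  -- continuity is what lets `D` pass through `Σ∞` and `Π∞`.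
  D-mod : ∀ {F G N} → F ≈[ N ] G → D F ≈[ N ] D G
  D-mod {F} {G} e = ptw coefficient
    where
    coefficient : ∀ n → n < _ → D F n ≡ D G n
    coefficient n n<N with n % k ℕ.≟ 0
    ... | no  n%k≢0 = ≡.trans (δil-off c k F n n%k≢0) (≡.sym (δil-off c k G n n%k≢0))
    ... | yes n%k≡0 = ≡.subst (λ n → D F n ≡ D G n) (≡.sym n≡) (≡.trans (δil-on c k F (n / k))
        (≡.trans (≡.cong (c ℤ.^ (n / k) ℤ.*_) (below e (n / k) (ℕ.≤-<-trans (m/n≤m n k) n<N))) (≡.sym (δil-on c k G (n / k)))))
      where
      n≡ : n ≡ n / k ℕ.* k
      n≡ = ≡.trans (m≡m%n+[m/n]*n n k) (≡.cong (ℕ._+ n / k ℕ.* k) n%k≡0)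

  D-+ : ∀ F G → D (F + G) ≐ D F + D G
  D-+ F G = D-unique
    (λ i → ≡.trans (⊞-at (D F) (D G) (i ℕ.* k)) (≡.trans (≡.cong₂ ℤ._+_ (δil-on c k F i) (δil-on c k G i))
      (≡.trans (≡.sym (ℤ.*-distribˡ-+ (c ℤ.^ i) (F i) (G i))) (≡.cong (c ℤ.^ i ℤ.*_) (≡.sym (⊞-at F G i))))))
    (λ n off → ≡.trans (⊞-at (D F) (D G) n) (≡.cong₂ ℤ._+_ (δil-off c k F n off) (δil-off c k G n off)))

  D-⊝ : ∀ F → D (⊝ F) ≐ ⊝ D F
  D-⊝ F = D-unique
    (λ i → ≡.trans (⊟-at (D F) (i ℕ.* k)) (≡.trans (≡.cong ℤ.-_ (δil-on c k F i))
      (≡.trans (ℤ.neg-distribʳ-* (c ℤ.^ i) (F i)) (≡.cong (c ℤ.^ i ℤ.*_) (≡.sym (⊟-at F i))))))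
    (λ n off → ≡.trans (⊟-at (D F) n) (≡.cong ℤ.-_ (δil-off c k F n off)))

  -- In the Cauchy sum at a multiple of k only multiples of k contribute, and the powers of c
  -- multiply to the right one. At any other n, k fails to divide i or n - i, so every term
  -- vanishes.
  D-* : ∀ F G → D (F * G) ≐ D F * D G
  D-* F G = D-unique on off
    where
    term : ℕ → ℕ → ℤ
    term n i = D F i ℤ.* D G (n ∸ i)
    on : ∀ m → (D F * D G) (m ℕ.* k) ≡ c ℤ.^ m ℤ.* (F * G) m
    on m = begin
      (D F * D G) (m ℕ.* k)
        ≡⟨ ⊛-at (D F) (D G) (m ℕ.* k) ⟩
      ℤΣ≤ (term (m ℕ.* k)) (m ℕ.* k)
        ≡⟨ Σ-multiples k′ (term (m ℕ.* k)) m (λ i i%k≢0 → ≡.cong (ℤ._* D G (m ℕ.* k ∸ i)) (δil-off c k F i i%k≢0)) ⟩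
      ℤΣ≤ (λ j → D F (j ℕ.* k) ℤ.* D G (m ℕ.* k ∸ j ℕ.* k)) m
        ≡⟨ ℤΣ.Σ-cong≤ m values ⟩
      ℤΣ≤ (λ j → c ℤ.^ m ℤ.* (F j ℤ.* G (m ∸ j))) m
        ≡⟨ ℤΣ.Σ-*ˡ (c ℤ.^ m) (λ j → F j ℤ.* G (m ∸ j)) m ⟩
      c ℤ.^ m ℤ.* ℤΣ≤ (λ j → F j ℤ.* G (m ∸ j)) m
        ≡⟨ ≡.cong (c ℤ.^ m ℤ.*_) (⊛-at F G m) ⟨
      c ℤ.^ m ℤ.* (F * G) m ∎
      where
      open ≡.≡-Reasoning
      values : ∀ j → j ≤ m → D F (j ℕ.* k) ℤ.* D G (m ℕ.* k ∸ j ℕ.* k) ≡ c ℤ.^ m ℤ.* (F j ℤ.* G (m ∸ j))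
      values j j≤m = begin
        D F (j ℕ.* k) ℤ.* D G (m ℕ.* k ∸ j ℕ.* k)
          ≡⟨ ≡.cong (λ i → D F (j ℕ.* k) ℤ.* D G i) (≡.sym (ℕ.*-distribʳ-∸ k m j)) ⟩
        D F (j ℕ.* k) ℤ.* D G ((m ∸ j) ℕ.* k)
          ≡⟨ ≡.cong₂ ℤ._*_ (δil-on c k F j) (δil-on c k G (m ∸ j)) ⟩
        (c ℤ.^ j ℤ.* F j) ℤ.* (c ℤ.^ (m ∸ j) ℤ.* G (m ∸ j))
          ≡⟨ ℤS.solve 4 (λ a f b g → (a ℤS.:* f) ℤS.:* (b ℤS.:* g) ℤS.:= (a ℤS.:* b) ℤS.:* (f ℤS.:* g)) ≡.refl (c ℤ.^ j) (F j) (c ℤ.^ (m ∸ j)) (G (m ∸ j)) ⟩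
        (c ℤ.^ j ℤ.* c ℤ.^ (m ∸ j)) ℤ.* (F j ℤ.* G (m ∸ j))
          ≡⟨ ≡.cong (ℤ._* (F j ℤ.* G (m ∸ j))) (≡.trans (≡.sym (ℤ.^-distribˡ-+-* c j (m ∸ j))) (≡.cong (c ℤ.^_) (ℕ.m+[n∸m]≡n j≤m))) ⟩
        c ℤ.^ m ℤ.* (F j ℤ.* G (m ∸ j)) ∎
    off : ∀ n → n % k ≢ 0 → (D F * D G) n ≡ + 0
    off n n%k≢0 = ≡.trans (⊛-at (D F) (D G) n) (≡.trans (ℤΣ.Σ-cong≤ n vanish) (ℤΣ.Σ-0 n))
      where
      vanish : ∀ i → i ≤ n → term n i ≡ + 0
      vanish i i≤n with i % k ℕ.≟ 0 | (n ∸ i) % k ℕ.≟ 0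
      ... | no  i%k≢0 | _ = ≡.cong (ℤ._* D G (n ∸ i)) (δil-off c k F i i%k≢0)
      ... | yes _     | no  n-i%k≢0 = ≡.trans (≡.cong (D F i ℤ.*_) (δil-off c k G (n ∸ i) n-i%k≢0)) (ℤ.*-zeroʳ (D F i))
      ... | yes i%k≡0 | yes n-i%k≡0 = contradiction
        (n∣m⇒m%n≡0 n k (≡.subst (k ∣_) (ℕ.m+[n∸m]≡n i≤n) (∣m∣n⇒∣m+n (m%n≡0⇒n∣m i k i%k≡0) (m%n≡0⇒n∣m (n ∸ i) k n-i%k≡0))))
        n%k≢0

  D-q^ : ∀ m → D (q^ m) ≐ (c ℤ.^ m) ·ₛ q^ (m ℕ.* k)
  D-q^ m = D-unique on (λ n off → ≡.trans (≡.cong (c ℤ.^ m ℤ.*_) (q^-≢ (λ { ≡.refl → off (m*n%n≡0 m k) }))) (ℤ.*-zeroʳ (c ℤ.^ m)))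
    where
    on : ∀ i → c ℤ.^ m ℤ.* (q^ (m ℕ.* k)) (i ℕ.* k) ≡ c ℤ.^ i ℤ.* (q^ m) i
    on i with i ℕ.≟ m
    ... | yes ≡.refl = ≡.cong (c ℤ.^ m ℤ.*_) (≡.trans (q^-refl (m ℕ.* k)) (≡.sym (q^-refl m)))
    ... | no  i≢m    = ≡.trans (≡.trans (≡.cong (c ℤ.^ m ℤ.*_) (q^-≢ (λ e → i≢m (ℕ.*-cancelʳ-≡ i m k e)))) (ℤ.*-zeroʳ (c ℤ.^ m)))
                         (≡.sym (≡.trans (≡.cong (c ℤ.^ i ℤ.*_) (q^-≢ i≢m)) (ℤ.*-zeroʳ (c ℤ.^ i))))

  D-1 : D 1# ≐ 1#
  D-1 = trans (D-cong (sym q^0)) (trans (D-q^ 0) (trans (ptw λ n → ℤ.*-identityˡ ((q^ 0) n)) q^0))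

  D-0 : D 0# ≐ 0#
  D-0 = D-unique (λ i → ≡.trans (𝟘-at (i ℕ.* k)) (≡.sym (≡.trans (≡.cong (c ℤ.^ i ℤ.*_) (𝟘-at i)) (ℤ.*-zeroʳ (c ℤ.^ i))))) (λ n _ → 𝟘-at n)

  D-Σ≤ : ∀ t n → D (Σ≤ t n) ≐ Σ≤ (D ∘ t) n
  D-Σ≤ t zero    = refl
  D-Σ≤ t (suc n) = trans (D-+ _ _) (+-congʳ (D-Σ≤ t n))

  D-Π< : ∀ t n → D (Π< t n) ≐ Π< (D ∘ t) n
  D-Π< t zero    = D-1
  D-Π< t (suc n) = trans (D-* _ _) (*-congʳ (D-Π< t n))

  D-Σ∞ : ∀ {t} → Terms t → D (Σ∞ t) ≐ Σ∞ (D ∘ t)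
  D-Σ∞ {t} small = sym (Σ∞-unique {D ∘ t} (λ n → Mod.trans (D-mod (small n)) (≐⇒≈ D-0))
    (λ n → Mod.trans (≐⇒≈ (sym (D-Σ≤ t n))) (D-mod (Σ≤≈Σ∞ {t} small n))))

  D-Π∞ : ∀ {t} → Factors t → D (Π∞ t) ≐ Π∞ (D ∘ t)
  D-Π∞ {t} small = sym (Π∞-unique {D ∘ t} (λ n → Mod.trans (D-mod (small n)) (≐⇒≈ D-1))
    (λ n → Mod.trans (≐⇒≈ (sym (D-Π< t n))) (D-mod (Π<≈Π∞ {t} small n))))

  D-sgn : ∀ r → D (sgn r) ≐ sgn r
  D-sgn zero    = D-1
  D-sgn (suc r) = trans (D-⊝ _) (-‿cong (D-sgn r))

  D-inverse : ∀ {F G F′ G′} → F * G ≐ 1# → D F ≐ F′ → F′ * G′ ≐ 1# → D G ≐ G′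
  D-inverse inv DF inv′ = inverse-unique (trans (*-congʳ (sym DF)) (trans (sym (D-* _ _)) (trans (D-cong inv) D-1))) inv′

module D⁺ (k′ : ℕ) where
  open Dilation (+ 1) k′ public
  private
    k : ℕ
    k = suc k′

  D-q : ∀ m → D (q^ m) ≐ q^ (k ℕ.* m)
  D-q m = trans (D-q^ m) (trans (ptw λ n → ≡.trans (≡.cong (ℤ._* (q^ (m ℕ.* k)) n) (ℤ.^-zeroˡ m)) (ℤ.*-identityˡ _)) (q^-≡ (ℕ.*-comm m k)))

  D-1-q : ∀ m → D (1# - q^ m) ≐ 1# - q^ (k ℕ.* m)
  D-1-q m = trans (D-+ _ _) (+-cong D-1 (trans (D-⊝ _) (-‿cong (D-q m))))

  D-1+q : ∀ m → D (1# + q^ m) ≐ 1# + q^ (k ℕ.* m)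
  D-1+q m = trans (D-+ _ _) (+-cong D-1 (D-q m))

  D-geo⁺ : ∀ {m} → 1 ≤ m → D (geo⁺ m) ≐ geo⁺ (k ℕ.* m)
  D-geo⁺ {m} 1≤m = D-inverse (geo⁺-inverse 1≤m) (D-1-q m) (geo⁺-inverse (ℕ.≤-trans 1≤m (ℕ.m≤n*m m k)))

  D-geo⁻ : ∀ {m} → 1 ≤ m → D (geo⁻ m) ≐ geo⁻ (k ℕ.* m)
  D-geo⁻ {m} 1≤m = D-inverse (geo⁻-inverse 1≤m) (D-1+q m) (geo⁻-inverse (ℕ.≤-trans 1≤m (ℕ.m≤n*m m k)))

  D-eta : ∀ m → 1 ≤ m → D (eta m) ≐ eta (k ℕ.* m)
  D-eta m 1≤m = trans (D-Π∞ (λ j → weaken (Base.m≤b*m m 1≤m (suc j)) (1-q^≈1 _)))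
    (Π∞-cong (λ j → trans (D-1-q (m ℕ.* suc j)) (+-congˡ (-‿cong (q^-≡ (≡.sym (ℕ.*-assoc k m (suc j))))))))

  D-etaInv : ∀ m (1≤m : 1 ≤ m) → D (etaInv m) ≐ etaInv (k ℕ.* m)
  D-etaInv m 1≤m = D-inverse (Base.eta-inverse m 1≤m) (D-eta m 1≤m) (Base.eta-inverse (k ℕ.* m) (ℕ.≤-trans 1≤m (ℕ.m≤n*m m k)))

module D⁻ (k′ : ℕ) where
  open Dilation (ℤ.- + 1) k′ public
  private
    k : ℕ
    k = suc k′

    scale : ∀ m F → ((ℤ.- + 1) ℤ.^ m) ·ₛ F ≐ sgn m * F
    scale zero    F = trans (ptw λ n → ℤ.*-identityˡ (F n)) (sym (*-identityˡ F))
    scale (suc m) F = trans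
      (ptw λ n → ≡.trans (ℤ.*-assoc (ℤ.- + 1) ((ℤ.- + 1) ℤ.^ m) (F n))
        (≡.trans (ℤ.-1*i≡-i _) (≡.trans (≡.cong ℤ.-_ (at (scale m F) n)) (≡.sym (⊟-at (sgn m * F) n)))))
      (solve 2 (λ s f → :- (s :* f) := (:- s) :* f) refl _ _)

  D-q : ∀ m → D (q^ m) ≐ sgn m * q^ (k ℕ.* m)
  D-q m = trans (D-q^ m) (trans (scale m _) (*-congˡ (q^-≡ (ℕ.*-comm m k))))

  sgn-2* : ∀ m → sgn (2 ℕ.* m) ≐ 1#
  sgn-2* zero    = refl
  sgn-2* (suc m) = trans (reflexive (≡.cong sgn (ℕ.*-suc 2 m))) (trans (solve 1 (λ s → :- :- s := s) refl _) (sgn-2* m))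

  D-q-even : ∀ m → D (q^ (2 ℕ.* m)) ≐ q^ (k ℕ.* (2 ℕ.* m))
  D-q-even m = trans (D-q (2 ℕ.* m)) (trans (*-congʳ (sgn-2* m)) (*-identityˡ _))

  D-q-odd : ∀ m → D (q^ odd m) ≐ ⊝ q^ (k ℕ.* odd m)
  D-q-odd m = trans (D-q (odd m)) (trans (*-congʳ (-‿cong (sgn-2* m))) (solve 1 (λ x → (:- con (+ 1)) :* x := :- x) refl _))

  D-geo⁺-odd : ∀ m → D (geo⁺ (odd m)) ≐ geo⁻ (k ℕ.* odd m)
  D-geo⁺-odd m = D-inverse (geo⁺-inverse (s≤s z≤n))
    (trans (D-+ _ _) (+-cong D-1 (trans (D-⊝ _) (trans (-‿cong (D-q-odd m)) (solve 1 (λ x → :- :- x := x) refl _)))))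
    (geo⁻-inverse (ℕ.≤-trans (s≤s z≤n) (ℕ.m≤n*m (odd m) k)))

  D-eta-even : D (eta 2) ≐ eta (k ℕ.* 2)
  D-eta-even = trans (D-Π∞ (λ j → weaken (ℕ.m≤n*m (suc j) 2) (1-q^≈1 _)))
    (Π∞-cong (λ j → trans (D-+ _ _) (+-cong D-1 (trans (D-⊝ _) (-‿cong (trans (D-q-even (suc j)) (q^-≡ (≡.sym (ℕ.*-assoc k 2 (suc j))))))))))

  D-etaInv-even : D (etaInv 2) ≐ etaInv (k ℕ.* 2)
  D-etaInv-even = D-inverse Q2.eta-inverse D-eta-even (Base.eta-inverse (k ℕ.* 2) (ℕ.≤-trans (s≤s (z≤n {1})) (ℕ.m≤n*m 2 k)))

parity : ∀ {F X Y} → F ≐ δil (+ 1) 2 X + q^ 1 * δil (+ 1) 2 Y → (∀ n → F (2 ℕ.* n) ≡ X n) × (∀ n → F (2 ℕ.* n ℕ.+ 1) ≡ Y n)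
parity {F} {X} {Y} e = even , odd′
  where
  on : ∀ G n → δil (+ 1) 2 G (2 ℕ.* n) ≡ G n
  on G n = ≡.trans (≡.cong (δil (+ 1) 2 G) (ℕ.*-comm 2 n)) (≡.trans (δil-on (+ 1) 2 G n)
    (≡.trans (≡.cong (ℤ._* G n) (ℤ.^-zeroˡ n)) (ℤ.*-identityˡ (G n))))
  off : ∀ G n → δil (+ 1) 2 G (2 ℕ.* n ℕ.+ 1) ≡ + 0
  off G n = δil-off (+ 1) 2 G _ (λ e → ℕ.1+n≢0 (≡.trans (≡.sym (≡.trans
    (≡.cong (_% 2) (≡.trans (ℕ.+-comm (2 ℕ.* n) 1) (≡.cong suc (ℕ.*-comm 2 n)))) ([m+kn]%n≡m%n 1 n 2))) e))
  even : ∀ n → F (2 ℕ.* n) ≡ X n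
  even n = ≡.trans (at e (2 ℕ.* n)) (≡.trans (⊞-at _ _ (2 ℕ.* n))
    (≡.trans (≡.cong₂ ℤ._+_ (on X n) (shifted n)) (ℤ.+-identityʳ (X n))))
    where
    shifted : ∀ n → (q^ 1 * δil (+ 1) 2 Y) (2 ℕ.* n) ≡ + 0
    shifted zero    = q^-⊛-< 1 (δil (+ 1) 2 Y) 0 (s≤s z≤n)
    shifted (suc n) = ≡.trans (q^-⊛-≥ 1 (δil (+ 1) 2 Y) (2 ℕ.* suc n) (s≤s z≤n))
      (≡.trans (≡.cong (δil (+ 1) 2 Y) (≡.trans (≡.cong (_∸ 1) (ℕ.*-suc 2 n)) (ℕ.+-comm 1 (2 ℕ.* n)))) (off Y n))
  odd′ : ∀ n → F (2 ℕ.* n ℕ.+ 1) ≡ Y n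
  odd′ n = ≡.trans (at e (2 ℕ.* n ℕ.+ 1)) (≡.trans (⊞-at _ _ (2 ℕ.* n ℕ.+ 1))
    (≡.trans (≡.cong₂ ℤ._+_ (off X n) shifted) (ℤ.+-identityˡ (Y n))))
    where
    shifted : (q^ 1 * δil (+ 1) 2 Y) (2 ℕ.* n ℕ.+ 1) ≡ Y n
    shifted = ≡.trans (q^-⊛-≥ 1 (δil (+ 1) 2 Y) (2 ℕ.* n ℕ.+ 1) (ℕ.m≤n+m 1 (2 ℕ.* n)))
      (≡.trans (≡.cong (δil (+ 1) 2 Y) (ℕ.m+n∸n≡m (2 ℕ.* n) 1)) (on Y n))

-- Dissection of ω and of ψ²

open SemiringExp semiring using (_^_; ^-congˡ)

module D₂ = D⁺ 1
module D₃ = D⁺ 2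
module D₄ = D⁺ 3
module D₋₂ = D⁻ 1

-- The sign c belongs to the inner dilation: F(c q^B) at q^A is F(c q^(AB)). With c in the outer
-- dilation the result would contain c^B instead.
D-compose : ∀ c a b F → δil (+ 1) (suc a) (δil c (suc b) F) ≐ δil c (suc b ℕ.* suc a) F
D-compose c a b F = sym (Dilation.D-unique c (a ℕ.+ b ℕ.* suc a) on off)
  where
  A B : ℕ
  A = suc a
  B = suc b
  G : PS
  G = δil (+ 1) A (δil c B F)
  outer : ∀ m → G (m ℕ.* A) ≡ δil c B F m
  outer m = ≡.trans (δil-on (+ 1) A (δil c B F) m) (≡.trans (≡.cong (ℤ._* δil c B F m) (ℤ.^-zeroˡ m)) (ℤ.*-identityˡ _))
  on : ∀ i → G (i ℕ.* (B ℕ.* A)) ≡ c ℤ.^ i ℤ.* F i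
  on i = ≡.trans (≡.cong G (≡.sym (ℕ.*-assoc i B A))) (≡.trans (outer (i ℕ.* B)) (δil-on c B F i))
  off : ∀ n → n % (B ℕ.* A) ≢ 0 → G n ≡ + 0
  off n n%≢0 with n % A ℕ.≟ 0
  ... | no  n%A≢0 = δil-off (+ 1) A (δil c B F) n n%A≢0
  ... | yes n%A≡0 = ≡.trans (≡.cong G n≡) (≡.trans (outer (n / A)) (δil-off c B F (n / A) m%B≢0))
    where
    n≡ : n ≡ n / A ℕ.* A
    n≡ = ≡.trans (m≡m%n+[m/n]*n n A) (≡.cong (ℕ._+ n / A ℕ.* A) n%A≡0)
    m%B≢0 : (n / A) % B ≢ 0
    m%B≢0 e = n%≢0 (≡.trans (≡.cong (_% (B ℕ.* A)) (≡.trans n≡ (≡.trans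
      (≡.cong (ℕ._* A) (≡.trans (m≡m%n+[m/n]*n (n / A) B) (≡.cong (ℕ._+ (n / A) / B ℕ.* B) e))) (ℕ.*-assoc ((n / A) / B) B A))))
      (m*n%n≡0 ((n / A) / B) (B ℕ.* A)))

D-2 : ∀ k F → δil (+ 1) (suc k) (ι (+ 2) * F) ≐ ι (+ 2) * δil (+ 1) (suc k) F
D-2 k F = trans (Dk.D-cong (solve 1 (λ f → con (+ 2) :* f := f :+ f) refl F))
  (trans (Dk.D-+ F F) (solve 1 (λ f → f :+ f := con (+ 2) :* f) refl _))
  where module Dk = D⁺ k

D-^ : ∀ k F n → δil (+ 1) (suc k) (F ^ n) ≐ δil (+ 1) (suc k) F ^ n
D-^ k F zero    = D⁺.D-1 k
D-^ k F (suc n) = trans (D⁺.D-* k _ _) (*-congˡ (D-^ k F n))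

f₁ f₂ f₄ f₈ e₁ e₂ e₄ e₈ : PS
f₁ = eta 1
f₂ = eta 2
f₄ = eta 4
f₈ = eta 8
e₁ = etaInv 1
e₂ = etaInv 2
e₄ = etaInv 4
e₈ = etaInv 8

fe₁ : f₁ * e₁ ≐ 1#
fe₁ = Q1.eta-inverse
fe₂ : f₂ * e₂ ≐ 1#
fe₂ = Q2.eta-inverse
fe₄ : f₄ * e₄ ≐ 1#
fe₄ = Q4.eta-inverse
fe₈ : f₈ * e₈ ≐ 1#
fe₈ = Base.eta-inverse 8 (s≤s z≤n)

module OddProducts (k : ℕ) (1≤k : 1 ≤ k) where
  G⁺ G⁻ : ℕ → PS
  G⁺ j = geo⁺ (k ℕ.* odd j)
  G⁻ j = geo⁻ (k ℕ.* odd j)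

  private
    1+j≤ : ∀ j → suc j ≤ k ℕ.* odd j
    1+j≤ j = ℕ.≤-trans (s≤s (ℕ.m≤n*m j 2)) (Base.m≤b*m k 1≤k (odd j))

    k≤ : ∀ m → suc m ≤ k ℕ.* suc m
    k≤ m = Base.m≤b*m k 1≤k (suc m)

    2k≤ : ∀ m → suc m ≤ 2 ℕ.* k ℕ.* suc m
    2k≤ m = Base.m≤b*m (2 ℕ.* k) (ℕ.≤-trans 1≤k (ℕ.m≤n*m k 2)) (suc m)

    G⁺-factors : Factors G⁺
    G⁺-factors j = weaken (1+j≤ j) (geo⁺≈1 (ℕ.≤-trans (s≤s z≤n) (1+j≤ j)))

  G⁻-factors : Factors G⁻
  G⁻-factors j = geo⁻-mod (1+j≤ j)

  split : etaInv k ≐ Π∞ G⁺ * etaInv (2 ℕ.* k)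
  split = trans (sym (Π∞-2* (λ j → weaken (k≤ j) (geo⁺≈1 (ℕ.≤-trans (s≤s z≤n) (k≤ j))))))
    (trans (Π∞-cong (λ j → *-congˡ (reflexive (≡.cong geo⁺ (index j)))))
      (Π∞-* G⁺-factors (λ j → weaken (2k≤ j) (geo⁺≈1 (ℕ.≤-trans (s≤s z≤n) (2k≤ j))))))
    where
    index : ∀ j → k ℕ.* suc (suc (2 ℕ.* j)) ≡ 2 ℕ.* k ℕ.* suc j
    index j = ℕS.solve 2 (λ k j → k ⊗ (κ 2 ⊕ κ 2 ⊗ j) ⊜ κ 2 ⊗ k ⊗ (κ 1 ⊕ j)) ≡.refl k j

  G⁺≐ : Π∞ G⁺ ≐ etaInv k * eta (2 ℕ.* k)
  G⁺≐ = sym (trans (*-congʳ split) (trans (solve 3 (λ a b c → a :* b :* c := a :* (c :* b)) refl _ _ _)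
    (trans (*-congˡ (Base.eta-inverse (2 ℕ.* k) (ℕ.≤-trans 1≤k (ℕ.m≤n*m k 2)))) (*-identityʳ _))))

  G⁻G⁺ : Π∞ G⁻ * Π∞ G⁺ ≐ Π∞ (λ j → geo⁺ (2 ℕ.* k ℕ.* odd j))
  G⁻G⁺ = trans (sym (Π∞-* G⁻-factors G⁺-factors)) (Π∞-cong term)
    where
    term : ∀ j → G⁻ j * G⁺ j ≐ geo⁺ (2 ℕ.* k ℕ.* odd j)
    term j = inverse-unique {1# - q^ (2 ℕ.* k ℕ.* odd j)}
      (trans (*-congʳ (+-congˡ (-‿cong (trans (q^-≡ index) (q^-+ m m)))))
        (trans (solve 3 (λ x a b → (con (+ 1) :- x :* x) :* (a :* b) := ((con (+ 1) :+ x) :* a) :* ((con (+ 1) :- x) :* b)) refl _ _ _)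
          (trans (*-cong (geo⁻-inverse pos) (geo⁺-inverse pos)) (*-identityˡ 1#))))
      (geo⁺-inverse (ℕ.≤-trans pos (ℕ.≤-trans (ℕ.m≤n*m m 2) (ℕ.≤-reflexive (≡.sym (ℕ.*-assoc 2 k (odd j)))))))
      where
      m : ℕ
      m = k ℕ.* odd j
      pos : 1 ≤ m
      pos = ℕ.≤-trans (s≤s z≤n) (1+j≤ j)
      index : 2 ℕ.* k ℕ.* odd j ≡ m ℕ.+ m
      index = ℕS.solve 2 (λ k o → κ 2 ⊗ k ⊗ o ⊜ k ⊗ o ⊕ k ⊗ o) ≡.refl k (odd j)

-- (- q^k; q^(2k))_∞ = f_(2k)² / (f_k f_(4k))
odd-plus-product : ∀ k (1≤k : 1 ≤ k) →
  Π∞ (λ j → geo⁻ (k ℕ.* odd j)) ≐ eta k * eta (2 ℕ.* (2 ℕ.* k)) * (etaInv (2 ℕ.* k) * etaInv (2 ℕ.* k))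
odd-plus-product k 1≤k = unit-cancel {Π∞ O.G⁺} {f * e′}
  (trans (*-congʳ O.G⁺≐) (trans (solve 4 (λ a b c d → a :* b :* (c :* d) := (c :* a) :* (b :* d)) refl _ _ _ _)
    (trans (*-cong fe f′e′) (*-identityˡ 1#))))
  (begin
    Π∞ O.G⁺ * Π∞ O.G⁻
      ≈⟨ trans (*-comm _ _) (trans O.G⁻G⁺ O′.G⁺≐) ⟩
    e′ * f″
      ≈⟨ sym (trans (*-congʳ (trans (*-cong fe f′e′) (*-identityˡ 1#))) (*-identityˡ _)) ⟩
    f * e * (f′ * e′) * (e′ * f″)
      ≈⟨ solve 5 (λ f e f′ e′ f″ → f :* e :* (f′ :* e′) :* (e′ :* f″) := e :* f′ :* (f :* f″ :* (e′ :* e′))) refl f e f′ e′ f″ ⟩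
    e * f′ * (f * f″ * (e′ * e′))
      ≈⟨ *-congʳ (sym O.G⁺≐) ⟩
    Π∞ O.G⁺ * (f * f″ * (e′ * e′)) ∎)
  where
  open ≐-Reasoning
  1≤2k : 1 ≤ 2 ℕ.* k
  1≤2k = ℕ.≤-trans 1≤k (ℕ.m≤n*m k 2)
  module O = OddProducts k 1≤k
  module O′ = OddProducts (2 ℕ.* k) 1≤2k
  f e f′ e′ f″ : PS
  f = eta k
  e = etaInv k
  f′ = eta (2 ℕ.* k)
  e′ = etaInv (2 ℕ.* k)
  f″ = eta (2 ℕ.* (2 ℕ.* k))
  fe : f * e ≐ 1#
  fe = Base.eta-inverse k 1≤k
  f′e′ : f′ * e′ ≐ 1#
  f′e′ = Base.eta-inverse (2 ℕ.* k) 1≤2k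

1*odd : ∀ (g : ℕ → PS) j → g (1 ℕ.* odd j) ≐ g (odd j)
1*odd g j = reflexive (≡.cong g (ℕ.*-identityˡ (odd j)))

two≡ : ∀ j → 2 ℕ.* odd j ≡ two j
two≡ = ℕS.solve 1 (λ j → κ 2 ⊗ (κ 1 ⊕ κ 2 ⊗ j) ⊜ κ 2 ⊕ κ 4 ⊗ j) ≡.refl

H≐ : H ≐ f₁ * f₄ * (e₂ * e₂)
H≐ = trans (Π∞-cong (λ j → sym (1*odd geo⁻ j))) (odd-plus-product 1 (s≤s z≤n))

δ≐ : Π∞ δ ≐ square (e₁ * f₂)
δ≐ = trans (Π∞-* odd-factors odd-factors) (*-cong G≐ G≐)
  where
  G≐ : Π∞ (geo⁺ ∘ odd) ≐ e₁ * f₂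
  G≐ = trans (Π∞-cong (λ j → sym (1*odd geo⁺ j))) (OddProducts.G⁺≐ 1 (s≤s z≤n))

two-product : Π∞ (geo⁻ ∘ two) ≐ f₂ * f₈ * (e₄ * e₄)
two-product = trans (Π∞-cong (λ j → reflexive (≡.cong geo⁻ (≡.sym (two≡ j))))) (odd-plus-product 2 (s≤s z≤n))

four-product : Π∞ (λ j → geo⁻ (4 ℕ.* suc j)) ≐ e₈ * f₄
four-product = begin
  P                  ≈⟨ sym (*-identityʳ P) ⟩
  P * 1#             ≈⟨ *-congˡ (sym (trans (*-comm _ _) fe₄)) ⟩
  P * (e₄ * f₄)      ≈⟨ sym (*-assoc _ _ _) ⟩
  P * e₄ * f₄        ≈⟨ *-congʳ (trans (sym (Π∞-* four-factors factors⁺)) (Π∞-cong term)) ⟩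
  e₈ * f₄            ∎
  where
  open ≐-Reasoning
  P : PS
  P = Π∞ (λ j → geo⁻ (4 ℕ.* suc j))
  factors⁺ : Factors (λ j → geo⁺ (4 ℕ.* suc j))
  factors⁺ j = weaken (ℕ.m≤n*m (suc j) 4) (geo⁺≈1 (s≤s z≤n))
  term : ∀ j → geo⁻ (4 ℕ.* suc j) * geo⁺ (4 ℕ.* suc j) ≐ geo⁺ (8 ℕ.* suc j)
  term j = inverse-unique {1# - q^ (8 ℕ.* suc j)}
    (trans (*-congʳ (+-congˡ (-‿cong (trans (q^-≡ (ℕ.*-distribʳ-+ (suc j) 4 4)) (q^-+ (4 ℕ.* suc j) (4 ℕ.* suc j))))))
      (trans (solve 3 (λ x a b → (con (+ 1) :- x :* x) :* (a :* b) := ((con (+ 1) :+ x) :* a) :* ((con (+ 1) :- x) :* b)) refl _ _ _)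
        (trans (*-cong (geo⁻-inverse (s≤s z≤n)) (geo⁺-inverse (s≤s z≤n))) (*-identityˡ 1#))))
    (geo⁺-inverse (s≤s z≤n))

W₀ W₁ : PS
W₀ = e₁ * Σ∞ even-term
W₁ = ι (+ 2) * (e₁ * Σ∞ odd-term)

ones³ : ∀ {a b c} → a ≐ 1# → b ≐ 1# → c ≐ 1# → ∀ x → a * b * c * x ≐ x
ones³ {a} {b} {c} p q r x = trans (*-congʳ (trans (*-cong (trans (*-cong p q) (*-identityˡ 1#)) r) (*-identityˡ 1#))) (*-identityˡ x)

restore : ∀ {f e} → f * e ≐ 1# → ∀ x → x ≐ f * (e * x)
restore inv x = trans (sym (*-identityˡ x)) (trans (*-congʳ (sym inv)) (*-assoc _ _ _))

^-one : ∀ {x} n → x ≐ 1# → x ^ n ≐ 1#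
^-one zero    _ = refl
^-one (suc n) e = trans (*-cong e (^-one n e)) (*-identityˡ 1#)

private
  Ω F₄ : PS
  Ω = e₄ * Σ∞ ω⁻-term
  F₄ = e₄ * Σ∞ f₄-term

  -- Once H = f₁ f₄/f₂² is inserted and f₄/f₄ is cancelled, every term on the right of `watson-even`
  -- and `watson-odd` contains this factor f₁² f₄/f₂⁴. Removing it solves the two relations for W₀
  -- and W₁.
  U U⁻¹ : PS
  U = e₂ ^ 4 * f₁ ^ 2 * f₄
  U⁻¹ = f₂ ^ 4 * e₁ ^ 2 * e₄

  U-inverse : U * U⁻¹ ≐ 1#
  U-inverse = trans (solve 6 (λ e₂ f₁ f₄ f₂ e₁ e₄ → e₂ :^ 4 :* f₁ :^ 2 :* f₄ :* (f₂ :^ 4 :* e₁ :^ 2 :* e₄)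
      := (f₂ :* e₂) :^ 4 :* (f₁ :* e₁) :^ 2 :* (f₄ :* e₄) :* con (+ 1)) refl e₂ f₁ f₄ f₂ e₁ e₄)
    (ones³ (^-one 4 fe₂) (^-one 2 fe₁) fe₄ 1#)

W₀-product : W₀ ≐ f₂ ^ 8 * f₈ ^ 2 * e₁ ^ 4 * e₄ ^ 5 - q^ 1 * Ω
W₀-product = unit-cancel U-inverse (begin
  U * W₀
    ≈⟨ solve 8 (λ e₂ f₁ f₄ w e₄ q o k → e₂ :^ 4 :* f₁ :^ 2 :* f₄ :* w
         := e₂ :* e₂ :* (f₁ :* f₄ :* (e₂ :* e₂) :* (f₁ :* w)) :+ e₄ :* e₄ :* (q :* k :* (f₄ :* o)) :- e₄ :* e₄ :* (q :* k :* (f₄ :* o)))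
         refl e₂ f₁ f₄ W₀ e₄ (q^ 1) Ω (H * H) ⟩
  e₂ * e₂ * (f₁ * f₄ * (e₂ * e₂) * (f₁ * W₀)) + e₄ * e₄ * (q^ 1 * (H * H) * (f₄ * Ω)) - e₄ * e₄ * (q^ 1 * (H * H) * (f₄ * Ω))
    ≈⟨ +-cong (sym (trans watson-even (+-cong (*-congˡ (*-cong H≐ (restore fe₁ _))) (*-congˡ (*-congˡ (restore fe₄ _))))))
              (-‿cong (*-congˡ (*-congʳ (*-congˡ (*-cong H≐ H≐))))) ⟩
  Π∞ δ * Π∞ ε₂ - e₄ * e₄ * (q^ 1 * (f₁ * f₄ * (e₂ * e₂) * (f₁ * f₄ * (e₂ * e₂))) * (f₄ * Ω))
    ≈⟨ +-cong (*-cong δ≐ (trans (Π∞-* two-factors two-factors) (*-cong two-product two-product))) refl ⟩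
  square (e₁ * f₂) * square (f₂ * f₈ * (e₄ * e₄)) - e₄ * e₄ * (q^ 1 * (f₁ * f₄ * (e₂ * e₂) * (f₁ * f₄ * (e₂ * e₂))) * (f₄ * Ω))
    ≈⟨ +-cong (sym (ones³ (^-one 4 fe₂) (^-one 2 fe₁) fe₄ _)) (-‿cong (trans
         (solve 6 (λ e₄ q f₁ f₄ e₂ o → e₄ :* e₄ :* (q :* (f₁ :* f₄ :* (e₂ :* e₂) :* (f₁ :* f₄ :* (e₂ :* e₂))) :* (f₄ :* o))
           := (f₄ :* e₄) :^ 2 :* (e₂ :^ 4 :* f₁ :^ 2 :* f₄ :* (q :* o))) refl e₄ (q^ 1) f₁ f₄ e₂ Ω)
         (trans (*-congʳ (^-one 2 fe₄)) (*-identityˡ _)))) ⟩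
  (f₂ * e₂) ^ 4 * (f₁ * e₁) ^ 2 * (f₄ * e₄) * (square (e₁ * f₂) * square (f₂ * f₈ * (e₄ * e₄))) - U * (q^ 1 * Ω)
    ≈⟨ solve 9 (λ f₂ e₂ f₁ e₁ f₄ e₄ f₈ q o →
         (f₂ :* e₂) :^ 4 :* (f₁ :* e₁) :^ 2 :* (f₄ :* e₄) :* ((e₁ :* f₂) :* (e₁ :* f₂) :* (f₂ :* f₈ :* (e₄ :* e₄) :* (f₂ :* f₈ :* (e₄ :* e₄))))
           :- e₂ :^ 4 :* f₁ :^ 2 :* f₄ :* (q :* o)
         := e₂ :^ 4 :* f₁ :^ 2 :* f₄ :* (f₂ :^ 8 :* f₈ :^ 2 :* e₁ :^ 4 :* e₄ :^ 5 :- q :* o)) refl f₂ e₂ f₁ e₁ f₄ e₄ f₈ (q^ 1) Ω ⟩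
  U * (f₂ ^ 8 * f₈ ^ 2 * e₁ ^ 4 * e₄ ^ 5 - q^ 1 * Ω) ∎)
  where open ≐-Reasoning

W₁-product : ι (+ 2) * (q^ 1 * W₁) ≐ f₂ ^ 6 * f₄ * e₁ ^ 4 * e₈ ^ 2 - F₄
W₁-product = unit-cancel U-inverse (begin
  U * (ι (+ 2) * (q^ 1 * (ι (+ 2) * (e₁ * S))))
    ≈⟨ solve 9 (λ e₂ f₁ f₄ s q e₁ e₄ o k → e₂ :^ 4 :* f₁ :^ 2 :* f₄ :* (con (+ 2) :* (q :* (con (+ 2) :* (e₁ :* s))))
         := con (+ 4) :* (e₂ :* e₂ :* (q :* (f₁ :* f₄ :* (e₂ :* e₂)) :* (f₁ :* (e₁ :* s)))) :+ e₄ :* e₄ :* (k :* (f₄ :* o)) :- e₄ :* e₄ :* (k :* (f₄ :* o)))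
         refl e₂ f₁ f₄ S (q^ 1) e₁ e₄ F₄ (H * H) ⟩
  ι (+ 4) * (e₂ * e₂ * (q^ 1 * (f₁ * f₄ * (e₂ * e₂)) * (f₁ * (e₁ * S)))) + e₄ * e₄ * (H * H * (f₄ * F₄)) - e₄ * e₄ * (H * H * (f₄ * F₄))
    ≈⟨ +-cong (sym (trans watson-odd (+-cong (*-congˡ (*-congˡ (*-cong (*-congˡ H≐) (restore fe₁ _)))) (*-congˡ (*-congˡ (restore fe₄ _))))))
              (-‿cong (*-congˡ (*-congʳ (*-cong H≐ H≐)))) ⟩
  Π∞ δ * Π∞ (λ j → square (geo⁻ (4 ℕ.* suc j))) - e₄ * e₄ * (f₁ * f₄ * (e₂ * e₂) * (f₁ * f₄ * (e₂ * e₂)) * (f₄ * F₄))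
    ≈⟨ +-cong (*-cong δ≐ (trans (Π∞-* four-factors four-factors) (*-cong four-product four-product))) refl ⟩
  square (e₁ * f₂) * square (e₈ * f₄) - e₄ * e₄ * (f₁ * f₄ * (e₂ * e₂) * (f₁ * f₄ * (e₂ * e₂)) * (f₄ * F₄))
    ≈⟨ +-cong (sym (trans (*-congʳ (trans (*-cong (^-one 4 fe₂) (^-one 2 fe₁)) (*-identityˡ 1#))) (*-identityˡ _))) (-‿cong (trans
         (solve 5 (λ e₄ f₁ f₄ e₂ o → e₄ :* e₄ :* (f₁ :* f₄ :* (e₂ :* e₂) :* (f₁ :* f₄ :* (e₂ :* e₂)) :* (f₄ :* o))
           := (f₄ :* e₄) :^ 2 :* (e₂ :^ 4 :* f₁ :^ 2 :* f₄ :* o)) refl e₄ f₁ f₄ e₂ F₄)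
         (trans (*-congʳ (^-one 2 fe₄)) (*-identityˡ _)))) ⟩
  (f₂ * e₂) ^ 4 * (f₁ * e₁) ^ 2 * (square (e₁ * f₂) * square (e₈ * f₄)) - U * F₄
    ≈⟨ solve 7 (λ f₂ e₂ f₁ e₁ f₄ e₈ o →
         (f₂ :* e₂) :^ 4 :* (f₁ :* e₁) :^ 2 :* ((e₁ :* f₂) :* (e₁ :* f₂) :* ((e₈ :* f₄) :* (e₈ :* f₄)))
           :- e₂ :^ 4 :* f₁ :^ 2 :* f₄ :* o
         := e₂ :^ 4 :* f₁ :^ 2 :* f₄ :* (f₂ :^ 6 :* f₄ :* e₁ :^ 4 :* e₈ :^ 2 :- o)) refl f₂ e₂ f₁ e₁ f₄ e₈ F₄ ⟩
  U * (f₂ ^ 6 * f₄ * e₁ ^ 4 * e₈ ^ 2 - F₄) ∎)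
  where
  open ≐-Reasoning
  S : PS
  S = Σ∞ odd-term

ω-term-order : Terms ω-term
ω-term-order r = *-order′ (sgn r) (order-* (ratio (odd r)) (q^-order≤ (ℕ.≤-trans (n≤n*[n+s] r 1) (ℕ.m≤n*m _ 3))))

ratio-dilation : ∀ k m → 1 ≤ m → δil (+ 1) (suc k) (ratio m) ≐ ratio (suc k ℕ.* m)
ratio-dilation k m 1≤m = trans (D⁺.D-* k _ _) (*-cong (D⁺.D-1+q k m) (D⁺.D-geo⁺ k 1≤m))

ω-dilated : δil (+ 1) 3 ω ≐ etaInv 6 * Σ∞ ω₃-term
ω-dilated = trans (D₃.D-cong ω≐) (trans (D₃.D-* _ _) (*-cong (D₃.D-etaInv 2 (s≤s z≤n))
  (trans (D₃.D-Σ∞ ω-term-order) (Σ∞-cong term))))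
  where
  term : ∀ r → δil (+ 1) 3 (ω-term r) ≐ ω₃-term r
  term r = trans (D₃.D-* _ _) (*-cong (D₃.D-sgn r) (trans (D₃.D-* _ _) (*-cong
    (trans (D₃.D-q _) (q^-≡ (≡.sym (ℕ.*-assoc 3 3 (r ℕ.* (r ℕ.+ 1))))))
    (ratio-dilation 2 (odd r) (s≤s z≤n)))))

ω-at-minus-q² : δil (ℤ.- + 1) 2 ω ≐ e₄ * Σ∞ ω⁻-term
ω-at-minus-q² = trans (D₋₂.D-cong ω≐) (trans (D₋₂.D-* _ _) (*-cong D₋₂.D-etaInv-even
  (trans (D₋₂.D-Σ∞ ω-term-order) (Σ∞-cong term))))
  where
  term : ∀ r → δil (ℤ.- + 1) 2 (ω-term r) ≐ ω⁻-term r
  term r = trans (D₋₂.D-* _ _) (*-cong (D₋₂.D-sgn r) (trans (D₋₂.D-* _ _) (*-cong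
      (trans (D₋₂.D-cong (q^-≡ even)) (trans (D₋₂.D-q-even (3 ℕ.* tri r)) (q^-≡ index)))
      (trans (D₋₂.D-* _ _) (*-cong
        (trans (D₋₂.D-+ _ _) (+-cong D₋₂.D-1 (trans (D₋₂.D-q-odd r) (-‿cong (q^-≡ (two≡ r))))))
        (trans (D₋₂.D-geo⁺-odd r) (reflexive (≡.cong geo⁻ (two≡ r)))))))))
    where
    even : 3 ℕ.* (r ℕ.* (r ℕ.+ 1)) ≡ 2 ℕ.* (3 ℕ.* tri r)
    even = ≡.trans (≡.cong (3 ℕ.*_) (≡.sym (2*tri r))) (ℕS.solve 1 (λ t → κ 3 ⊗ (κ 2 ⊗ t) ⊜ κ 2 ⊗ (κ 3 ⊗ t)) ≡.refl (tri r))
    index : 2 ℕ.* (2 ℕ.* (3 ℕ.* tri r)) ≡ 6 ℕ.* (r ℕ.* (r ℕ.+ 1))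
    index = ≡.trans (ℕS.solve 1 (λ t → κ 2 ⊗ (κ 2 ⊗ (κ 3 ⊗ t)) ⊜ κ 6 ⊗ (κ 2 ⊗ t)) ≡.refl (tri r)) (≡.cong (6 ℕ.*_) (2*tri r))

fmock-dilated : δil (+ 1) 4 fmock ≐ e₄ * Σ∞ f₄-term
fmock-dilated = trans (D₄.D-cong fmock-lerch) (trans (D₄.D-* _ _) (*-cong (D₄.D-etaInv 1 (s≤s z≤n))
  (trans (D₄.D-Σ∞ order) (Σ∞-cong term))))
  where
  order : Terms (λ r → Q1.χ r * Q1.σ₀ r * q^ (1 ℕ.* (r ℕ.* (r ℕ.+ 0))) * E1.ε r)
  order r = order-* (E1.ε r) (*-order′ (Q1.χ r * Q1.σ₀ r) (q^-order≤ (ℕ.≤-trans (n≤n*[n+s] r 0) (ℕ.m≤n*m _ 1))))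
  pw : ∀ m → δil (+ 1) 4 (q^ (1 ℕ.* m)) ≐ q^ (4 ℕ.* m)
  pw m = trans (D₄.D-q _) (q^-≡ (≡.cong (4 ℕ.*_) (ℕ.*-identityˡ m)))
  χ : ∀ r → δil (+ 1) 4 (Q1.χ r) ≐ Q4.χ r
  χ zero    = D₄.D-1
  χ (suc r) = trans (D₄.D-⊝ _) (-‿cong (trans (D₄.D-* _ _) (*-cong (χ r) (pw (suc r)))))
  σ : ∀ r → δil (+ 1) 4 (Q1.σ₀ r) ≐ Q4.σ₀ r
  σ zero    = D₄.D-1
  σ (suc r) = trans (D₄.D-+ _ _) (+-cong D₄.D-1 (pw (suc r)))
  ε : ∀ r → δil (+ 1) 4 (E1.ε r) ≐ E4.ε r
  ε zero    = D₄.D-1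
  ε (suc r) = trans (D₄.D-* _ _) (*-cong four (trans (D₄.D-* _ _) (*-cong g g)))
    where
    four : δil (+ 1) 4 (ι (+ 4)) ≐ ι (+ 4)
    four = trans (D₄.D-cong (solve 0 (con (+ 4) := con (+ 2) :* (con (+ 2) :* con (+ 1))) refl))
      (trans (D-2 3 _) (trans (*-congˡ (trans (D-2 3 _) (*-congˡ D₄.D-1))) (solve 0 (con (+ 2) :* (con (+ 2) :* con (+ 1)) := con (+ 4)) refl)))
    g : δil (+ 1) 4 (geo⁻ (1 ℕ.* suc r)) ≐ geo⁻ (4 ℕ.* suc r)
    g = trans (D₄.D-geo⁻ (s≤s z≤n)) (reflexive (≡.cong (λ m → geo⁻ (4 ℕ.* m)) (ℕ.*-identityˡ (suc r))))
  term : ∀ r → δil (+ 1) 4 (Q1.χ r * Q1.σ₀ r * q^ (1 ℕ.* (r ℕ.* (r ℕ.+ 0))) * E1.ε r) ≐ f₄-term r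
  term r = trans (D₄.D-* _ _) (*-cong (trans (D₄.D-* _ _) (*-cong (trans (D₄.D-* _ _) (*-cong (χ r) (σ r))) (pw _))) (ε r))

ω-bisection : ω ≐ δil (+ 1) 2 W₀ + q^ 1 * δil (+ 1) 2 W₁
ω-bisection = begin
  ω
    ≈⟨ trans ω≐ (*-congˡ (Σ∞-cong term)) ⟩
  e₂ * Σ∞ (λ r → δil (+ 1) 2 (even-term r) + ι (+ 2) * q^ 1 * δil (+ 1) 2 (odd-term r))
    ≈⟨ *-congˡ (trans (Σ∞-+ _ _) (+-congˡ (Σ∞-*ˡ (ι (+ 2) * q^ 1) odd-order))) ⟩
  e₂ * (Σ∞ (λ r → δil (+ 1) 2 (even-term r)) + ι (+ 2) * q^ 1 * Σ∞ (λ r → δil (+ 1) 2 (odd-term r)))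
    ≈⟨ *-congˡ (+-cong (sym (D₂.D-Σ∞ even-term-order)) (*-congˡ (sym (D₂.D-Σ∞ odd-term-order)))) ⟩
  e₂ * (δil (+ 1) 2 (Σ∞ even-term) + ι (+ 2) * q^ 1 * δil (+ 1) 2 (Σ∞ odd-term))
    ≈⟨ solve 4 (λ e a q b → e :* (a :+ con (+ 2) :* q :* b) := e :* a :+ q :* (con (+ 2) :* (e :* b))) refl e₂ _ (q^ 1) _ ⟩
  e₂ * δil (+ 1) 2 (Σ∞ even-term) + q^ 1 * (ι (+ 2) * (e₂ * δil (+ 1) 2 (Σ∞ odd-term)))
    ≈⟨ +-cong (collect even-term) (*-congˡ (trans (*-congˡ (collect odd-term)) (sym (D-2 1 _)))) ⟩
  δil (+ 1) 2 W₀ + q^ 1 * δil (+ 1) 2 W₁ ∎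
  where
  open ≐-Reasoning
  collect : ∀ t → e₂ * δil (+ 1) 2 (Σ∞ t) ≐ δil (+ 1) 2 (e₁ * Σ∞ t)
  collect t = sym (trans (D₂.D-* _ _) (*-congʳ (D₂.D-etaInv 1 (s≤s z≤n))))
  odd-order : Terms (λ r → δil (+ 1) 2 (odd-term r))
  odd-order r = Mod.trans (D₂.D-mod (odd-term-order r)) (≐⇒≈ D₂.D-0)
  -- (1 + y)/(1 - y) = (1 + y²)/(1 - y²) + 2 y/(1 - y²)
  ratio-split : ∀ m → 1 ≤ m → ratio m ≐ ratio (2 ℕ.* m) + ι (+ 2) * q^ m * geo⁺ (2 ℕ.* m)
  ratio-split m 1≤m = begin
    (1# + y) * g
      ≈⟨ sym (*-identityʳ _) ⟩
    (1# + y) * g * 1#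
      ≈⟨ *-congˡ (sym (geo⁺-inverse (ℕ.≤-trans 1≤m (ℕ.m≤n*m m 2)))) ⟩
    (1# + y) * g * ((1# - q^ (2 ℕ.* m)) * G)
      ≈⟨ *-congˡ (*-congʳ (+-congˡ (-‿cong y²))) ⟩
    (1# + y) * g * ((1# - y * y) * G)
      ≈⟨ solve 3 (λ y g G → (con (+ 1) :+ y) :* g :* ((con (+ 1) :- y :* y) :* G)
           := ((con (+ 1) :- y) :* g) :* ((con (+ 1) :+ y :* y) :* G :+ con (+ 2) :* y :* G)) refl y g G ⟩
    (1# - y) * g * ((1# + y * y) * G + ι (+ 2) * y * G)
      ≈⟨ trans (*-congʳ (geo⁺-inverse 1≤m)) (*-identityˡ _) ⟩
    (1# + y * y) * G + ι (+ 2) * y * G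
      ≈⟨ +-congʳ (*-congʳ (+-congˡ (sym y²))) ⟩
    ratio (2 ℕ.* m) + ι (+ 2) * y * G ∎
    where
    y g G : PS
    y = q^ m
    g = geo⁺ m
    G = geo⁺ (2 ℕ.* m)
    y² : q^ (2 ℕ.* m) ≐ y * y
    y² = trans (q^-≡ (≡.cong (m ℕ.+_) (ℕ.+-identityʳ m))) (q^-+ m m)
  term : ∀ r → ω-term r ≐ δil (+ 1) 2 (even-term r) + ι (+ 2) * q^ 1 * δil (+ 1) 2 (odd-term r)
  term r = begin
    sgn r * (q^ (3 ℕ.* (r ℕ.* (r ℕ.+ 1))) * ratio (odd r))
      ≈⟨ *-congˡ (*-cong (q^-≡ (≡.trans (≡.cong (3 ℕ.*_) (≡.sym (2*tri r))) (ℕS.solve 1 (λ t → κ 3 ⊗ (κ 2 ⊗ t) ⊜ κ 2 ⊗ (κ 3 ⊗ t)) ≡.refl (tri r))))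
           (ratio-split (odd r) (s≤s z≤n))) ⟩
    sgn r * (A * (ratio (2 ℕ.* odd r) + ι (+ 2) * q^ odd r * G))
      ≈⟨ *-congˡ (*-congˡ (+-congˡ (*-congʳ (*-congˡ (q^-+ 1 (2 ℕ.* r)))))) ⟩
    sgn r * (A * (ratio (2 ℕ.* odd r) + ι (+ 2) * (q^ 1 * q^ (2 ℕ.* r)) * G))
      ≈⟨ solve 6 (λ s a p q t g → s :* (a :* (p :+ con (+ 2) :* (q :* t) :* g)) := s :* (a :* p) :+ con (+ 2) :* q :* (s :* (a :* t :* g))) refl (sgn r) A _ (q^ 1) _ _ ⟩
    sgn r * (A * ratio (2 ℕ.* odd r)) + ι (+ 2) * q^ 1 * (sgn r * (A * q^ (2 ℕ.* r) * G))
      ≈⟨ +-cong (sym (trans (D₂.D-* _ _) (*-cong (D₂.D-sgn r) (trans (D₂.D-* _ _) (*-cong (D₂.D-q _) (ratio-dilation 1 (odd r) (s≤s z≤n)))))))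
                (*-congˡ (sym (trans (D₂.D-* _ _) (*-cong (D₂.D-sgn r) (trans (D₂.D-* _ _) (*-cong
                  (trans (D₂.D-q _) (trans (q^-≡ (ℕ.*-distribˡ-+ 2 (3 ℕ.* tri r) r)) (q^-+ (2 ℕ.* (3 ℕ.* tri r)) _)))
                  (D₂.D-geo⁺ (s≤s z≤n)))))))) ⟩
    δil (+ 1) 2 (even-term r) + ι (+ 2) * q^ 1 * δil (+ 1) 2 (odd-term r) ∎
    where
    A G : PS
    A = q^ (2 ℕ.* (3 ℕ.* tri r))
    G = geo⁺ (2 ℕ.* odd r)

-- Theta series: product formulas and the bisection of φ

module J2 = Jacobi 2 (s≤s z≤n)
module J4 = Jacobi 4 (s≤s z≤n)
module T2 = ThetaTerms 2 (s≤s z≤n)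
module T4 = ThetaTerms 4 (s≤s z≤n)

-- With ψ(q) = Σ q^(n(n+1)/2) the latter two are φ(q²) and ψ(q⁴).
φ φ₂ ψ₄ : PS
φ  = 1# + ι (+ 2) * Σ∞ (λ l → q^ (suc l ℕ.* suc l))
φ₂ = 1# + ι (+ 2) * Σ∞ (λ l → q^ (2 ℕ.* (suc l ℕ.* suc l)))
ψ₄ = Σ∞ (λ l → q^ (2 ℕ.* (l ℕ.* (l ℕ.+ 1))))

private
  n≤[1+n]² : ∀ l → l ≤ suc l ℕ.* suc l
  n≤[1+n]² l = ℕ.≤-trans (ℕ.n≤1+n l) (ℕ.m≤m*n (suc l) (suc l))

  square-index : ∀ l → theta-exponent 2 1 l ≡ l ℕ.* l
  square-index zero    = ≡.refl
  square-index (suc l) = ≡.trans (≡.cong (ℕ._+ (1 ℕ.+ 2 ℕ.* l)) (square-index l))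
    (ℕS.solve 1 (λ l → l ⊗ l ⊕ (κ 1 ⊕ κ 2 ⊗ l) ⊜ (κ 1 ⊕ l) ⊗ (κ 1 ⊕ l)) ≡.refl l)

  double-square-index : ∀ l → theta-exponent 4 2 l ≡ 2 ℕ.* (l ℕ.* l)
  double-square-index zero    = ≡.refl
  double-square-index (suc l) = ≡.trans (≡.cong (ℕ._+ (2 ℕ.+ 4 ℕ.* l)) (double-square-index l))
    (ℕS.solve 1 (λ l → κ 2 ⊗ (l ⊗ l) ⊕ (κ 2 ⊕ κ 4 ⊗ l) ⊜ κ 2 ⊗ ((κ 1 ⊕ l) ⊗ (κ 1 ⊕ l))) ≡.refl l)

  pronic-index₀ : ∀ l → theta-exponent 4 0 (suc l) ≡ 2 ℕ.* (l ℕ.* (l ℕ.+ 1))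
  pronic-index₀ zero    = ≡.refl
  pronic-index₀ (suc l) = ≡.trans (≡.cong (ℕ._+ 4 ℕ.* suc l) (pronic-index₀ l))
    (ℕS.solve 1 (λ l → κ 2 ⊗ (l ⊗ (l ⊕ κ 1)) ⊕ κ 4 ⊗ (κ 1 ⊕ l) ⊜ κ 2 ⊗ ((κ 1 ⊕ l) ⊗ (κ 1 ⊕ l ⊕ κ 1))) ≡.refl l)

  pronic-index₄ : ∀ l → theta-exponent 4 4 l ≡ 2 ℕ.* (l ℕ.* (l ℕ.+ 1))
  pronic-index₄ zero    = ≡.refl
  pronic-index₄ (suc l) = ≡.trans (≡.cong (ℕ._+ (4 ℕ.+ 4 ℕ.* l)) (pronic-index₄ l))
    (ℕS.solve 1 (λ l → κ 2 ⊗ (l ⊗ (l ⊕ κ 1)) ⊕ (κ 4 ⊕ κ 4 ⊗ l) ⊜ κ 2 ⊗ ((κ 1 ⊕ l) ⊗ (κ 1 ⊕ l ⊕ κ 1))) ≡.refl l)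

  plus-inverse : ∀ {u} {g} → Factors u → Factors g → (∀ j → u j * g j ≐ 1#) → ∀ {X Y} → Π∞ g ≐ X → X * Y ≐ 1# → Π∞ u ≐ Y
  plus-inverse uf gf inv g≐ XY = inverse-unique (trans (*-comm _ _) (trans (*-congˡ (sym g≐)) (Π∞-inverse uf gf inv))) XY

φ-product : φ ≐ f₂ * square (e₁ * e₄ * (f₂ * f₂))
φ-product = sym (begin
  f₂ * square (e₁ * e₄ * (f₂ * f₂))
    ≈⟨ *-congˡ (*-cong (sym P) (sym P)) ⟩
  f₂ * (P⁺ 1 2 * P⁺ 1 2)
    ≈⟨ J2.jacobi-limit {q^ 1} {q^ 1} (sym (q^-+ 1 1)) (Pochhammer.Π-plus 2 (s≤s z≤n) 1 (s≤s z≤n)) (Pochhammer.Π-plus 2 (s≤s z≤n) 1 (s≤s z≤n)) ⟩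
  1# + (Σ∞ (λ l → Q2.T (q^ 1) (suc l)) + Σ∞ (λ l → Q2.T (q^ 1) (suc l)))
    ≈⟨ +-congˡ (trans (solve 1 (λ s → s :+ s := con (+ 2) :* s) refl _)
         (*-congˡ (Σ∞-cong (λ l → trans (T2.T-plus 1 (suc l)) (q^-≡ (square-index (suc l))))))) ⟩
  φ ∎)
  where
  open ≐-Reasoning
  P : P⁺ 1 2 ≐ e₁ * e₄ * (f₂ * f₂)
  P = plus-inverse (Pochhammer.plus-factors 2 (s≤s z≤n) 1 (s≤s z≤n)) h-factors (λ j → geo⁻-inverse (s≤s z≤n)) H≐
    (trans (solve 6 (λ f₁ f₄ e₂ e₁ e₄ f₂ → f₁ :* f₄ :* (e₂ :* e₂) :* (e₁ :* e₄ :* (f₂ :* f₂))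
       := (f₁ :* e₁) :* (f₄ :* e₄) :* (f₂ :* e₂) :* ((f₂ :* e₂) :* con (+ 1))) refl f₁ f₄ e₂ e₁ e₄ f₂)
      (trans (ones³ fe₁ fe₄ fe₂ _) (trans (*-identityʳ _) fe₂)))

φ₂-product : φ₂ ≐ f₄ * square (e₂ * e₈ * (f₄ * f₄))
φ₂-product = sym (begin
  f₄ * square (e₂ * e₈ * (f₄ * f₄))
    ≈⟨ *-congˡ (*-cong (sym P) (sym P)) ⟩
  f₄ * (P⁺ 2 4 * P⁺ 2 4)
    ≈⟨ J4.jacobi-limit {q^ 2} {q^ 2} (sym (q^-+ 2 2)) (Pochhammer.Π-plus 4 (s≤s z≤n) 2 (s≤s z≤n)) (Pochhammer.Π-plus 4 (s≤s z≤n) 2 (s≤s z≤n)) ⟩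
  1# + (Σ∞ (λ l → Q4.T (q^ 2) (suc l)) + Σ∞ (λ l → Q4.T (q^ 2) (suc l)))
    ≈⟨ +-congˡ (trans (solve 1 (λ s → s :+ s := con (+ 2) :* s) refl _)
         (*-congˡ (Σ∞-cong (λ l → trans (T4.T-plus 2 (suc l)) (q^-≡ (double-square-index (suc l))))))) ⟩
  φ₂ ∎)
  where
  open ≐-Reasoning
  P : P⁺ 2 4 ≐ e₂ * e₈ * (f₄ * f₄)
  P = plus-inverse (Pochhammer.plus-factors 4 (s≤s z≤n) 2 (s≤s z≤n)) two-factors (λ j → geo⁻-inverse (s≤s z≤n)) two-product
    (trans (solve 6 (λ f₂ f₈ e₄ e₂ e₈ f₄ → f₂ :* f₈ :* (e₄ :* e₄) :* (e₂ :* e₈ :* (f₄ :* f₄))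
       := (f₂ :* e₂) :* (f₈ :* e₈) :* (f₄ :* e₄) :* ((f₄ :* e₄) :* con (+ 1))) refl f₂ f₈ e₄ e₂ e₈ f₄)
      (trans (ones³ fe₂ fe₈ fe₄ _) (trans (*-identityʳ _) fe₄)))

-- At X = 1 the bilateral sum contains every term of ψ₄ twice, and the product starts with the
-- factor 1 + 1, which `unit` splits off. The doubled series is also what the odd half of φ
-- contains.
ψ₄-product : ι (+ 2) * ψ₄ ≐ ι (+ 2) * (f₄ * square (f₈ * e₄))
ψ₄-product = sym (begin
  ι (+ 2) * (f₄ * square (f₈ * e₄))
    ≈⟨ *-congˡ (*-congˡ (*-cong (sym P) (sym P))) ⟩
  ι (+ 2) * (f₄ * (P⁺ 4 4 * P⁺ 4 4))
    ≈⟨ solve 2 (λ f p → con (+ 2) :* (f :* (p :* p)) := f :* (p :* (con (+ 2) :* p))) refl _ _ ⟩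
  f₄ * (P⁺ 4 4 * (ι (+ 2) * P⁺ 4 4))
    ≈⟨ J4.jacobi-limit {1#} {q^ 4} (*-identityˡ _) unit (Pochhammer.Π-plus 4 (s≤s z≤n) 4 (s≤s z≤n)) ⟩
  1# + (Σ∞ (λ l → Q4.T (q^ 4) (suc l)) + Σ∞ (λ l → Q4.T 1# (suc l)))
    ≈⟨ +-congˡ (+-cong (Σ∞-cong (λ l → trans (T4.T-plus 4 (suc l)) (q^-≡ (pronic-index₄ (suc l)))))
         (Σ∞-cong (λ l → trans (T-cong (suc l)) (trans (T4.T-plus 0 (suc l)) (q^-≡ (pronic-index₀ l)))))) ⟩
  1# + (Σ∞ (λ l → t (suc l)) + ψ₄)
    ≈⟨ trans (sym (+-assoc _ _ _)) (+-congʳ (trans (+-congʳ (sym q^0)) (sym (Σ∞-first t-order)))) ⟩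
  ψ₄ + ψ₄
    ≈⟨ solve 1 (λ s → s :+ s := con (+ 2) :* s) refl _ ⟩
  ι (+ 2) * ψ₄ ∎)
  where
  open ≐-Reasoning
  t : ℕ → PS
  t l = q^ (2 ℕ.* (l ℕ.* (l ℕ.+ 1)))
  t-order : Terms t
  t-order l = q^-order≤ (ℕ.≤-trans (n≤n*[n+s] l 1) (ℕ.m≤n*m _ 2))
  T-cong : ∀ l → Q4.T 1# l ≐ Q4.T (q^ 0) l
  T-cong zero    = refl
  T-cong (suc l) = *-cong (T-cong l) (*-congʳ (sym q^0))
  unit : ∀ M → Π< (λ j → 1# + 1# * q^ (4 ℕ.* j)) (suc M) ≈[ suc M ] ι (+ 2) * P⁺ 4 4
  unit M = Mod.trans (≐⇒≈ (trans (𝒮.Π-first (λ j → 1# + 1# * q^ (4 ℕ.* j)) M)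
      (*-cong (trans (+-congˡ (*-congˡ q^0)) (solve 0 (con (+ 1) :+ con (+ 1) :* con (+ 1) := con (+ 2)) refl))
        (𝒮.Π-cong M (λ j → +-congˡ (trans (*-identityˡ _) (q^-≡ (ℕ.*-suc 4 j))))))))
    (*-modˡ (Π<≈Π∞ (Pochhammer.plus-factors 4 (s≤s z≤n) 4 (s≤s z≤n)) M))
  P : P⁺ 4 4 ≐ f₈ * e₄
  P = plus-inverse (Pochhammer.plus-factors 4 (s≤s z≤n) 4 (s≤s z≤n))
    (λ j → geo⁻-mod (ℕ.≤-trans (ℕ.m≤n*m (suc j) 4) (ℕ.≤-reflexive (ℕ.*-suc 4 j))))
    (λ j → geo⁻-inverse (s≤s z≤n))
    (trans (Π∞-cong (λ j → reflexive (≡.cong geo⁻ (≡.sym (ℕ.*-suc 4 j))))) four-product)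
    (trans (solve 4 (λ e₈ f₄ f₈ e₄ → e₈ :* f₄ :* (f₈ :* e₄) := (f₈ :* e₈) :* (f₄ :* e₄)) refl e₈ f₄ f₈ e₄)
      (trans (*-cong fe₈ fe₄) (*-identityˡ 1#)))

-- The summand with index l is the square of l + 1, so even l give the odd squares 1 + 4l(l+1) and
-- odd l the even ones.
φ-bisection : φ ≐ δil (+ 1) 2 φ₂ + q^ 1 * δil (+ 1) 2 (ι (+ 2) * ψ₄)
φ-bisection = begin
  1# + ι (+ 2) * Σ∞ (λ l → q^ (suc l ℕ.* suc l))
    ≈⟨ +-congˡ (*-congˡ (trans (Σ∞-2* {λ l → q^ (suc l ℕ.* suc l)} (λ l → q^-order≤ (n≤[1+n]² l))) (Σ∞-cong term))) ⟩
  1# + ι (+ 2) * Σ∞ (λ l → q^ 1 * δil (+ 1) 2 (t l) + δil (+ 1) 2 (t′ l))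
    ≈⟨ +-congˡ (*-congˡ (trans (Σ∞-+ _ _) (+-congʳ (Σ∞-*ˡ (q^ 1) (λ l → Mod.trans (D₂.D-mod (t-order l)) (≐⇒≈ D₂.D-0)))))) ⟩
  1# + ι (+ 2) * (q^ 1 * Σ∞ (λ l → δil (+ 1) 2 (t l)) + Σ∞ (λ l → δil (+ 1) 2 (t′ l)))
    ≈⟨ +-congˡ (*-congˡ (+-cong (*-congˡ (sym (D₂.D-Σ∞ t-order))) (sym (D₂.D-Σ∞ t′-order)))) ⟩
  1# + ι (+ 2) * (q^ 1 * δil (+ 1) 2 ψ₄ + δil (+ 1) 2 (Σ∞ t′))
    ≈⟨ solve 4 (λ o q a b → o :+ con (+ 2) :* (q :* a :+ b) := (o :+ con (+ 2) :* b) :+ q :* (con (+ 2) :* a)) refl _ _ _ _ ⟩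
  1# + ι (+ 2) * δil (+ 1) 2 (Σ∞ t′) + q^ 1 * (ι (+ 2) * δil (+ 1) 2 ψ₄)
    ≈⟨ +-cong (sym (trans (D₂.D-+ _ _) (+-cong D₂.D-1 (D-2 1 _)))) (*-congˡ (sym (D-2 1 _))) ⟩
  δil (+ 1) 2 φ₂ + q^ 1 * δil (+ 1) 2 (ι (+ 2) * ψ₄) ∎
  where
  open ≐-Reasoning
  t t′ : ℕ → PS
  t l = q^ (2 ℕ.* (l ℕ.* (l ℕ.+ 1)))
  t′ l = q^ (2 ℕ.* (suc l ℕ.* suc l))
  t-order : Terms t
  t-order l = q^-order≤ (ℕ.≤-trans (n≤n*[n+s] l 1) (ℕ.m≤n*m _ 2))
  t′-order : Terms t′
  t′-order l = q^-order≤ (ℕ.≤-trans (n≤[1+n]² l) (ℕ.m≤n*m _ 2))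
  term : ∀ l → q^ (suc (2 ℕ.* l) ℕ.* suc (2 ℕ.* l)) + q^ (suc (1 ℕ.+ 2 ℕ.* l) ℕ.* suc (1 ℕ.+ 2 ℕ.* l))
             ≐ q^ 1 * δil (+ 1) 2 (t l) + δil (+ 1) 2 (t′ l)
  term l = +-cong
    (trans (q^-≡ (ℕS.solve 1 (λ l → (κ 1 ⊕ κ 2 ⊗ l) ⊗ (κ 1 ⊕ κ 2 ⊗ l) ⊜ κ 1 ⊕ κ 2 ⊗ (κ 2 ⊗ (l ⊗ (l ⊕ κ 1)))) ≡.refl l))
      (trans (q^-+ 1 _) (*-congˡ (sym (D₂.D-q _)))))
    (trans (q^-≡ (ℕS.solve 1 (λ l → (κ 2 ⊕ κ 2 ⊗ l) ⊗ (κ 2 ⊕ κ 2 ⊗ l) ⊜ κ 2 ⊗ (κ 2 ⊗ ((κ 1 ⊕ l) ⊗ (κ 1 ⊕ l)))) ≡.refl l))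
      (sym (D₂.D-q _)))

e₃ Y₀ Y₁ : PS
e₃ = etaInv 3
Y₀ = e₃ * (f₂ * f₂ * e₁) * φ₂
Y₁ = e₃ * (f₂ * f₂ * e₁) * (ι (+ 2) * ψ₄)

-- In ψ²/f₆ = φ f₄²/(f₂ f₆) everything except φ is a series in q². Only φ has to be dissected, and
-- halving the exponents turns the cofactor into f₂²/(f₁ f₃).
ψ²-bisection : etaInv 6 * (f₂ * f₂ * Π∞ δ) ≐ δil (+ 1) 2 Y₀ + q^ 1 * δil (+ 1) 2 Y₁
ψ²-bisection = begin
  etaInv 6 * (f₂ * f₂ * Π∞ δ)
    ≈⟨ *-congˡ (*-congˡ δ≐) ⟩
  etaInv 6 * (f₂ * f₂ * square (e₁ * f₂))
    ≈⟨ sym (ones³ fe₂ fe₄ fe₄ _) ⟩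
  f₂ * e₂ * (f₄ * e₄) * (f₄ * e₄) * (etaInv 6 * (f₂ * f₂ * square (e₁ * f₂)))
    ≈⟨ solve 6 (λ f₂ e₂ f₄ e₄ e₆ e₁ → f₂ :* e₂ :* (f₄ :* e₄) :* (f₄ :* e₄) :* (e₆ :* (f₂ :* f₂ :* ((e₁ :* f₂) :* (e₁ :* f₂))))
         := e₆ :* (f₄ :* f₄ :* e₂) :* (f₂ :* ((e₁ :* e₄ :* (f₂ :* f₂)) :* (e₁ :* e₄ :* (f₂ :* f₂))))) refl f₂ e₂ f₄ e₄ (etaInv 6) e₁ ⟩
  etaInv 6 * (f₄ * f₄ * e₂) * (f₂ * square (e₁ * e₄ * (f₂ * f₂)))
    ≈⟨ *-congˡ (trans (sym φ-product) φ-bisection) ⟩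
  etaInv 6 * (f₄ * f₄ * e₂) * (δil (+ 1) 2 φ₂ + q^ 1 * δil (+ 1) 2 (ι (+ 2) * ψ₄))
    ≈⟨ solve 4 (λ a b q c → a :* (b :+ q :* c) := a :* b :+ q :* (a :* c)) refl _ _ _ _ ⟩
  etaInv 6 * (f₄ * f₄ * e₂) * δil (+ 1) 2 φ₂ + q^ 1 * (etaInv 6 * (f₄ * f₄ * e₂) * δil (+ 1) 2 (ι (+ 2) * ψ₄))
    ≈⟨ +-cong (collect φ₂) (*-congˡ (collect (ι (+ 2) * ψ₄))) ⟩
  δil (+ 1) 2 Y₀ + q^ 1 * δil (+ 1) 2 Y₁ ∎
  where
  open ≐-Reasoning
  collect : ∀ F → etaInv 6 * (f₄ * f₄ * e₂) * δil (+ 1) 2 F ≐ δil (+ 1) 2 (e₃ * (f₂ * f₂ * e₁) * F)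
  collect F = sym (trans (D₂.D-* _ _) (*-congʳ (trans (D₂.D-* _ _) (*-cong (D₂.D-etaInv 3 (s≤s z≤n))
    (trans (D₂.D-* _ _) (*-cong (trans (D₂.D-* _ _) (*-cong (D₂.D-eta 2 (s≤s z≤n)) (D₂.D-eta 2 (s≤s z≤n)))) (D₂.D-etaInv 1 (s≤s z≤n))))))))

-- Assembly of the even and odd parts of ξ

-- Here q² ω(q³) = q² W₀(q^6) + q q^4 W₁(q^6), so after halving the exponents the two parts receive
-- q W₀(q³) and q² W₁(q³).
ξ-bisection : ξ ≐ δil (+ 1) 2 (Y₀ + q^ 1 * δil (+ 1) 3 W₀) + q^ 1 * δil (+ 1) 2 (Y₁ + q^ 2 * δil (+ 1) 3 W₁)
ξ-bisection = begin
  ξ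
    ≈⟨ trans ξ-decomposition (+-cong ψ²-bisection (*-congˡ (sym ω-dilated))) ⟩
  δil (+ 1) 2 Y₀ + q^ 1 * δil (+ 1) 2 Y₁ + q^ 2 * δil (+ 1) 3 ω
    ≈⟨ +-congˡ (*-congˡ (trans (D₃.D-cong ω-bisection) (trans (D₃.D-+ _ _) (+-cong (commute W₀) (trans (D₃.D-* _ _) (*-cong (trans (D₃.D-q 1) (q^-+ 1 2)) (commute W₁))))))) ⟩
  δil (+ 1) 2 Y₀ + q^ 1 * δil (+ 1) 2 Y₁ + q^ 2 * (δil (+ 1) 2 (δil (+ 1) 3 W₀) + q^ 1 * q^ 2 * δil (+ 1) 2 (δil (+ 1) 3 W₁))
    ≈⟨ solve 6 (λ y q y′ qq w w′ → y :+ q :* y′ :+ qq :* (w :+ q :* qq :* w′) := (y :+ qq :* w) :+ q :* (y′ :+ qq :* qq :* w′)) refl _ _ _ _ _ _ ⟩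
  δil (+ 1) 2 Y₀ + q^ 2 * δil (+ 1) 2 (δil (+ 1) 3 W₀) + q^ 1 * (δil (+ 1) 2 Y₁ + q^ 2 * q^ 2 * δil (+ 1) 2 (δil (+ 1) 3 W₁))
    ≈⟨ +-cong (sym (trans (D₂.D-+ _ _) (+-congˡ (trans (D₂.D-* _ _) (*-congʳ (D₂.D-q 1))))))
              (*-congˡ (sym (trans (D₂.D-+ _ _) (+-congˡ (trans (D₂.D-* _ _) (*-congʳ (trans (D₂.D-q 2) (q^-+ 2 2)))))))) ⟩
  δil (+ 1) 2 (Y₀ + q^ 1 * δil (+ 1) 3 W₀) + q^ 1 * δil (+ 1) 2 (Y₁ + q^ 2 * δil (+ 1) 3 W₁) ∎
  where
  open ≐-Reasoning
  commute : ∀ F → δil (+ 1) 3 (δil (+ 1) 2 F) ≐ δil (+ 1) 2 (δil (+ 1) 3 F)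
  commute F = trans (D-compose (+ 1) 2 1 F) (sym (D-compose (+ 1) 1 2 F))

D₃-eta^ : ∀ m n → 1 ≤ m → δil (+ 1) 3 (eta m ^ n) ≐ eta (3 ℕ.* m) ^ n
D₃-eta^ m n 1≤m = trans (D-^ 2 _ n) (^-congˡ n (D₃.D-eta m 1≤m))

D₃-etaInv^ : ∀ m n → 1 ≤ m → δil (+ 1) 3 (etaInv m ^ n) ≐ etaInv (3 ℕ.* m) ^ n
D₃-etaInv^ m n 1≤m = trans (D-^ 2 _ n) (^-congˡ n (D₃.D-etaInv m 1≤m))

D₃-* : ∀ {F G F′ G′} → δil (+ 1) 3 F ≐ F′ → δil (+ 1) 3 G ≐ G′ → δil (+ 1) 3 (F * G) ≐ F′ * G′
D₃-* e e′ = trans (D₃.D-* _ _) (*-cong e e′)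

D₃-- : ∀ {F G F′ G′} → δil (+ 1) 3 F ≐ F′ → δil (+ 1) 3 G ≐ G′ → δil (+ 1) 3 (F - G) ≐ F′ - G′
D₃-- e e′ = trans (D₃.D-+ _ _) (+-cong e (trans (D₃.D-⊝ _) (-‿cong e′)))

W₀-dilated : δil (+ 1) 3 W₀ ≐ eta 6 ^ 8 * eta 24 ^ 2 * e₃ ^ 4 * etaInv 12 ^ 5 - q^ 3 * δil (ℤ.- + 1) 6 ω
W₀-dilated = trans (D₃.D-cong W₀-product) (D₃--
  (D₃-* (D₃-* (D₃-* (D₃-eta^ 2 8 (s≤s z≤n)) (D₃-eta^ 8 2 (s≤s z≤n))) (D₃-etaInv^ 1 4 (s≤s z≤n))) (D₃-etaInv^ 4 5 (s≤s z≤n)))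
  (D₃-* (D₃.D-q 1) (trans (D₃.D-cong (sym ω-at-minus-q²)) (D-compose (ℤ.- + 1) 2 1 ω))))

W₁-dilated : ι (+ 2) * (q^ 3 * δil (+ 1) 3 W₁) ≐ eta 6 ^ 6 * eta 12 * e₃ ^ 4 * etaInv 24 ^ 2 - δil (+ 1) 12 fmock
W₁-dilated = trans (sym (trans (D-2 2 _) (*-congˡ (D₃-* (D₃.D-q 1) refl)))) (trans (D₃.D-cong W₁-product) (D₃--
  (D₃-* (D₃-* (D₃-* (D₃-eta^ 2 6 (s≤s z≤n)) (D₃.D-eta 4 (s≤s z≤n))) (D₃-etaInv^ 1 4 (s≤s z≤n))) (D₃-etaInv^ 8 2 (s≤s z≤n)))
  (trans (D₃.D-cong (sym fmock-dilated)) (D-compose (+ 1) 2 3 fmock))))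

private
  *ₛ-to : ∀ {F G F′ G′} → F ≐ F′ → G ≐ G′ → F *ₛ G ≐ F′ * G′
  *ₛ-to e e′ = trans (*ₛ≐ _ _) (*-cong e e′)

  +ₛ-to : ∀ {F G F′ G′} → F ≐ F′ → G ≐ G′ → F +ₛ G ≐ F′ + G′
  +ₛ-to e e′ = trans (+ₛ≐ _ _) (+-cong e e′)

  -ₛ-to : ∀ {F G F′ G′} → F ≐ F′ → G ≐ G′ → F -ₛ G ≐ F′ - G′
  -ₛ-to e e′ = trans (-ₛ≐ _ _) (+-cong e (-‿cong e′))

  ^ₛ-to : ∀ {F G} n → F ≐ G → F ^ₛ n ≐ G ^ n
  ^ₛ-to zero    e = 1ₛ≐
  ^ₛ-to (suc n) e = *ₛ-to e (^ₛ-to n e)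

evenSeries≐ : evenSeries ≐ Y₀ + q^ 1 * δil (+ 1) 3 W₀
evenSeries≐ = ptw (proj₁ (parity ξ-bisection))

oddSeries≐ : oddSeries ≐ q^ 1 * (ι (+ 2) * (Y₁ + q^ 2 * δil (+ 1) 3 W₁))
oddSeries≐ = ptw coefficient
  where
  X : PS
  X = Y₁ + q^ 2 * δil (+ 1) 3 W₁
  coefficient : ∀ n → oddSeries n ≡ (q^ 1 * (ι (+ 2) * X)) n
  coefficient zero    = ≡.sym (q^-⊛-< 1 (ι (+ 2) * X) 0 (s≤s z≤n))
  coefficient (suc m) = ≡.trans (≡.cong (+ 2 ℤ.*_) (proj₂ (parity ξ-bisection) m))
    (≡.trans (at (·ₛ2≐ X) m) (≡.sym (q^-⊛-≥ 1 (ι (+ 2) * X) (suc m) (s≤s z≤n))))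

-- `W₁-dilated` determines W₁(q³) only through the multiple 2q³. The factor 2q built into
-- `oddSeries` and the q² from `ξ-bisection` supply exactly this multiple, so nothing has to be
-- divided.
odd-identity : oddSeries ≐ eta 6 ^ 6 * eta 12 * e₃ ^ 4 * etaInv 24 ^ 2 - δil (+ 1) 12 fmock
  + ι (+ 4) * (q^ 1 * f₂ ^ 2 * f₈ ^ 2 * e₁ * e₃ * e₄)
odd-identity = begin
  oddSeries
    ≈⟨ oddSeries≐ ⟩
  q^ 1 * (ι (+ 2) * (e₃ * (f₂ * f₂ * e₁) * (ι (+ 2) * ψ₄) + q^ 2 * δil (+ 1) 3 W₁))
    ≈⟨ *-congˡ (*-congˡ (+-congʳ (*-congˡ ψ₄-product))) ⟩
  q^ 1 * (ι (+ 2) * (e₃ * (f₂ * f₂ * e₁) * (ι (+ 2) * (f₄ * square (f₈ * e₄))) + q^ 2 * δil (+ 1) 3 W₁))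
    ≈⟨ solve 9 (λ q e₃ f₂ e₁ f₄ f₈ e₄ qq w → q :* (con (+ 2) :* (e₃ :* (f₂ :* f₂ :* e₁) :* (con (+ 2) :* (f₄ :* ((f₈ :* e₄) :* (f₈ :* e₄)))) :+ qq :* w))
         := con (+ 2) :* (q :* qq :* w) :+ (f₄ :* e₄) :* (con (+ 4) :* (q :* f₂ :^ 2 :* f₈ :^ 2 :* e₁ :* e₃ :* e₄))) refl (q^ 1) e₃ f₂ e₁ f₄ f₈ e₄ (q^ 2) (δil (+ 1) 3 W₁) ⟩
  ι (+ 2) * (q^ 1 * q^ 2 * δil (+ 1) 3 W₁) + f₄ * e₄ * (ι (+ 4) * (q^ 1 * f₂ ^ 2 * f₈ ^ 2 * e₁ * e₃ * e₄))
    ≈⟨ +-cong (trans (*-congˡ (*-congʳ (sym (q^-+ 1 2)))) W₁-dilated) (trans (*-congʳ fe₄) (*-identityˡ _)) ⟩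
  eta 6 ^ 6 * eta 12 * e₃ ^ 4 * etaInv 24 ^ 2 - δil (+ 1) 12 fmock + ι (+ 4) * (q^ 1 * f₂ ^ 2 * f₈ ^ 2 * e₁ * e₃ * e₄) ∎
  where open ≐-Reasoning

-- The contribution q W₀(q³) brings both the product with f₆^8 and, since W₀ contains -q ω(-q²), the
-- term -q q³ ω(-q^6). The remaining product is φ(q²) times f₂²/(f₁ f₃), where f₂ cancels.
even-identity : evenSeries ≐ q^ 1 * eta 6 ^ 8 * eta 24 ^ 2 * e₃ ^ 4 * etaInv 12 ^ 5 - q^ 4 * δil (ℤ.- + 1) 6 ω
  + f₄ ^ 5 * e₁ * e₃ * e₈ ^ 2
even-identity = begin
  evenSeries
    ≈⟨ evenSeries≐ ⟩
  e₃ * (f₂ * f₂ * e₁) * φ₂ + q^ 1 * δil (+ 1) 3 W₀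
    ≈⟨ +-cong (*-congˡ φ₂-product) (*-congˡ W₀-dilated) ⟩
  e₃ * (f₂ * f₂ * e₁) * (f₄ * square (e₂ * e₈ * (f₄ * f₄)))
    + q^ 1 * (eta 6 ^ 8 * eta 24 ^ 2 * e₃ ^ 4 * etaInv 12 ^ 5 - q^ 3 * δil (ℤ.- + 1) 6 ω)
    ≈⟨ +-cong (solve 6 (λ e₃ f₂ e₁ f₄ e₂ e₈ → e₃ :* (f₂ :* f₂ :* e₁) :* (f₄ :* ((e₂ :* e₈ :* (f₄ :* f₄)) :* (e₂ :* e₈ :* (f₄ :* f₄))))
           := (f₂ :* e₂) :^ 2 :* (f₄ :^ 5 :* e₁ :* e₃ :* e₈ :^ 2)) refl e₃ f₂ e₁ f₄ e₂ e₈)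
         (solve 7 (λ q a b c d r w → q :* (a :* b :* c :* d :- r :* w) := q :* a :* b :* c :* d :- q :* r :* w) refl _ _ _ _ _ _ _) ⟩
  (f₂ * e₂) ^ 2 * (f₄ ^ 5 * e₁ * e₃ * e₈ ^ 2)
    + (q^ 1 * eta 6 ^ 8 * eta 24 ^ 2 * e₃ ^ 4 * etaInv 12 ^ 5 - q^ 1 * q^ 3 * δil (ℤ.- + 1) 6 ω)
    ≈⟨ trans (+-comm _ _) (+-cong (+-congˡ (-‿cong (*-congʳ (sym (q^-+ 1 3))))) (trans (*-congʳ (^-one 2 fe₂)) (*-identityˡ _))) ⟩
  q^ 1 * eta 6 ^ 8 * eta 24 ^ 2 * e₃ ^ 4 * etaInv 12 ^ 5 - q^ 4 * δil (ℤ.- + 1) 6 ω + f₄ ^ 5 * e₁ * e₃ * e₈ ^ 2 ∎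
  where open ≐-Reasoning

open import Data.Integer using (-_)

theorem3p1 : ((n : ℕ) →
    oddSeries n
    ≡ ((fq 6 ^ₛ 6 *ₛ fq 12 *ₛ fqInv 3 ^ₛ 4 *ₛ fqInv 24 ^ₛ 2)
    -ₛ dil (+ 1) 12 fmock
    +ₛ (+ 4) ·ₛ (qpow 1 *ₛ fq 2 ^ₛ 2 *ₛ fq 8 ^ₛ 2 *ₛ fqInv 1 *ₛ fqInv 3 *ₛ fqInv 4)) n)
    × ((n : ℕ) →
    evenSeries n
    ≡ ((qpow 1 *ₛ fq 6 ^ₛ 8 *ₛ fq 24 ^ₛ 2 *ₛ fqInv 3 ^ₛ 4 *ₛ fqInv 12 ^ₛ 5)
    -ₛ qpow 4 *ₛ dil (- + 1) 6 ω
    +ₛ (fq 4 ^ₛ 5 *ₛ fqInv 1 *ₛ fqInv 3 *ₛ fqInv 8 ^ₛ 2)) n)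
theorem3p1 =
  at (trans odd-identity (sym (+ₛ-to
    (-ₛ-to (*ₛ-to (*ₛ-to (*ₛ-to (^ₛ-to 6 (fq≐ 6)) (fq≐ 12)) (^ₛ-to 4 (fqInv≐ 3))) (^ₛ-to 2 (fqInv≐ 24))) (dil≐ (+ 1) 12 fmock))
    (trans (·ₛ4≐ _) (*-congˡ (*ₛ-to (*ₛ-to (*ₛ-to (*ₛ-to (*ₛ-to (qpow≐ 1) (^ₛ-to 2 (fq≐ 2))) (^ₛ-to 2 (fq≐ 8))) (fqInv≐ 1)) (fqInv≐ 3)) (fqInv≐ 4)))))))
  , at (trans even-identity (sym (+ₛ-to
    (-ₛ-to (*ₛ-to (*ₛ-to (*ₛ-to (*ₛ-to (qpow≐ 1) (^ₛ-to 8 (fq≐ 6))) (^ₛ-to 2 (fq≐ 24))) (^ₛ-to 4 (fqInv≐ 3))) (^ₛ-to 5 (fqInv≐ 12)))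
           (*ₛ-to (qpow≐ 4) (dil≐ (- + 1) 6 ω)))
    (*ₛ-to (*ₛ-to (*ₛ-to (^ₛ-to 5 (fq≐ 4)) (fqInv≐ 1)) (fqInv≐ 3)) (^ₛ-to 2 (fqInv≐ 8))))))
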